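{- Let $X$ be any one of the following types: $[3^7]$, $[3^5,4^1]$, $[3^4,4^2]$, $[3^3,4^1,3^1,4^1]$, $[3^5,5^1]$, $[3^4,7^1]$, $[3^4,8^1]$, $[3^4,9^1]$, $[3^4,10^1]$, $[3^2,5^1,3^1,5^1]$, $[3^3,4^1,6^1]$, $[3^2,4^1,3^1,6^1]$, $[3^1,4^1,3^1,4^2]$, $[3^1,4^4]$, $[3^1,7^1,3^1,7^1]$, $[3^1,4^1,7^1,4^1]$, $[3^1,4^1,8^1,4^1]$, $[4^3,5^1]$, $[3^1,4^1,9^1,4^1]$, $[3^1,4^1,10^1,4^1]$, $[3^1,5^3]$, $[3^1,6^1,4^1,6^1]$, $[4^1,6^1,18^1]$, $[4^3,6^1]$, $[5^1,4^1,5^1,4^1]$, $[4^1,6^1,14^1]$, $[4^1,6^1,16^1]$, $[4^1,6^1,20^1]$, $[4^1,8^1,10^1]$, $[4^1,8^1,12^1]$, $[6^2,7^1]$, $[8^1,6^2]$, $[9^1,6^2]$, $[10^1,6^2]$, $[5^1,8^2]$, $[6^1,8^2]$, $[4^1,10^2]$, $[3^1,14^2]$, $[7^3]$. Then for every $m=2,3,4,\dots$ there exists a semi-equivelar map $\mathcal{K}^m$ of type $X$ (an $m$-covering map of a semi-equivelar map $\mathcal{K}$ of type $X$ on a surface of Euler characteristic $-2$) on a surface with Euler characteristic $\chi=-2m$, and $\mathrm{Aut}(\mathcal{K}^m)\cong\mathbb{D}_m$ (the dihedral group of order $2m$) or $\mathrm{Aut}(\mathcal{K}^m)\cong\mathbb{Z}_m$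 (the cyclic group of order $m$).
   Context: A surface is a connected closed 2-manifold (orientable or not). A map is a connected 2-dimensional cell complex on a surface (equivalently, a cellular embedding of a connected graph). All maps are polyhedral: a non-empty intersection of two distinct faces is either a vertex or an edge. Face-cycle, type: the faces containing a vertex $u$ form a cycle (the face-cycle at $u$) of the form $(F_{1,1}-\cdots-F_{1,n_1})-\cdots-(F_{k,1}-\cdots-F_{k,n_k})-F_{1,1}$, where $F_{i,\ell}$ is a $p_i$-gon for $1\le \ell\le n_i$, $1\le i\le k$, $p_r\ne p_{r+1}$ for $1\le r\le k-1$ and $p_k\ne p_1$ (if $k>1$). A map is semi-equivelar of type $[p_1^{n_1},\dots,p_k^{n_k}]$ ($p_i\ge 3$, $n_i\ge1$) if the face-cycle at every vertex has this form with the same cyclic sequence; types are considered up to cyclic rotation and reversal. $\mathrm{Aut}(\mathcal{K})$ is the group, under composition, of automorphisms of $\mathcal{K}$: bijections of the vertex set that map cells (edges, faces) to cells and preserve incidence, in both directions. Cycles: a cycle in a map is contractible if it bounds a 2-disk; genus-separating if it does not bound a 2-disk but separates the surface; non-trivial if it neither bounds a 2-disk nor is genus-separating. $\ell$-covering map $\mathcal{K}^{\ell}$: let $C$ be a non-trivial cycle of length $k$ in $\mathcal{K}$ which divides the face-cycles of its vertices, i.e. for every sub-path $u-v-w$ of length two of $C$, the path $u-v-w$ is a chord of the disk formed by the faces at $v$ (it splits the face-cycle of $v$ into faces on the two sides of $C$). Cut $\mathcal{K}$ along $C$ to get a map $\mathcal{M}$ with two boundary cycles $A(p_1,\dots,p_k)$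 and $B(q_1,\dots,q_k)$, where $p_i$ and $q_i$ come from the same vertex of $C$. Take $\ell$ copies $\mathcal{M}_1,\dots,\mathcal{M}_\ell$ of $\mathcal{M}$ with boundary cycles $A_i(p^i_1,\dots,p^i_k)$ and $B_i(q^i_1,\dots,q^i_k)$, and identify $B_i$ with $A_{i+1}$ via $q^i_j\mapsto p^{i+1}_j$ for $1\le i\le \ell$ (indices $i$ modulo $\ell$). The resulting map is called an $\ell$-covering map $\mathcal{K}^\ell$ of $\mathcal{K}$. -}

module Defs where

open import Algebra.Bundles using (Group)
open import Algebra.Morphism.Structures using (module GroupMorphisms)
open import Data.Fin.Base using (Fin; toℕ; cast)
open import Data.Fin.Properties as Fin using (any?)
open import Data.Integer.Base as ℤ using (ℤ; +_; 0ℤ)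
open import Data.Integer.Divisibility.Signed using (_∣_; divides)
open import Data.Integer.Tactic.RingSolver using (solve-∀)
open import Data.List.Base using (List; []; _∷_; length; lookup; concatMap; replicate)
open import Data.List.Membership.Propositional using (_∈_; _∉_)
open import Data.List.Relation.Unary.All using (All)
open import Data.List.Relation.Unary.Unique.Propositional using (Unique)
open import Data.Nat.Base using (ℕ; suc; _≤_; _<_)
open import Data.Nat.DivMod using (_mod_)
open import Data.Product.Base using (Σ; Σ-syntax; ∃; ∃-syntax; _×_; _,_; proj₁; proj₂)
open import Data.Sign.Base as Sign using (Sign)
import Data.Sign.Properties as Sign
open import Data.Sum.Base using (_⊎_)
open import Function.Base using (id; _∘_)
open import Function.Bundles using (_↔_; _⇔_; mk⇔; Inverse; Equivalence)
open import Function.Construct.Composition using (_↔-∘_; _⇔-∘_)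
open import Function.Construct.Identity using (↔-id)
open import Function.Construct.Symmetry using (↔-sym)
open import Function.Properties.Inverse using (↔⇒↣)
open import Level using (0ℓ)
open import Relation.Binary.Construct.Closure.Equivalence using (EqClosure)
open import Relation.Binary.Construct.Closure.ReflexiveTransitive using (Star)
open import Relation.Binary.Definitions using (DecidableEquality)
open import Relation.Binary.PropositionalEquality
  using (_≡_; _≢_; refl; sym; trans; cong; subst; subst₂)
open import Relation.Nullary.Decidable using (yes; no; via-injection)
open import Relation.Nullary.Negation using (¬_)

-- Cyclic successor: i ↦ i + 1 modulo n.
next : ∀ {n} → Fin n → Fin n
next {suc n} i = suc (toℕ i) mod suc n

------------------------------------------------------------------------
-- Cell complexes

-- A face is a polygon, given by the cyclic sequence of its corners; the
-- starting corner and the direction are presentation choices.  Distinct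
-- cells are distinct elements of Vertex, Edge and Face.
record Complex : Set₁ where
  field
    Vertex Edge Face : Set
    #V #E #F         : ℕ
    finite-V         : Vertex ↔ Fin #V
    finite-E         : Edge ↔ Fin #E
    finite-F         : Face ↔ Fin #F
    ends             : Edge → Vertex × Vertex
    deg              : Face → ℕ
    corner           : (f : Face) → Fin (deg f) → Vertex

  -- The end points of an edge are unordered.
  Joins : Edge → Vertex → Vertex → Set
  Joins e u v = ends e ≡ (u , v) ⊎ ends e ≡ (v , u)

  infix 4 _∈ᴱ_ _∈ᶠ_ _⊂ᶠ_ _≟ⱽ_

  _∈ᴱ_ : Vertex → Edge → Set
  v ∈ᴱ e = v ≡ proj₁ (ends e) ⊎ v ≡ proj₂ (ends e)

  _∈ᶠ_ : Vertex → Face → Set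
  v ∈ᶠ f = ∃[ i ] corner f i ≡ v

  _⊂ᶠ_ : Edge → Face → Set
  e ⊂ᶠ f = ∃[ i ] Joins e (corner f i) (corner f (next i))

  Adjacent : Vertex → Vertex → Set
  Adjacent u v = ∃[ e ] Joins e u v

  _≟ⱽ_ : DecidableEquality Vertex
  _≟ⱽ_ = via-injection (↔⇒↣ finite-V) Fin._≟_

  χ : ℤ
  χ = (+ #V) ℤ.- (+ #E) ℤ.+ (+ #F)

  -- The faces containing u, arranged in a cycle of length n in which
  -- consecutive faces meet along an edge through u.
  record FaceCycle (u : Vertex) (n : ℕ) : Set where
    field
      face       : Fin n → Face
      n≥3        : 3 ≤ n
      injective  : ∀ {i j} → face i ≡ face j → i ≡ j
      complete   : ∀ f → u ∈ᶠ f ⇔ (∃[ i ] face i ≡ f)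
      meet       : ∀ i → ∃[ e ] (u ∈ᴱ e × e ⊂ᶠ face i × e ⊂ᶠ face (next i))

-- Polyhedral maps on surfaces.  The underlying space is a closed
-- 2-manifold because each edge lies on exactly two faces and the faces
-- around each vertex form a single cycle.
record IsPolyhedralMap (K : Complex) : Set where
  open Complex K
  field
    basepoint        : Vertex
    loopless         : ∀ {e u v} → Joins e u v → u ≢ v
    simple           : ∀ {e e′ u v} → Joins e u v → Joins e′ u v → e ≡ e′
    polygon          : ∀ f → 3 ≤ deg f
    corner-injective : ∀ f {i j} → corner f i ≡ corner f j → i ≡ j
    boundary-edge    : ∀ f i → Adjacent (corner f i) (corner f (next i))
    two-faces        : ∀ e → ∃[ f ] ∃[ g ] (f ≢ g × e ⊂ᶠ f × e ⊂ᶠ g ×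
                         (∀ h → e ⊂ᶠ h → h ≡ f ⊎ h ≡ g))
    face-cycle       : ∀ u → ∃[ n ] FaceCycle u n
    connected        : ∀ u v → Star Adjacent u v
    polyhedral       : ∀ {f g} → f ≢ g → (∃[ v ] (v ∈ᶠ f × v ∈ᶠ g)) →
                         (∃[ v ] ∀ w → (w ∈ᶠ f × w ∈ᶠ g) ⇔ w ≡ v) ⊎
                         (∃[ e ] (e ⊂ᶠ f × e ⊂ᶠ g ×
                            (∀ w → (w ∈ᶠ f × w ∈ᶠ g) ⇔ w ∈ᴱ e)))

record PolyhedralMap : Set₁ where
  field
    complex         : Complex
    isPolyhedralMap : IsPolyhedralMap complex
  open Complex complex public
  open IsPolyhedralMap isPolyhedralMap public

------------------------------------------------------------------------
-- Semi-equivelar maps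

-- [p₁^n₁, …, p_k^n_k] is the list of the pairs (pᵢ , nᵢ).
VertexType : Set
VertexType = List (ℕ × ℕ)

record ProperType (X : VertexType) : Set where
  field
    bounds   : All (λ (p , n) → 3 ≤ p × 1 ≤ n) X
    distinct : 1 < length X → ∀ r → proj₁ (lookup X r) ≢ proj₁ (lookup X (next r))

expand : VertexType → List ℕ
expand = concatMap (λ (p , n) → replicate n p)

-- The face-cycle at u is existentially quantified, so its starting face
-- and its direction may be chosen freely at each vertex.
SemiEquivelar : PolyhedralMap → VertexType → Set
SemiEquivelar K X = ProperType X ×
  (∀ u → Σ[ c ∈ FaceCycle u (length (expand X)) ]
           ∀ i → deg (FaceCycle.face c i) ≡ lookup (expand X) i)
  where open PolyhedralMap K

------------------------------------------------------------------------
-- Automorphism groups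

-- onE and onF record where edges and faces go; as maps of vertices two
-- automorphisms are identified when they agree on vertices (see Aut).
record Automorphism (K : PolyhedralMap) : Set where
  open PolyhedralMap K
  field
    onV : Vertex ↔ Vertex
    onE : Edge ↔ Edge
    onF : Face ↔ Face
    V∈E : ∀ v e → v ∈ᴱ e ⇔ Inverse.to onV v ∈ᴱ Inverse.to onE e
    V∈F : ∀ v f → v ∈ᶠ f ⇔ Inverse.to onV v ∈ᶠ Inverse.to onF f
    E⊂F : ∀ e f → e ⊂ᶠ f ⇔ Inverse.to onE e ⊂ᶠ Inverse.to onF f

private
  -- Incidence preserved by a pair of bijections is preserved by the
  -- inverse pair.
  invert : {P Q : Set} (R : P → Q → Set) (α : P ↔ P) (β : Q ↔ Q) →
           (∀ x y → R x y ⇔ R (Inverse.to α x) (Inverse.to β y)) →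
           ∀ x y → R x y ⇔ R (Inverse.from α x) (Inverse.from β y)
  invert R α β pres x y = mk⇔
    (Equivalence.from (pres _ _) ∘
      subst₂ R (sym (Inverse.strictlyInverseˡ α x)) (sym (Inverse.strictlyInverseˡ β y)))
    (subst₂ R (Inverse.strictlyInverseˡ α x) (Inverse.strictlyInverseˡ β y) ∘
      Equivalence.to (pres _ _))

module _ (K : PolyhedralMap) where
  open PolyhedralMap K
  open Automorphism

  idᴬ : Automorphism K
  idᴬ = record
    { onV = ↔-id _ ; onE = ↔-id _ ; onF = ↔-id _
    ; V∈E = λ _ _ → mk⇔ id id
    ; V∈F = λ _ _ → mk⇔ id id
    ; E⊂F = λ _ _ → mk⇔ id id
    }

  infixr 9 _∘ᴬ_

  _∘ᴬ_ : Automorphism K → Automorphism K → Automorphism K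
  φ ∘ᴬ ψ = record
    { onV = onV φ ↔-∘ onV ψ ; onE = onE φ ↔-∘ onE ψ ; onF = onF φ ↔-∘ onF ψ
    ; V∈E = λ v e → V∈E φ _ _ ⇔-∘ V∈E ψ v e
    ; V∈F = λ v f → V∈F φ _ _ ⇔-∘ V∈F ψ v f
    ; E⊂F = λ e f → E⊂F φ _ _ ⇔-∘ E⊂F ψ e f
    }

  invᴬ : Automorphism K → Automorphism K
  invᴬ φ = record
    { onV = ↔-sym (onV φ) ; onE = ↔-sym (onE φ) ; onF = ↔-sym (onF φ)
    ; V∈E = invert _∈ᴱ_ (onV φ) (onE φ) (V∈E φ)
    ; V∈F = invert _∈ᶠ_ (onV φ) (onF φ) (V∈F φ)
    ; E⊂F = invert _⊂ᶠ_ (onE φ) (onF φ) (E⊂F φ)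
    }

  Aut : Group 0ℓ 0ℓ
  Aut = record
    { Carrier = Automorphism K
    ; _≈_     = λ φ ψ → ∀ v → Inverse.to (onV φ) v ≡ Inverse.to (onV ψ) v
    ; _∙_     = _∘ᴬ_
    ; ε       = idᴬ
    ; _⁻¹     = invᴬ
    ; isGroup = record
      { isMonoid = record
        { isSemigroup = record
          { isMagma = record
            { isEquivalence = record
              { refl  = λ _ → refl
              ; sym   = λ p v → sym (p v)
              ; trans = λ p q v → trans (p v) (q v)
              }
            ; ∙-cong = λ {φ} {_} {_} {ψ′} p q v →
                trans (cong (Inverse.to (onV φ)) (q v)) (p (Inverse.to (onV ψ′) v))
            }
          ; assoc = λ _ _ _ _ → refl
          }
        ; identity = (λ _ _ → refl) , (λ _ _ → refl)
        }
      ; inverse = (λ φ → Inverse.strictlyInverseʳ (onV φ))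
                , (λ φ → Inverse.strictlyInverseˡ (onV φ))
      ; ⁻¹-cong = λ {φ} {ψ} p v →
          trans (cong (Inverse.from (onV φ))
                  (trans (sym (Inverse.strictlyInverseˡ (onV ψ) v))
                         (sym (p (Inverse.from (onV ψ) v)))))
                (Inverse.strictlyInverseʳ (onV φ) (Inverse.from (onV ψ) v))
      }
    }

infix 4 _≅_

_≅_ : Group 0ℓ 0ℓ → Group 0ℓ 0ℓ → Set
G ≅ H = Σ[ θ ∈ (Group.Carrier G → Group.Carrier H) ] IsGroupIsomorphism θ
  where open GroupMorphisms (Group.rawGroup G) (Group.rawGroup H)

------------------------------------------------------------------------
-- Cyclic and dihedral groups

infixr 8 _⊙_

_⊙_ : Sign → ℤ → ℤ
Sign.+ ⊙ a = a
Sign.- ⊙ a = ℤ.- a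

module _ (m : ℕ) where

  infix 4 _≡ₘ_

  _≡ₘ_ : ℤ → ℤ → Set
  a ≡ₘ b = (+ m) ∣ (a ℤ.- b)

  private
    reflₘ : ∀ {a b} → a ≡ b → a ≡ₘ b
    reflₘ {a} refl = divides 0ℤ (lemma a)
      where
      lemma : ∀ a → a ℤ.- a ≡ 0ℤ
      lemma = solve-∀

    symₘ : ∀ {a b} → a ≡ₘ b → b ≡ₘ a
    symₘ {a} {b} (divides k eq) =
      divides (ℤ.- k) (trans (lemma a b) (trans (cong ℤ.-_ eq) (lemma′ k (+ m))))
      where
      lemma : ∀ a b → b ℤ.- a ≡ ℤ.- (a ℤ.- b)
      lemma = solve-∀
      lemma′ : ∀ k n → ℤ.- (k ℤ.* n) ≡ (ℤ.- k) ℤ.* n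
      lemma′ = solve-∀

    +-lemma : ∀ k l n → k ℤ.* n ℤ.+ l ℤ.* n ≡ (k ℤ.+ l) ℤ.* n
    +-lemma = solve-∀

    transₘ : ∀ {a b c} → a ≡ₘ b → b ≡ₘ c → a ≡ₘ c
    transₘ {a} {b} {c} (divides k eq) (divides l eq′) =
      divides (k ℤ.+ l) (trans (lemma a b c)
        (trans (cong (ℤ._+ (b ℤ.- c)) eq) (trans (cong (λ z → k ℤ.* + m ℤ.+ z) eq′) (+-lemma k l (+ m)))))
      where
      lemma : ∀ a b c → a ℤ.- c ≡ (a ℤ.- b) ℤ.+ (b ℤ.- c)
      lemma = solve-∀

    +-congₘ : ∀ {a b c d} → a ≡ₘ b → c ≡ₘ d → (a ℤ.+ c) ≡ₘ (b ℤ.+ d)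
    +-congₘ {a} {b} {c} {d} (divides k eq) (divides l eq′) =
      divides (k ℤ.+ l) (trans (lemma a b c d)
        (trans (cong (ℤ._+ (c ℤ.- d)) eq) (trans (cong (λ z → k ℤ.* + m ℤ.+ z) eq′) (+-lemma k l (+ m)))))
      where
      lemma : ∀ a b c d → (a ℤ.+ c) ℤ.- (b ℤ.+ d) ≡ (a ℤ.- b) ℤ.+ (c ℤ.- d)
      lemma = solve-∀

    neg-congₘ : ∀ {a b} → a ≡ₘ b → (ℤ.- a) ≡ₘ (ℤ.- b)
    neg-congₘ {a} {b} p = subst (+ m ∣_) (lemma a b) (symₘ {a} {b} p)
      where
      lemma : ∀ a b → b ℤ.- a ≡ (ℤ.- a) ℤ.- (ℤ.- b)
      lemma = solve-∀

    +-assoc′ : ∀ a b c → (a ℤ.+ b) ℤ.+ c ≡ a ℤ.+ (b ℤ.+ c)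
    +-assoc′ = solve-∀

    +-idˡ : ∀ a → 0ℤ ℤ.+ a ≡ a
    +-idˡ = solve-∀

    +-idʳ : ∀ a → a ℤ.+ 0ℤ ≡ a
    +-idʳ = solve-∀

    +-invˡ : ∀ a → (ℤ.- a) ℤ.+ a ≡ 0ℤ
    +-invˡ = solve-∀

    +-invʳ : ∀ a → a ℤ.+ (ℤ.- a) ≡ 0ℤ
    +-invʳ = solve-∀

  ℤ/ : Group 0ℓ 0ℓ
  ℤ/ = record
    { Carrier = ℤ
    ; _≈_     = _≡ₘ_
    ; _∙_     = ℤ._+_
    ; ε       = 0ℤ
    ; _⁻¹     = ℤ.-_
    ; isGroup = record
      { isMonoid = record
        { isSemigroup = record
          { isMagma = record
            { isEquivalence = record
              { refl  = λ {a} → reflₘ {a} refl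
              ; sym   = λ {a} {b} → symₘ {a} {b}
              ; trans = λ {a} {b} {c} → transₘ {a} {b} {c}
              }
            ; ∙-cong = λ {a} {b} {c} {d} → +-congₘ {a} {b} {c} {d}
            }
          ; assoc = λ a b c → reflₘ (+-assoc′ a b c)
          }
        ; identity = (λ a → reflₘ (+-idˡ a)) , (λ a → reflₘ (+-idʳ a))
        }
      ; inverse = (λ a → reflₘ (+-invˡ a)) , (λ a → reflₘ (+-invʳ a))
      ; ⁻¹-cong = λ {a} {b} → neg-congₘ {a} {b}
      }
    }

  private
    ⊙-cong : ∀ s {a b} → a ≡ₘ b → (s ⊙ a) ≡ₘ (s ⊙ b)
    ⊙-cong Sign.+ p = p
    ⊙-cong Sign.- {a} {b} p = neg-congₘ {a} {b} p

    ⊙-assoc : ∀ a s b t c →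
              (a ℤ.+ s ⊙ b) ℤ.+ (s Sign.* t) ⊙ c ≡ a ℤ.+ s ⊙ (b ℤ.+ t ⊙ c)
    ⊙-assoc a Sign.+ b Sign.+ c = +-assoc′ a b c
    ⊙-assoc a Sign.+ b Sign.- c = +-assoc′ a b (ℤ.- c)
    ⊙-assoc a Sign.- b Sign.+ c = lemma a b c
      where
      lemma : ∀ a b c → (a ℤ.+ (ℤ.- b)) ℤ.+ (ℤ.- c) ≡ a ℤ.+ (ℤ.- (b ℤ.+ c))
      lemma = solve-∀
    ⊙-assoc a Sign.- b Sign.- c = lemma a b c
      where
      lemma : ∀ a b c → (a ℤ.+ (ℤ.- b)) ℤ.+ c ≡ a ℤ.+ (ℤ.- (b ℤ.+ (ℤ.- c)))
      lemma = solve-∀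

    ⊙-idʳ : ∀ a s → a ℤ.+ s ⊙ 0ℤ ≡ a
    ⊙-idʳ a Sign.+ = +-idʳ a
    ⊙-idʳ a Sign.- = +-idʳ a

    ⊙-invˡ : ∀ a s → (ℤ.- (s ⊙ a)) ℤ.+ s ⊙ a ≡ 0ℤ
    ⊙-invˡ a s = +-invˡ (s ⊙ a)

    ⊙-invʳ : ∀ a s → a ℤ.+ s ⊙ (ℤ.- (s ⊙ a)) ≡ 0ℤ
    ⊙-invʳ a Sign.+ = +-invʳ a
    ⊙-invʳ a Sign.- = lemma a
      where
      lemma : ∀ a → a ℤ.+ (ℤ.- (ℤ.- (ℤ.- a))) ≡ 0ℤ
      lemma = solve-∀

  -- The dihedral group of order 2m as ℤ/m ⋊ {+,-}, the sign - acting by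
  -- negation: (a , +) is a rotation and (a , -) a reflection.
  𝔻 : Group 0ℓ 0ℓ
  𝔻 = record
    { Carrier = ℤ × Sign
    ; _≈_     = λ (a , s) (b , t) → a ≡ₘ b × s ≡ t
    ; _∙_     = λ (a , s) (b , t) → a ℤ.+ s ⊙ b , s Sign.* t
    ; ε       = 0ℤ , Sign.+
    ; _⁻¹     = λ (a , s) → ℤ.- (s ⊙ a) , s
    ; isGroup = record
      { isMonoid = record
        { isSemigroup = record
          { isMagma = record
            { isEquivalence = record
              { refl  = λ {(a , _)} → reflₘ {a} refl , refl
              ; sym   = λ {(a , _)} {(b , _)} (p , q) → symₘ {a} {b} p , sym q
              ; trans = λ {(a , _)} {(b , _)} {(c , _)} (p , q) (p′ , q′) →
                          transₘ {a} {b} {c} p p′ , trans q q′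
              }
            ; ∙-cong = λ { {a , s} {b , _} {c , t} {d , _} (p , refl) (p′ , refl) →
                +-congₘ {a} {b} {s ⊙ c} {s ⊙ d} p (⊙-cong s {c} {d} p′) , refl }
            }
          ; assoc = λ (a , s) (b , t) (c , u) →
              reflₘ (⊙-assoc a s b t c) , Sign.*-assoc s t u
          }
        ; identity = (λ (a , _) → reflₘ (+-idˡ a) , refl)
                   , (λ (a , s) → reflₘ (⊙-idʳ a s) , Sign.*-identityʳ s)
        }
      ; inverse = (λ (a , s) → reflₘ (⊙-invˡ a s) , Sign.s*s≡+ s)
                , (λ (a , s) → reflₘ (⊙-invʳ a s) , Sign.s*s≡+ s)
      ; ⁻¹-cong = λ { {a , s} {b , _} (p , refl) →
          neg-congₘ {s ⊙ a} {s ⊙ b} (⊙-cong s {a} {b} p) , refl }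
      }
    }

------------------------------------------------------------------------
-- Cycles in a map

Enumerates : {A : Set} → List A → (A → Set) → Set
Enumerates xs P = Unique xs × (∀ x → x ∈ xs ⇔ P x)

module _ (K : PolyhedralMap) where
  open PolyhedralMap K

  record Cycle : Set where
    field
      len           : ℕ
      len≥3         : 3 ≤ len
      vtx           : Fin len → Vertex
      vtx-injective : ∀ {i j} → vtx i ≡ vtx j → i ≡ j
      edge          : Fin len → Edge
      joins         : ∀ j → Joins (edge j) (vtx j) (vtx (next j))

    OnV : Vertex → Set
    OnV v = ∃[ j ] vtx j ≡ v

    OnE : Edge → Set
    OnE e = ∃[ j ] edge j ≡ e

  module _ (C : Cycle) where
    open Cycle C

    -- C bounds a 2-disk: C is the boundary of the union of a set of faces,
    -- and this union is connected of Euler characteristic 1.  As C is a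
    -- simple cycle, the union is automatically a surface with boundary C.
    record Contractible : Set where
      field
        vs : List Vertex
        es : List Edge
        fs : List Face
        fs-unique : Unique fs
        vs-closed : Enumerates vs (λ v → ∃[ f ] (f ∈ fs × v ∈ᶠ f))
        es-closed : Enumerates es (λ e → ∃[ f ] (f ∈ fs × e ⊂ᶠ f))
        boundary  : ∀ {e f g} → f ≢ g → e ⊂ᶠ f → e ⊂ᶠ g →
                    OnE e ⇔ ((f ∈ fs × g ∉ fs) ⊎ (f ∉ fs × g ∈ fs))
        connectedᶠ : ∀ {f g} → f ∈ fs → g ∈ fs →
          Star (λ h k → h ∈ fs × k ∈ fs × ∃[ e ] (e ⊂ᶠ h × e ⊂ᶠ k)) f g
        χ≡1 : (+ length vs) ℤ.- (+ length es) ℤ.+ (+ length fs) ≡ + 1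

    -- The complement of C in the surface is disconnected: some two faces
    -- are not joined by a chain of faces crossing only edges off C.
    Separating : Set
    Separating = ∃[ f ] ∃[ g ]
      ¬ Star (λ h k → ∃[ e ] (¬ OnE e × e ⊂ᶠ h × e ⊂ᶠ k)) f g

    GenusSeparating : Set
    GenusSeparating = ¬ Contractible × Separating

    NonTrivial : Set
    NonTrivial = ¬ Contractible × ¬ GenusSeparating

    data Side : Set where
      sideA sideB : Side

    -- The two sides of C.  `side j f` is meaningful only for faces f
    -- containing the j-th vertex of C.  By `divides`, the two edges of C at
    -- that vertex split its face-cycle into an A-part and a B-part; by
    -- `coherent` these parts match along each edge of C, so that cutting
    -- along C does yield two boundary cycles.
    record Sides : Set where
      field
        side     : Fin len → Face → Side
        divide   : ∀ j {e f g} → vtx j ∈ᴱ e → f ≢ g → e ⊂ᶠ f → e ⊂ᶠ g →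
                   OnE e ⇔ (side j f ≢ side j g)
        coherent : ∀ j {f} → edge j ⊂ᶠ f → side j f ≡ side (next j) f

    -- The vertices of the map M obtained by cutting along C; `pᴬ j` and
    -- `qᴮ j` are the copies of the j-th vertex of C on the boundary cycles
    -- A and B.
    data CutVertex : Set where
      interior : (v : Vertex) → .(¬ OnV v) → CutVertex
      pᴬ qᴮ    : Fin len → CutVertex

    -- The faces of M are those of K, a corner v of f becoming `cut S f v`.
    cut : Sides → Face → Vertex → CutVertex
    cut S f v with any? (λ j → vtx j ≟ⱽ v)
    ... | no off = interior v off
    ... | yes (j , _) with Sides.side S j f
    ...   | sideA = pᴬ j
    ...   | sideB = qᴮ j

    -- The identification of Bᵢ with Aᵢ₊₁, i modulo ℓ, in ℓ copies of M.
    data Seam {ℓ : ℕ} : CutVertex × Fin ℓ → CutVertex × Fin ℓ → Set where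
      seam : ∀ j i → Seam (qᴮ j , i) (pᴬ j , next i)

-- L is an ℓ-covering map of K.  The vertices of L are the classes of the
-- vertices of ℓ copies of M under the equivalence relation generated by
-- Seam; the faces of L are the images of those of the copies of M.  The
-- cyclic sequences of corners are matched with their given starting points.
record IsCovering (ℓ : ℕ) (K L : PolyhedralMap) : Set where
  private
    module K = PolyhedralMap K
    module L = PolyhedralMap L
  field
    C          : Cycle K
    nontrivial : NonTrivial K C
    sides      : Sides K C
    glue       : CutVertex K C × Fin ℓ → L.Vertex
    surjective : ∀ w → ∃[ x ] glue x ≡ w
    identify   : ∀ x y → glue x ≡ glue y ⇔ EqClosure (Seam K C) x y
    onF        : (K.Face × Fin ℓ) ↔ L.Face
    deg-onF    : ∀ f i → K.deg f ≡ L.deg (Inverse.to onF (f , i))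
    corner-onF : ∀ f i s → L.corner (Inverse.to onF (f , i)) (cast (deg-onF f i) s)
                           ≡ glue (cut K C sides f (K.corner f s) , i)

------------------------------------------------------------------------
-- The types considered

types : List VertexType
types =
    ((3 , 7) ∷ [])
  ∷ ((3 , 5) ∷ (4 , 1) ∷ [])
  ∷ ((3 , 4) ∷ (4 , 2) ∷ [])
  ∷ ((3 , 3) ∷ (4 , 1) ∷ (3 , 1) ∷ (4 , 1) ∷ [])
  ∷ ((3 , 5) ∷ (5 , 1) ∷ [])
  ∷ ((3 , 4) ∷ (7 , 1) ∷ [])
  ∷ ((3 , 4) ∷ (8 , 1) ∷ [])
  ∷ ((3 , 4) ∷ (9 , 1) ∷ [])
  ∷ ((3 , 4) ∷ (10 , 1) ∷ [])
  ∷ ((3 , 2) ∷ (5 , 1) ∷ (3 , 1) ∷ (5 , 1) ∷ [])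
  ∷ ((3 , 3) ∷ (4 , 1) ∷ (6 , 1) ∷ [])
  ∷ ((3 , 2) ∷ (4 , 1) ∷ (3 , 1) ∷ (6 , 1) ∷ [])
  ∷ ((3 , 1) ∷ (4 , 1) ∷ (3 , 1) ∷ (4 , 2) ∷ [])
  ∷ ((3 , 1) ∷ (4 , 4) ∷ [])
  ∷ ((3 , 1) ∷ (7 , 1) ∷ (3 , 1) ∷ (7 , 1) ∷ [])
  ∷ ((3 , 1) ∷ (4 , 1) ∷ (7 , 1) ∷ (4 , 1) ∷ [])
  ∷ ((3 , 1) ∷ (4 , 1) ∷ (8 , 1) ∷ (4 , 1) ∷ [])
  ∷ ((4 , 3) ∷ (5 , 1) ∷ [])
  ∷ ((3 , 1) ∷ (4 , 1) ∷ (9 , 1) ∷ (4 , 1) ∷ [])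
  ∷ ((3 , 1) ∷ (4 , 1) ∷ (10 , 1) ∷ (4 , 1) ∷ [])
  ∷ ((3 , 1) ∷ (5 , 3) ∷ [])
  ∷ ((3 , 1) ∷ (6 , 1) ∷ (4 , 1) ∷ (6 , 1) ∷ [])
  ∷ ((4 , 1) ∷ (6 , 1) ∷ (18 , 1) ∷ [])
  ∷ ((4 , 3) ∷ (6 , 1) ∷ [])
  ∷ ((5 , 1) ∷ (4 , 1) ∷ (5 , 1) ∷ (4 , 1) ∷ [])
  ∷ ((4 , 1) ∷ (6 , 1) ∷ (14 , 1) ∷ [])
  ∷ ((4 , 1) ∷ (6 , 1) ∷ (16 , 1) ∷ [])
  ∷ ((4 , 1) ∷ (6 , 1) ∷ (20 , 1) ∷ [])
  ∷ ((4 , 1) ∷ (8 , 1) ∷ (10 , 1) ∷ [])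
  ∷ ((4 , 1) ∷ (8 , 1) ∷ (12 , 1) ∷ [])
  ∷ ((6 , 2) ∷ (7 , 1) ∷ [])
  ∷ ((8 , 1) ∷ (6 , 2) ∷ [])
  ∷ ((9 , 1) ∷ (6 , 2) ∷ [])
  ∷ ((10 , 1) ∷ (6 , 2) ∷ [])
  ∷ ((5 , 1) ∷ (8 , 2) ∷ [])
  ∷ ((6 , 1) ∷ (8 , 2) ∷ [])
  ∷ ((4 , 1) ∷ (10 , 2) ∷ [])
  ∷ ((3 , 1) ∷ (14 , 2) ∷ [])
  ∷ ((7 , 3) ∷ [])
  ∷ []

{-# OPTIONS --safe #-}
-- Let C be a two-sided non-separating cycle of a map K with χ(K) = -2.  The
-- m-covering Kᵐ along C is a covering of K with deck group ℤ/m: its cells are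
-- pairs of a cell of K and a level in ℤ/m, and the level changes by one
-- across C.  Being a local homeomorphism, the projection lifts polyhedrality and
-- the type, and χ(Kᵐ) = m χ(K); K itself is the case m = 1.
--
-- An automorphism of Kᵐ is determined by the image of one flag, the origin.
-- A walk among flags that closes up at the origin, with total change of level
-- zero, must close up at its image.  For each type a computer search found K,
-- C and a few such walks which, at any other flag of K, either do not close up
-- or close up with change of level ±1, so that no automorphism takes the
-- origin there, for any m ≥ 2; hence Aut Kᵐ is the deck group.  When every K
-- at hand has an involution lifting to all Kᵐ and reversing the levels, the
-- walks exclude all flags but two, and Aut Kᵐ is dihedral.  The finitely many
-- conditions on K, C and the walks are checked by evaluation.

module Submission where

open import Defs
open import Algebra.Bundles using (Group)
import Algebra.Properties.Group as GroupProperties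
open import Data.Bool.Base using (Bool; true; false; not; _∧_; _∨_; _xor_; if_then_else_)
import Data.Bool.Properties as Bool
open import Data.Empty using (⊥-elim)
open import Data.Empty.Irrelevant renaming (⊥-elim to ⊥-elim-irr)
open import Data.Fin.Base as Fin using (Fin; zero; suc; toℕ; fromℕ; fromℕ<; inject₁)
open import Data.Fin.Induction using (<-weakInduction; <-wellFounded)
import Data.Fin.Properties as Fin
open import Data.Fin.Relation.Unary.Top using (view; ‵fromℕ; ‵inject₁)
open import Data.Integer.Base as ℤ using (ℤ; -_; +_; -[1+_]; 0ℤ; 1ℤ)
import Data.Integer.DivMod as ℤ
open import Data.Integer.Divisibility.Signed using (_∣_; divides; ∣⇒∣ᵤ)
import Data.Integer.Properties as ℤ
open import Data.Integer.Tactic.RingSolver using (solve-∀)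
open import Data.List.Base as List using (List; []; _∷_; length; lookup)
import Data.List.Membership.DecPropositional as DecMembership
open import Data.List.Membership.Propositional using (_∈_)
open import Data.List.Relation.Unary.All as All using (All; []; _∷_)
open import Data.List.Relation.Unary.Any as Any using (Any; here; there)
open import Data.Nat.Base as ℕ using (ℕ; zero; suc; _≤_; _<_; _*_; s≤s; NonZero; _≡ᵇ_; _<ᵇ_)
import Data.Nat.DivMod as ℕ
import Data.Nat.Divisibility as ℕ
import Data.Nat.Properties as ℕ
open import Data.Product.Base using (Σ; Σ-syntax; ∃-syntax; _×_; _,_; proj₁; proj₂; swap)
open import Data.Product.Properties using (,-injective; ,-injectiveˡ; ,-injectiveʳ; ≡-dec)
open import Data.Sign.Base as Sign using (Sign)
open import Data.Sum.Base using (_⊎_; inj₁; inj₂; [_,_]′) renaming (map to map-⊎; swap to swap-⊎)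
open import Data.Unit.Base using (⊤; tt)
open import Function.Base using (_∘_; id)
open import Function.Bundles using (Injection; Inverse; Equivalence; _⇔_; mk⇔; mk↔ₛ′)
open import Function.Construct.Symmetry using (↔-sym)
open import Function.Properties.Inverse using (↔⇒↣)
open import Induction.WellFounded using (Acc; acc)
open import Level using (0ℓ)
open import Relation.Binary.Construct.Closure.Equivalence as EqClosure using (EqClosure)
open import Relation.Binary.Construct.Closure.ReflexiveTransitive as Star using (Star; ε; _◅_; _◅◅_)
open import Relation.Binary.Definitions using (DecidableEquality)
open import Relation.Binary.PropositionalEquality
  using (_≡_; _≢_; refl; sym; trans; cong; cong₂; subst; subst₂; isEquivalence; module ≡-Reasoning)
open import Relation.Nullary.Decidable
  using (Dec; yes; no; True; toWitness; map′; ¬?; _×-dec_; _⊎-dec_; _→-dec_)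
open import Relation.Nullary.Negation using (¬_)

-- Since `m` is arbitrary, only statements about `K` can be evaluated. Levels therefore enter the
-- checked conditions as integers, and a walk that closes up elsewhere is useful only if its change
-- of level is nonzero modulo every `m ≥ 2` at once; a change of ±1 guarantees this. Levels are
-- attached to polygons: `(f , i)` is the polygon `f` in the `i`-th copy of the cut map. Its corners
-- on side B are points of the boundary cycle that is glued to the next copy, so they are vertices
-- of level `i + 1`. A vertex common to two polygons of Kᵐ then fixes the difference of their
-- levels. This is why intersections of polygons and coincidences of edges in Kᵐ can be read off
-- from `K`. Flags do not occur in the definition of a complex or of an automorphism. They are
-- recovered from incidences: a flag is determined by its two end points and its polygon. Every
-- automorphism thereby acts on flags and commutes with the three flag involutions, which is what
-- makes transport of walks possible.

next-inject₁ : ∀ {n} (i : Fin n) → next (inject₁ i) ≡ suc i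
next-inject₁ {n} i = Fin.toℕ-injective (trans (Fin.toℕ-fromℕ< _)
  (trans (cong (λ k → suc k ℕ.% suc n) (Fin.toℕ-inject₁ i)) (ℕ.m<n⇒m%n≡m (s≤s (Fin.toℕ<n i)))))

next-fromℕ : ∀ n → next (fromℕ n) ≡ zero
next-fromℕ n = Fin.toℕ-injective (trans (Fin.toℕ-fromℕ< _)
  (trans (cong (λ k → suc k ℕ.% suc n) (Fin.toℕ-fromℕ n)) (ℕ.n%n≡0 (suc n))))

prev : ∀ {n} → Fin n → Fin n
prev {suc n} zero    = fromℕ n
prev {suc n} (suc i) = inject₁ i

next-prev : ∀ {n} (i : Fin n) → next (prev i) ≡ i
next-prev {suc n} zero    = next-fromℕ n
next-prev {suc n} (suc i) = next-inject₁ i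

prev-next : ∀ {n} (i : Fin n) → prev (next i) ≡ i
prev-next {suc n} i with view i
... | ‵fromℕ     = cong prev (next-fromℕ n)
... | ‵inject₁ j = cong prev (next-inject₁ j)

next≢ : ∀ {n} → 2 ≤ n → (i : Fin n) → next i ≢ i
next≢ {suc n} (s≤s 1≤n) i with view i
... | ‵fromℕ     = λ eq → ℕ.<⇒≢ 1≤n (trans (cong toℕ (trans (sym (next-fromℕ n)) eq)) (Fin.toℕ-fromℕ n))
... | ‵inject₁ j = λ eq → ℕ.1+n≢n (trans (cong toℕ (trans (sym (next-inject₁ j)) eq)) (Fin.toℕ-inject₁ j))

next≢prev : ∀ {n} → 3 ≤ n → (i : Fin n) → next i ≢ prev i
next≢prev {suc (suc (suc n))} _ zero eq
  with () ← trans (cong toℕ (trans (sym (next-inject₁ zero)) eq)) (Fin.toℕ-fromℕ (suc (suc n)))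
next≢prev {suc (suc (suc n))} _ (suc j) eq with view j
... | ‵fromℕ     = ℕ.0≢1+n (trans (cong toℕ (trans (sym (next-fromℕ (suc (suc n)))) eq))
                                  (trans (Fin.toℕ-inject₁ (fromℕ (suc n))) (Fin.toℕ-fromℕ (suc n))))
... | ‵inject₁ k = ℕ.m≢1+n+m (toℕ k) {1} (sym (trans (cong toℕ (trans (sym (next-inject₁ (suc k))) eq))
                                  (trans (Fin.toℕ-inject₁ (inject₁ k)) (Fin.toℕ-inject₁ k))))
next≢prev {suc zero} (s≤s ())
next≢prev {suc (suc zero)} (s≤s (s≤s ()))

toℕ-next : ∀ {m} .{{_ : NonZero m}} (i : Fin m) → toℕ (next i) ≡ suc (toℕ i) ℕ.% m
toℕ-next {suc m} i = Fin.toℕ-fromℕ< _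

-- Arithmetic of levels modulo `m`.

module Residue (m : ℕ) .{{_ : NonZero m}} where

  -- Levels are opaque from here on and are handled only through the laws below, so that no division
  -- by `m` is unfolded later.
  abstract
    infixl 6 _⊞_ _⊟_

    ι : ℤ → Fin m
    ι k = fromℕ< (ℤ.n%ℕd<d k m)

    _⊞_ : Fin m → ℤ → Fin m
    i ⊞ k = ι (+ toℕ i ℤ.+ k)

    -- The reflections of the cycle of levels; lifted mirrors act on levels in this way, deck
    -- translations by `_⊞_`.
    _⊟_ : ℤ → Fin m → Fin m
    k ⊟ i = ι (k ℤ.- + toℕ i)

    private
      +-congʳ : ∀ a b k → _≡ₘ_ m a b → _≡ₘ_ m (a ℤ.+ k) (b ℤ.+ k)
      +-congʳ a b k = subst (+ m ∣_) (lemma a b k)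
        where
        lemma : ∀ a b k → a ℤ.- b ≡ (a ℤ.+ k) ℤ.- (b ℤ.+ k)
        lemma = solve-∀

      -‿congˡ : ∀ k a b → _≡ₘ_ m a b → _≡ₘ_ m (k ℤ.- b) (k ℤ.- a)
      -‿congˡ k a b = subst (+ m ∣_) (lemma k a b)
        where
        lemma : ∀ k a b → a ℤ.- b ≡ (k ℤ.- b) ℤ.- (k ℤ.- a)
        lemma = solve-∀

      ≡ₘ-sym : ∀ a b → _≡ₘ_ m a b → _≡ₘ_ m b a
      ≡ₘ-sym a b = Group.sym (ℤ/ m) {a} {b}

      ≡ₘ-trans : ∀ a b c → _≡ₘ_ m a b → _≡ₘ_ m b c → _≡ₘ_ m a c
      ≡ₘ-trans a b c = Group.trans (ℤ/ m) {a} {b} {c}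

      -- The difference is at most the larger of `r` and `s` in absolute value, hence below `m`, and
      -- the only such multiple of `m` is 0.
      ≡ₘ⇒≡ : ∀ {r s} → r < m → s < m → _≡ₘ_ m (+ r) (+ s) → r ≡ s
      ≡ₘ⇒≡ {r} {s} r<m s<m m∣r-s = ℤ.+-injective (ℤ.i-j≡0⇒i≡j (+ r) (+ s)
        (ℤ.∣i∣≡0⇒i≡0 (small (∣⇒∣ᵤ m∣r-s) (ℕ.≤-<-trans bound (ℕ.⊔-lub r<m s<m)))))
        where
        bound : ℤ.∣ + r ℤ.- + s ∣ ≤ r ℕ.⊔ s
        bound = subst (λ k → ℤ.∣ k ∣ ≤ r ℕ.⊔ s) (sym (ℤ.m-n≡m⊖n r s)) (ℤ.∣m⊝n∣≤m⊔n r s)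
        small : ∀ {n} → m ℕ.∣ n → n < m → n ≡ 0
        small {zero}  _   _   = refl
        small {suc n} m∣n n<m = ⊥-elim (ℕ.>⇒∤ n<m m∣n)

    ι-≡ₘ : ∀ k → _≡ₘ_ m k (+ toℕ (ι k))
    ι-≡ₘ k = divides (k ℤ./ℕ m) (begin
      k ℤ.- + toℕ (ι k)                                       ≡⟨ cong (λ r → k ℤ.- + r) (Fin.toℕ-fromℕ< _) ⟩
      k ℤ.- + (k ℤ.%ℕ m)                                      ≡⟨ cong (ℤ._- + (k ℤ.%ℕ m)) (ℤ.a≡a%ℕn+[a/ℕn]*n k m) ⟩
      (+ (k ℤ.%ℕ m) ℤ.+ (k ℤ./ℕ m) ℤ.* + m) ℤ.- + (k ℤ.%ℕ m)  ≡⟨ lemma (+ (k ℤ.%ℕ m)) ((k ℤ./ℕ m) ℤ.* + m) ⟩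
      (k ℤ./ℕ m) ℤ.* + m                                      ∎)
      where
      open ≡-Reasoning
      lemma : ∀ a b → (a ℤ.+ b) ℤ.- a ≡ b
      lemma = solve-∀

    ι-cong : ∀ a b → _≡ₘ_ m a b → ι a ≡ ι b
    ι-cong a b a≡b = Fin.toℕ-injective (≡ₘ⇒≡ (Fin.toℕ<n (ι a)) (Fin.toℕ<n (ι b))
      (≡ₘ-trans (+ toℕ (ι a)) a (+ toℕ (ι b)) (≡ₘ-sym a (+ toℕ (ι a)) (ι-≡ₘ a))
        (≡ₘ-trans a b (+ toℕ (ι b)) a≡b (ι-≡ₘ b))))

    ι-injective : ∀ a b → ι a ≡ ι b → _≡ₘ_ m a b
    ι-injective a b eq = ≡ₘ-trans a (+ toℕ (ι a)) b (ι-≡ₘ a)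
      (subst (λ i → _≡ₘ_ m (+ toℕ i) b) (sym eq) (≡ₘ-sym b (+ toℕ (ι b)) (ι-≡ₘ b)))

    ι-toℕ : ∀ i → ι (+ toℕ i) ≡ i
    ι-toℕ i = Fin.toℕ-injective (trans (Fin.toℕ-fromℕ< _) (ℕ.m<n⇒m%n≡m (Fin.toℕ<n i)))

    ι-⊞ : ∀ a k → ι a ⊞ k ≡ ι (a ℤ.+ k)
    ι-⊞ a k = sym (ι-cong (a ℤ.+ k) (+ toℕ (ι a) ℤ.+ k) (+-congʳ a (+ toℕ (ι a)) k (ι-≡ₘ a)))

    ⊟-ι : ∀ k a → k ⊟ ι a ≡ ι (k ℤ.- a)
    ⊟-ι k a = ι-cong (k ℤ.- + toℕ (ι a)) (k ℤ.- a) (-‿congˡ k a (+ toℕ (ι a)) (ι-≡ₘ a))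

    ⊞-identityʳ : ∀ i → i ⊞ 0ℤ ≡ i
    ⊞-identityʳ i = trans (cong ι (ℤ.+-identityʳ (+ toℕ i))) (ι-toℕ i)

    ⊞-assoc : ∀ i k l → i ⊞ k ⊞ l ≡ i ⊞ (k ℤ.+ l)
    ⊞-assoc i k l = trans (ι-⊞ (+ toℕ i ℤ.+ k) l) (cong ι (ℤ.+-assoc (+ toℕ i) k l))

    ⊞-injectiveˡ : ∀ {i j} k → i ⊞ k ≡ j ⊞ k → i ≡ j
    ⊞-injectiveˡ {i} {j} k eq = trans (sym (undo i)) (trans (cong (_⊞ (ℤ.- k)) eq) (undo j))
      where
      undo : ∀ i → i ⊞ k ⊞ (ℤ.- k) ≡ i
      undo i = trans (⊞-assoc i k (ℤ.- k)) (trans (cong (i ⊞_) (ℤ.+-inverseʳ k)) (⊞-identityʳ i))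

    -- Used to see that different classes modulo `m` give different deck translations, and that a
    -- closed walk has change of level divisible by `m`.
    ⊞-injectiveʳ : ∀ i k l → i ⊞ k ≡ i ⊞ l → _≡ₘ_ m k l
    ⊞-injectiveʳ i k l eq = subst (+ m ∣_) (lemma (+ toℕ i) k l) (ι-injective (+ toℕ i ℤ.+ k) (+ toℕ i ℤ.+ l) eq)
      where
      lemma : ∀ a k l → (a ℤ.+ k) ℤ.- (a ℤ.+ l) ≡ k ℤ.- l
      lemma = solve-∀

    ⊞-cong : ∀ i k l → _≡ₘ_ m k l → i ⊞ k ≡ i ⊞ l
    ⊞-cong i k l eq = ι-cong (+ toℕ i ℤ.+ k) (+ toℕ i ℤ.+ l) (subst (+ m ∣_) (lemma (+ toℕ i) k l) eq)
      where
      lemma : ∀ a k l → k ℤ.- l ≡ (a ℤ.+ k) ℤ.- (a ℤ.+ l)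
      lemma = solve-∀

    ⊞-transitive : ∀ i j → i ⊞ (+ toℕ j ℤ.- + toℕ i) ≡ j
    ⊞-transitive i j = trans (cong ι (lemma (+ toℕ i) (+ toℕ j))) (ι-toℕ j)
      where
      lemma : ∀ a b → a ℤ.+ (b ℤ.- a) ≡ b
      lemma = solve-∀

    next≡⊞1 : ∀ i → next i ≡ i ⊞ 1ℤ
    next≡⊞1 i = Fin.toℕ-injective (trans (toℕ-next i)
      (sym (trans (Fin.toℕ-fromℕ< _) (cong (ℕ._% m) (ℕ.+-comm (toℕ i) 1)))))

    ⊟-⊞ : ∀ k i l → (k ⊟ i) ⊞ l ≡ (k ℤ.+ l) ⊟ i
    ⊟-⊞ k i l = trans (ι-⊞ (k ℤ.- + toℕ i) l) (cong ι (lemma k (+ toℕ i) l))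
      where
      lemma : ∀ k a l → (k ℤ.- a) ℤ.+ l ≡ (k ℤ.+ l) ℤ.- a
      lemma = solve-∀

    ⊟-⊞ʳ : ∀ k i l → k ⊟ (i ⊞ l) ≡ (k ℤ.- l) ⊟ i
    ⊟-⊞ʳ k i l = trans (⊟-ι k (+ toℕ i ℤ.+ l)) (cong ι (lemma k (+ toℕ i) l))
      where
      lemma : ∀ k a l → k ℤ.- (a ℤ.+ l) ≡ (k ℤ.- l) ℤ.- a
      lemma = solve-∀

    ⊟-involutive : ∀ k i → k ⊟ (k ⊟ i) ≡ i
    ⊟-involutive k i = trans (⊟-ι k (k ℤ.- + toℕ i)) (trans (cong ι (lemma k (+ toℕ i))) (ι-toℕ i))
      where
      lemma : ∀ k a → k ℤ.- (k ℤ.- a) ≡ a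
      lemma = solve-∀

-- Coverings

bit : Bool → ℕ
bit b = if b then 1 else 0

⟦_⟧ : Bool → ℤ
⟦ b ⟧ = + bit b

-- A map K with a cycle C, as polygons glued along their sides.  The corner
-- (f , s) of the polygon f also stands for its side from (f , s) to
-- (f , next s), and the flag (c , b) for the side c with its first (b = false)
-- or last end point.  With the cut along C in mind, isB marks the corners on
-- side B of C, which belong to the next level, and beyond marks the sides on
-- C whose polygon lies on side B, so that the edge belongs to the next level.
-- The Boolean of glue tells whether the side is glued with reversed direction;
-- labels repeats vert in ℕ, where comparison is fast.
record Scheme (degrees : List ℕ) : Set where
  field
    #v #e #f : ℕ
    size     : Fin #f → ℕ

  Corner : Set
  Corner = Σ (Fin #f) (Fin ∘ size)

  Flag : Set
  Flag = Corner × Bool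

  field
    vert     : Corner → Fin #v
    labels   : ∀ f → Fin (size f) → ℕ
    glue     : Corner → Corner × Bool
    isB      : Corner → Bool
    beyond   : Corner → Bool
    edge     : Corner → Fin #e
    rep      : Fin #e → Corner
    around   : Fin #v → Fin (length degrees) → Corner
    base     : Flag
    len      : ℕ
    cycle    : Fin len → Flag

  face : Corner → Fin #f
  face = proj₁

  label : Corner → ℕ
  label (f , s) = labels f s

  opp : Corner → Corner
  opp c = proj₁ (glue c)

  succ pred : Corner → Corner
  succ (f , s) = f , next s
  pred (f , s) = f , prev s

  pt : Flag → Corner
  pt (c , false) = c
  pt (c , true)  = succ c

  s₀ s₁ s₂ : Flag → Flag
  s₀ (c , b)     = c , not b
  s₁ (c , false) = pred c , true
  s₁ (c , true)  = succ c , false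
  s₂ (c , b)     = opp c , proj₂ (glue c) xor b

  jump : Corner → ℤ
  jump c = ⟦ beyond c ⟧ ℤ.- ⟦ beyond (opp c) ⟧

  OnlyCommon : Corner → Corner → Set
  OnlyCommon q q′ = ∀ s t → label (face q , s) ≡ label (face q′ , t) →
    label (face q , s) ≡ label q

  CommonEdge : Flag → Corner → Set
  CommonEdge x@(c , _) q′ = face (opp c) ≡ face q′ ×
    (∀ s t → label (face c , s) ≡ label (face q′ , t) →
      label (face c , s) ≡ label (pt x) ⊎ label (face c , s) ≡ label (pt (s₀ x)))

record IsValid {degrees : List ℕ} (S : Scheme degrees) : Set where
  open Scheme S
  field
    degrees≥3       : 3 ≤ length degrees
    size≥3          : ∀ f → 3 ≤ size f
    label-vert      : ∀ c → label c ≡ toℕ (vert c)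
    label-injective : ∀ f s t → label (f , s) ≡ label (f , t) → s ≡ t
    s₂-involutive   : ∀ c b → s₂ (s₂ (c , b)) ≡ (c , b)
    s₂-face         : ∀ c → face (opp c) ≢ face c
    s₂-label        : ∀ c b → label (pt (s₂ (c , b))) ≡ label (pt (c , b))
    -- Both polygons at a side assign the same level to each end point; the equation is kept free of
    -- subtraction, hence in ℕ.
    s₂-level        : ∀ c b → bit (isB (pt (c , b))) ℕ.+ bit (beyond (opp c))
                            ≡ bit (isB (pt (s₂ (c , b)))) ℕ.+ bit (beyond c)
    edge-opp        : ∀ c → edge (opp c) ≡ edge c
    edge-rep        : ∀ e → edge (rep e) ≡ e
    rep-edge        : ∀ c → rep (edge c) ≡ c ⊎ rep (edge c) ≡ opp c
    -- The polygon of the representative has the level of the edge itself, so that the end points of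
    -- an edge can be defined there.
    rep-near        : ∀ e → beyond (rep e) ≡ false
    around-vert     : ∀ v i → vert (around v i) ≡ v
    around-size     : ∀ v i → size (face (around v i)) ≡ lookup degrees i
    around-inj      : ∀ v i j → around v i ≡ around v j → i ≡ j
    around-surj     : ∀ c → ∃[ i ] around (vert c) i ≡ c
    around-step     : ∀ v i → around v (next i) ≡ pt (s₂ (around v i , false))
                            ⊎ around v (next i) ≡ pt (s₂ (pred (around v i) , true))
    -- Polyhedrality, as a condition on the polygons at a common vertex: they coincide, or meet
    -- exactly in one of the two sides at `q`, or meet in `q` alone.
    meets           : ∀ q i → face (around (vert q) i) ≡ face q
                            ⊎ CommonEdge (q , false) (around (vert q) i)
                            ⊎ CommonEdge (pred q , true) (around (vert q) i)
                            ⊎ OnlyCommon q (around (vert q) i)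
    -- Chains of polygons crossing no edge of C lead from every polygon to the base.
    descend         : ∀ f → f ≡ face (proj₁ base)
                          ⊎ (∃[ s ] toℕ (face (opp (f , s))) < toℕ f
                                  × beyond (f , s) ≡ beyond (opp (f , s)))
    euler           : #v ℕ.+ #f ℕ.+ 2 ≡ #e
    len≥3           : 3 ≤ len
    cycle-joins     : ∀ j → label (pt (s₀ (cycle j))) ≡ label (pt (cycle (next j)))
    cycle-injective : ∀ i j → label (pt (cycle i)) ≡ label (pt (cycle j)) → i ≡ j
    cycle-crosses   : ∀ j → beyond (proj₁ (cycle j)) ≢ beyond (opp (proj₁ (cycle j)))
    cycle-coherent  : ∀ j → isB (pt (cycle j)) ≡ isB (pt (s₀ (cycle j)))
    -- Together with `cycle-crosses`: the edges across which `beyond` changes are precisely the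
    -- edges of C.
    cycle-complete  : ∀ c → beyond c ≡ beyond (opp c)
                          ⊎ (∃[ j ] edge (proj₁ (cycle j)) ≡ edge c)
    isB-cycle       : ∀ c → isB c ≡ false ⊎ (∃[ j ] label (pt (cycle j)) ≡ label c)

-- Cells and flags of the covering Kᵐ, and its local properties.

module Cover {degrees : List ℕ} {S : Scheme degrees} (ok : IsValid S)
             (m : ℕ) .{{_ : NonZero m}} where

  open Scheme S
  open IsValid ok
  open Residue m

  Vertexᵐ Edgeᵐ Faceᵐ Flagᵐ : Set
  Vertexᵐ = Fin #v × Fin m
  Edgeᵐ   = Fin #e × Fin m
  Faceᵐ   = Fin #f × Fin m
  Flagᵐ   = Flag × Fin m

  -- A flag carries the level of its polygon. A corner on side B of copy `i` is glued to a corner on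
  -- side A of copy `i + 1`, whence the added bit.
  P : Flagᵐ → Vertexᵐ
  P (x , i) = vert (pt x) , i ⊞ ⟦ isB (pt x) ⟧

  E : Flagᵐ → Edgeᵐ
  E ((c , _) , i) = edge c , i ⊞ ⟦ beyond c ⟧

  F : Flagᵐ → Faceᵐ
  F ((c , _) , i) = face c , i

  S₀ S₁ S₂ : Flagᵐ → Flagᵐ
  S₀ (x , i) = s₀ x , i
  S₁ (x , i) = s₁ x , i
  S₂ (x , i) = s₂ x , i ⊞ jump (proj₁ x)

  complex : Complex
  complex = record
    { Vertex   = Vertexᵐ ; Edge = Edgeᵐ ; Face = Faceᵐ
    ; #V       = #v ℕ.* m ; #E = #e ℕ.* m ; #F = #f ℕ.* m
    ; finite-V = ↔-sym Fin.*↔× ; finite-E = ↔-sym Fin.*↔× ; finite-F = ↔-sym Fin.*↔×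
    ; ends     = λ (e , k) → P ((rep e , false) , k) , P ((rep e , true) , k)
    ; deg      = size ∘ proj₁
    ; corner   = λ (f , i) s → P (((f , s) , false) , i)
    }

  open Complex complex using (Joins; _∈ᴱ_; _∈ᶠ_; _⊂ᶠ_; Adjacent; FaceCycle)

  vert⇒label : ∀ {c c′} → vert c ≡ vert c′ → label c ≡ label c′
  vert⇒label eq = trans (label-vert _) (trans (cong toℕ eq) (sym (label-vert _)))

  label⇒vert : ∀ {c c′} → label c ≡ label c′ → vert c ≡ vert c′
  label⇒vert eq = Fin.toℕ-injective (trans (sym (label-vert _)) (trans eq (label-vert _)))

  vert-injective : ∀ {c c′} → face c ≡ face c′ → vert c ≡ vert c′ → c ≡ c′
  vert-injective {f , s} {_ , t} refl eq = cong (f ,_) (label-injective f s t (vert⇒label eq))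

  pt-pred : ∀ c → pt (pred c , true) ≡ c
  pt-pred (f , s) = cong (f ,_) (next-prev s)

  pred-succ : ∀ c → pred (succ c) ≡ c
  pred-succ (f , s) = cong (f ,_) (prev-next s)

  s₀-s₀ : ∀ x → s₀ (s₀ x) ≡ x
  s₀-s₀ (c , false) = refl
  s₀-s₀ (c , true)  = refl

  face-pt : ∀ x → face (pt x) ≡ face (proj₁ x)
  face-pt (c , false) = refl
  face-pt (c , true)  = refl

  pt-s₀≢ : ∀ x → pt (s₀ x) ≢ pt x
  pt-s₀≢ ((f , s) , false) eq = next≢ (ℕ.≤-trans (ℕ.n≤1+n 2) (size≥3 f)) s (lemma eq)
    where
    lemma : ∀ {s t} → _≡_ {A = Corner} (f , s) (f , t) → s ≡ t
    lemma refl = refl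
  pt-s₀≢ (c , true) eq = pt-s₀≢ (c , false) (sym eq)

  vert-s₀≢ : ∀ x → vert (pt (s₀ x)) ≢ vert (pt x)
  vert-s₀≢ x eq = pt-s₀≢ x (vert-injective (trans (face-pt (s₀ x)) (sym (face-pt x))) eq)

  at-corner : ∀ x y → pt x ≡ pt y → y ≡ x ⊎ y ≡ s₁ x
  at-corner (c , false) (.c , false) refl = inj₁ refl
  at-corner (c , false) (d , true)   refl = inj₂ (cong (_, true) (sym (pred-succ d)))
  at-corner (c , true)  (.(succ c) , false) refl = inj₂ refl
  at-corner (c , true)  (d , true)   eq   =
    inj₁ (cong (_, true) (trans (sym (pred-succ d)) (trans (cong pred (sym eq)) (pred-succ c))))

  s₁≢ : ∀ x → s₁ x ≢ x
  s₁≢ (_ , false) ()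
  s₁≢ (_ , true)  ()

  pt-s₀-s₁≢ : ∀ x → pt (s₀ (s₁ x)) ≢ pt (s₀ x)
  pt-s₀-s₁≢ ((f , s) , false) eq = next≢prev (size≥3 f) s (sym (lemma eq))
    where
    lemma : ∀ {s t} → _≡_ {A = Corner} (f , s) (f , t) → s ≡ t
    lemma refl = refl
  pt-s₀-s₁≢ (c@(f , s) , true) eq =
    next≢prev (size≥3 f) (next s) (trans (lemma eq) (sym (prev-next s)))
    where
    lemma : ∀ {s t} → _≡_ {A = Corner} (f , s) (f , t) → s ≡ t
    lemma refl = refl

  -- The only other flag at the same corner is `s₁ x`, and its far end point is different because
  -- polygons have at least three sides.
  flag-injective : ∀ x y → pt x ≡ pt y → pt (s₀ x) ≡ pt (s₀ y) → x ≡ y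
  flag-injective x y p q with at-corner x y p
  ... | inj₁ y≡x    = sym y≡x
  ... | inj₂ y≡s₁x = ⊥-elim (pt-s₀-s₁≢ x (trans (cong (pt ∘ s₀) (sym y≡s₁x)) (sym q)))

  pt-s₁ : ∀ x → pt (s₁ x) ≡ pt x
  pt-s₁ (c , false) = pt-pred c
  pt-s₁ (c , true)  = refl

  s₂-s₀ : ∀ x → s₂ (s₀ x) ≡ s₀ (s₂ x)
  s₂-s₀ (c , b) = cong (opp c ,_) (lemma (proj₂ (glue c)) b)
    where
    lemma : ∀ t b → t xor (not b) ≡ not (t xor b)
    lemma false b     = refl
    lemma true  false = refl
    lemma true  true  = refl

  opp-opp : ∀ c → opp (opp c) ≡ c
  opp-opp c = cong proj₁ (s₂-involutive c false)

  vert-s₂ : ∀ x → vert (pt (s₂ x)) ≡ vert (pt x)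
  vert-s₂ (c , b) = label⇒vert (s₂-label c b)

  P-S₁ : ∀ X → P (S₁ X) ≡ P X
  P-S₁ (x , i) = cong (λ c → vert c , i ⊞ ⟦ isB c ⟧) (pt-s₁ x)

  F-S₁ : ∀ X → F (S₁ X) ≡ F X
  F-S₁ ((_ , false) , _) = refl
  F-S₁ ((_ , true)  , _) = refl

  -- By `s₂-level`, the change of level across the side cancels the difference between the bits of
  -- the two corners.
  P-S₂ : ∀ X → P (S₂ X) ≡ P X
  P-S₂ (x@(c , b) , i) = cong₂ _,_ (vert-s₂ x)
    (trans (⊞-assoc i (jump c) ⟦ isB (pt (s₂ x)) ⟧) (cong (i ⊞_) (begin
      (⟦ beyond c ⟧ ℤ.- ⟦ beyond (opp c) ⟧) ℤ.+ ⟦ isB (pt (s₂ x)) ⟧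
        ≡⟨ lemma₁ ⟦ beyond c ⟧ ⟦ beyond (opp c) ⟧ ⟦ isB (pt (s₂ x)) ⟧ ⟩
      (⟦ isB (pt (s₂ x)) ⟧ ℤ.+ ⟦ beyond c ⟧) ℤ.- ⟦ beyond (opp c) ⟧
        ≡⟨ cong (λ k → + k ℤ.- ⟦ beyond (opp c) ⟧) (s₂-level c b) ⟨
      (⟦ isB (pt x) ⟧ ℤ.+ ⟦ beyond (opp c) ⟧) ℤ.- ⟦ beyond (opp c) ⟧
        ≡⟨ lemma₂ ⟦ isB (pt x) ⟧ ⟦ beyond (opp c) ⟧ ⟩
      ⟦ isB (pt x) ⟧ ∎)))
    where
    open ≡-Reasoning
    lemma₁ : ∀ d d′ h → (d ℤ.- d′) ℤ.+ h ≡ (h ℤ.+ d) ℤ.- d′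
    lemma₁ = solve-∀
    lemma₂ : ∀ h d → (h ℤ.+ d) ℤ.- d ≡ h
    lemma₂ = solve-∀

  E-S₂ : ∀ X → E (S₂ X) ≡ E X
  E-S₂ ((c , b) , i) = cong₂ _,_ (edge-opp c)
    (trans (⊞-assoc i (jump c) ⟦ beyond (opp c) ⟧)
           (cong (i ⊞_) (lemma ⟦ beyond c ⟧ ⟦ beyond (opp c) ⟧)))
    where
    lemma : ∀ d d′ → (d ℤ.- d′) ℤ.+ d′ ≡ d
    lemma = solve-∀

  S₀-S₀ : ∀ X → S₀ (S₀ X) ≡ X
  S₀-S₀ (x , i) = cong (_, i) (s₀-s₀ x)

  S₂-S₀ : ∀ X → S₂ (S₀ X) ≡ S₀ (S₂ X)
  S₂-S₀ (x , i) = cong (_, i ⊞ jump (proj₁ x)) (s₂-s₀ x)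

  -- No vertex repeats on a polygon, so incidences locate the corners. Equalities between images of
  -- flags under automorphisms are all obtained from this.
  Flagᵐ-injective : ∀ {X Y} → P X ≡ P Y → P (S₀ X) ≡ P (S₀ Y) → F X ≡ F Y → X ≡ Y
  Flagᵐ-injective {x , i} {y , j} p q r = cong₂ _,_
    (flag-injective x y
      (vert-injective (trans (face-pt x) (trans (,-injectiveˡ r) (sym (face-pt y)))) (,-injectiveˡ p))
      (vert-injective (trans (face-pt (s₀ x)) (trans (,-injectiveˡ r) (sym (face-pt (s₀ y))))) (,-injectiveˡ q)))
    (,-injectiveʳ r)

  beyond-rep : ∀ {c} → rep (edge c) ≡ c → beyond c ≡ false
  beyond-rep {c} eq = trans (cong beyond (sym eq)) (rep-near (edge c))

  ⊞-near : ∀ {b} i → b ≡ false → i ⊞ ⟦ b ⟧ ≡ i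
  ⊞-near i refl = ⊞-identityʳ i

  open Complex complex using (ends)

  Joins-sym : ∀ {e u v} → Joins e u v → Joins e v u
  Joins-sym = swap-⊎

  private
    joins-rep : ∀ X → rep (edge (proj₁ (proj₁ X))) ≡ proj₁ (proj₁ X) → Joins (E X) (P X) (P (S₀ X))
    joins-rep ((c , b) , i) eq = choose b
      where
      ends-E : ends (E ((c , b) , i)) ≡ (P ((c , false) , i) , P ((c , true) , i))
      ends-E = cong₂ (λ c k → P ((c , false) , k) , P ((c , true) , k)) eq (⊞-near i (beyond-rep eq))
      choose : ∀ b → Joins (E ((c , b) , i)) (P ((c , b) , i)) (P ((c , not b) , i))
      choose false = inj₁ ends-E
      choose true  = inj₂ ends-E

  -- `ends` looks at the representative side only. A side that is not the representative lies
  -- opposite to it, and `S₂` moves the claim across.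
  E-joins : ∀ X → Joins (E X) (P X) (P (S₀ X))
  E-joins X@((c , b) , i) with rep-edge c
  ... | inj₁ eq = joins-rep X eq
  ... | inj₂ eq = subst₂ (Joins (E X)) (P-S₂ X) (trans (cong P (sym (S₂-S₀ X))) (P-S₂ (S₀ X)))
    (subst (λ e → Joins e (P (S₂ X)) (P (S₀ (S₂ X)))) (E-S₂ X)
      (joins-rep (S₂ X) (trans (cong rep (edge-opp c)) eq)))

  P∈ᴱE : ∀ X → P X ∈ᴱ E X
  P∈ᴱE X = map-⊎ (sym ∘ cong proj₁) (sym ∘ cong proj₂) (E-joins X)

  P-S₀∈ᴱE : ∀ X → P (S₀ X) ∈ᴱ E X
  P-S₀∈ᴱE X = P∈ᴱE (S₀ X)

  ∈ᴱE⇒ : ∀ X {v} → v ∈ᴱ E X → v ≡ P X ⊎ v ≡ P (S₀ X)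
  ∈ᴱE⇒ X v∈e with E-joins X
  ... | inj₁ eq = map-⊎ (λ p → trans p (cong proj₁ eq)) (λ p → trans p (cong proj₂ eq)) v∈e
  ... | inj₂ eq = swap-⊎ (map-⊎ (λ p → trans p (cong proj₁ eq)) (λ p → trans p (cong proj₂ eq)) v∈e)

  E⊂ᶠF : ∀ X → E X ⊂ᶠ F X
  E⊂ᶠF (((f , s) , _) , i) = s , E-joins (((f , s) , false) , i)

  P∈ᶠF : ∀ X → P X ∈ᶠ F X
  P∈ᶠF (((f , s) , false) , i) = s , refl
  P∈ᶠF (((f , s) , true)  , i) = next s , refl

  same-edge : ∀ c d → edge c ≡ edge d → d ≡ c ⊎ d ≡ opp c
  same-edge c d eq with rep-edge c | rep-edge d
  ... | inj₁ p | inj₁ q = inj₁ (trans (sym q) (trans (cong rep (sym eq)) p))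
  ... | inj₂ p | inj₁ q = inj₂ (trans (sym q) (trans (cong rep (sym eq)) p))
  ... | inj₁ p | inj₂ q = inj₂ (trans (sym (opp-opp d)) (cong opp (trans (sym q) (trans (cong rep (sym eq)) p))))
  ... | inj₂ p | inj₂ q = inj₁ (trans (sym (opp-opp d))
    (trans (cong opp (trans (sym q) (trans (cong rep (sym eq)) p))) (opp-opp c)))

  -- At a given corner the bit is fixed, so the level of the vertex gives back that of the polygon:
  -- the projection to K is injective on the polygons at a vertex.
  level-unique : ∀ {x y i j} → pt x ≡ pt y → P (x , i) ≡ P (y , j) → i ≡ j
  level-unique {x} {y} {i} {j} eq p = ⊞-injectiveˡ ⟦ isB (pt x) ⟧
    (trans (,-injectiveʳ p) (cong (λ c → j ⊞ ⟦ isB c ⟧) (sym eq)))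

  private
    direction : ∀ x y → proj₁ y ≡ proj₁ x → vert (pt x) ≡ vert (pt y) → y ≡ x
    direction (c , false) (.c , false) refl _ = refl
    direction (c , true)  (.c , true)  refl _ = refl
    direction (c , false) (.c , true)  refl p = ⊥-elim (vert-s₀≢ (c , false) (sym p))
    direction (c , true)  (.c , false) refl p = ⊥-elim (vert-s₀≢ (c , true) (sym p))

    at-side : ∀ X Y → proj₁ (proj₁ Y) ≡ proj₁ (proj₁ X) → E X ≡ E Y → P X ≡ P Y → Y ≡ X
    at-side (x@(c , _) , i) (y , j) eq e p = cong₂ _,_ (direction x y eq (,-injectiveˡ p))
      (sym (⊞-injectiveˡ ⟦ beyond c ⟧ (trans (,-injectiveʳ e) (cong (λ d → j ⊞ ⟦ beyond d ⟧) eq))))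

  at-edge : ∀ X Y → E X ≡ E Y → P X ≡ P Y → Y ≡ X ⊎ Y ≡ S₂ X
  at-edge X Y e p = map-⊎ (λ eq → at-side X Y eq e p)
    (λ eq → at-side (S₂ X) Y eq (trans (E-S₂ X) e) (trans (P-S₂ X) p))
    (same-edge (proj₁ (proj₁ X)) (proj₁ (proj₁ Y)) (,-injectiveˡ e))

  private
    only-common : ∀ {q q′ a b} → OnlyCommon q q′ → face a ≡ face q → face b ≡ face q′ →
                  vert a ≡ vert b → vert a ≡ vert q
    only-common {_ , _} {_ , _} {_ , s} {_ , t} only refl refl eq =
      label⇒vert (only s t (vert⇒label eq))

    common-edge : ∀ {z q′ a b} → CommonEdge z q′ → face a ≡ face (pt z) → face b ≡ face q′ →
                  vert a ≡ vert b → a ≡ pt z ⊎ a ≡ pt (s₀ z)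
    common-edge {z@((_ , _) , false)} {_ , _} {a@(_ , s)} {_ , t} (_ , common) refl refl eq =
      map-⊎ (vert-injective {a} refl ∘ label⇒vert) (vert-injective {a} refl ∘ label⇒vert)
        (common s t (vert⇒label eq))
    common-edge {z@((_ , _) , true)} {_ , _} {a@(_ , s)} {_ , t} (_ , common) refl refl eq =
      map-⊎ (vert-injective {a} refl ∘ label⇒vert) (vert-injective {a} refl ∘ label⇒vert)
        (common s t (vert⇒label eq))

    data Meeting (q q′ : Corner) : Set where
      same   : face q ≡ face q′ → Meeting q q′
      shared : ∀ z → pt z ≡ q → CommonEdge z q′ → Meeting q q′
      only   : OnlyCommon q q′ → Meeting q q′

    -- `meets` compares `q` only with the corners listed in `around`, but by `around-surj` every
    -- corner at the same vertex is listed. The nested `with`s replace `q′` by its entry in that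
    -- list.
    meeting : ∀ q q′ → vert q ≡ vert q′ → Meeting q q′
    meeting q q′ eq with around-surj q′
    ... | i , p with around (vert q′) i | subst (λ v → around v i ≡ q′) (sym eq) p
    ...   | _ | r with around (vert q) i | r | meets q i
    ...     | _ | refl | inj₁ f                    = same (sym f)
    ...     | _ | refl | inj₂ (inj₁ c)             = shared (q , false) refl c
    ...     | _ | refl | inj₂ (inj₂ (inj₁ c))      = shared (pred q , true) (pt-pred q) c
    ...     | _ | refl | inj₂ (inj₂ (inj₂ o))      = only o

  -- The two polygons share both end points. If they are the same polygon, the flags agree; they
  -- cannot share `pt x` alone; and if they share exactly one edge, it is the edge of `x`, so `y`
  -- lies across it.
  at-ends : ∀ x y → vert (pt x) ≡ vert (pt y) → vert (pt (s₀ x)) ≡ vert (pt (s₀ y)) →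
            y ≡ x ⊎ y ≡ s₂ x
  at-ends x y p q = cases (meeting (pt x) (pt y) p)
    where
    same-face : ∀ x → face (proj₁ x) ≡ face (proj₁ y) → vert (pt x) ≡ vert (pt y) →
                vert (pt (s₀ x)) ≡ vert (pt (s₀ y)) → y ≡ x
    same-face x r p q = sym (flag-injective x y
      (vert-injective (trans (face-pt x) (trans r (sym (face-pt y)))) p)
      (vert-injective (trans (face-pt (s₀ x)) (trans r (sym (face-pt (s₀ y))))) q))
    face-s₀ : ∀ x → face (pt (s₀ x)) ≡ face (pt x)
    face-s₀ x = trans (face-pt (s₀ x)) (sym (face-pt x))
    cases : Meeting (pt x) (pt y) → y ≡ x ⊎ y ≡ s₂ x
    cases (same r) = inj₁ (same-face x (trans (sym (face-pt x)) (trans r (face-pt y))) p q)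
    cases (only o) = ⊥-elim (vert-s₀≢ x (only-common {pt x} {pt y} o (face-s₀ x) (face-s₀ y) q))
    cases (shared z pz c) with common-edge {z} {pt y} c (trans (face-s₀ x) (cong face (sym pz))) (face-s₀ y) q
    ... | inj₁ r = ⊥-elim (pt-s₀≢ x (trans r pz))
    ... | inj₂ r with flag-injective z x pz (sym r)
    ...   | refl = inj₂ (same-face (s₂ x) (trans (proj₁ c) (face-pt y)) (trans (vert-s₂ x) p)
      (trans (cong (vert ∘ pt) (sym (s₂-s₀ x))) (trans (vert-s₂ (s₀ x)) q)))

  at-endsᵐ : ∀ X Y → P X ≡ P Y → P (S₀ X) ≡ P (S₀ Y) → Y ≡ X ⊎ Y ≡ S₂ X
  at-endsᵐ X@(x , i) Y@(y , j) p q with at-ends x y (,-injectiveˡ p) (,-injectiveˡ q)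
  ... | inj₁ refl = inj₁ (cong (x ,_) (sym (level-unique {x} {x} refl p)))
  ... | inj₂ refl = inj₂ (cong (s₂ x ,_) (sym (level-unique {s₂ x} {s₂ x} refl (trans (P-S₂ X) p))))

  flag-of-edge : ∀ {e u v} → Joins e u v → ∃[ X ] (E X ≡ e × P X ≡ u × P (S₀ X) ≡ v)
  flag-of-edge {e , k} (inj₁ eq) = ((rep e , false) , k) ,
    cong₂ _,_ (edge-rep e) (⊞-near k (rep-near e)) , cong proj₁ eq , cong proj₂ eq
  flag-of-edge {e , k} (inj₂ eq) = ((rep e , true) , k) ,
    cong₂ _,_ (edge-rep e) (⊞-near k (rep-near e)) , cong proj₂ eq , cong proj₁ eq

  simple : ∀ {e e′ u v} → Joins e u v → Joins e′ u v → e ≡ e′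
  simple J J′ with flag-of-edge J | flag-of-edge J′
  ... | X , e , p , q | Y , e′ , p′ , q′ with at-endsᵐ X Y (trans p (sym p′)) (trans q (sym q′))
  ...   | inj₁ refl = trans (sym e) e′
  ...   | inj₂ refl = trans (sym e) (trans (sym (E-S₂ X)) e′)

  Joins-unique : ∀ {e u v u′ v′} → Joins e u v → Joins e u′ v′ → (u′ ≡ u × v′ ≡ v) ⊎ (v′ ≡ u × u′ ≡ v)
  Joins-unique (inj₁ p) (inj₁ q) = inj₁ (,-injective (trans (sym q) p))
  Joins-unique (inj₁ p) (inj₂ q) = inj₂ (,-injective (trans (sym q) p))
  Joins-unique (inj₂ p) (inj₁ q) = inj₂ (swap (,-injective (trans (sym q) p)))
  Joins-unique (inj₂ p) (inj₂ q) = inj₁ (swap (,-injective (trans (sym q) p)))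

  -- `⊂ᶠ` only says that the edge joins two consecutive corners; `simple` is what identifies it with
  -- the edge on that side of the polygon.
  flag-of : ∀ {e f u v} → Joins e u v → e ⊂ᶠ f → ∃[ X ] (E X ≡ e × P X ≡ u × P (S₀ X) ≡ v × F X ≡ f)
  flag-of {e} {f , i} {u} {v} J (s , J′) = choose (Joins-unique J J′)
    where
    X = (((f , s) , false) , i)
    E≡e : E X ≡ e
    E≡e = simple (E-joins X) J′
    choose : (P X ≡ u × P (S₀ X) ≡ v) ⊎ (P (S₀ X) ≡ u × P X ≡ v) →
             ∃[ X ] (E X ≡ e × P X ≡ u × P (S₀ X) ≡ v × F X ≡ (f , i))
    choose (inj₁ (p , q)) = X , E≡e , p , q , refl
    choose (inj₂ (p , q)) = S₀ X , E≡e , p , q , refl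

  E⊂ᶠF-S₂ : ∀ X → E X ⊂ᶠ F (S₂ X)
  E⊂ᶠF-S₂ X = subst (_⊂ᶠ F (S₂ X)) (E-S₂ X) (E⊂ᶠF (S₂ X))

  P∈ᶠF-S₂ : ∀ X → P X ∈ᶠ F (S₂ X)
  P∈ᶠF-S₂ X = subst (_∈ᶠ F (S₂ X)) (P-S₂ X) (P∈ᶠF (S₂ X))

  F-S₂≢ : ∀ X → F (S₂ X) ≢ F X
  F-S₂≢ ((c , _) , _) eq = s₂-face c (,-injectiveˡ eq)

  faces-of-edge : ∀ X h → E X ⊂ᶠ h → h ≡ F X ⊎ h ≡ F (S₂ X)
  faces-of-edge X h E⊂h with flag-of (E-joins X) E⊂h
  ... | Y , e , p , _ , refl = map-⊎ (cong F) (cong F) (at-edge X Y (sym e) (sym p))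

  two-faces : ∀ e → ∃[ f ] ∃[ g ] (f ≢ g × e ⊂ᶠ f × e ⊂ᶠ g × (∀ h → e ⊂ᶠ h → h ≡ f ⊎ h ≡ g))
  two-faces e with flag-of-edge {e} (inj₁ refl)
  ... | X , refl , _ = F X , F (S₂ X) , F-S₂≢ X ∘ sym , E⊂ᶠF X , E⊂ᶠF-S₂ X , faces-of-edge X

  -- The bit added by `P` is subtracted in advance, so that all these flags lie at the vertex
  -- `(v , k)` itself.
  around-flag : Vertexᵐ → Fin (length degrees) → Flagᵐ
  around-flag (v , k) i = (around v i , false) , k ⊞ ℤ.- ⟦ isB (around v i) ⟧

  P-around : ∀ u i → P (around-flag u i) ≡ u
  P-around (v , k) i = cong₂ _,_ (around-vert v i)
    (trans (⊞-assoc k _ _) (trans (cong (k ⊞_) (ℤ.+-inverseˡ ⟦ isB (around v i) ⟧)) (⊞-identityʳ k)))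

  F-unique : ∀ X Y → pt (proj₁ X) ≡ pt (proj₁ Y) → P X ≡ P Y → F X ≡ F Y
  F-unique (x , i) (y , j) eq p =
    cong₂ _,_ (trans (sym (face-pt x)) (trans (cong face eq) (face-pt y))) (level-unique {x} {y} eq p)

  face-cycle : ∀ u → FaceCycle u (length degrees)
  face-cycle u@(v , k) = record
    { face      = λ i → F (around-flag u i)
    ; n≥3       = degrees≥3
    ; injective = λ {i} {j} eq → around-inj v i j (vert-injective (,-injectiveˡ eq)
                    (trans (around-vert v i) (sym (around-vert v j))))
    ; complete  = λ f → mk⇔ to (λ { (i , refl) → subst (_∈ᶠ F (around-flag u i)) (P-around u i) (P∈ᶠF (around-flag u i)) })
    ; meet      = meet
    }
    where
    to : ∀ {f} → u ∈ᶠ f → ∃[ i ] F (around-flag u i) ≡ f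
    to {f , j} (s , refl) with around-surj (f , s)
    ... | i , eq = i , F-unique (around-flag u i) (((f , s) , false) , j) eq (P-around u i)
    meet : ∀ i → ∃[ e ] (u ∈ᴱ e × e ⊂ᶠ F (around-flag u i) × e ⊂ᶠ F (around-flag u (next i)))
    meet i = choose (around-step v i)
      where
      q = around v i
      via : ∀ x → pt x ≡ q → face (proj₁ x) ≡ face q → pt (s₂ x) ≡ around v (next i) →
            ∃[ e ] (u ∈ᴱ e × e ⊂ᶠ F (around-flag u i) × e ⊂ᶠ F (around-flag u (next i)))
      via x p r eq = E X , subst (_∈ᴱ E X) PX (P∈ᴱE X) ,
        subst (E X ⊂ᶠ_) (cong (_, proj₂ X) r) (E⊂ᶠF X) ,
        subst (E X ⊂ᶠ_) (F-unique (S₂ X) (around-flag u (next i)) eq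
          (trans (P-S₂ X) (trans PX (sym (P-around u (next i)))))) (E⊂ᶠF-S₂ X)
        where
        X = x , proj₂ (around-flag u i)
        PX : P X ≡ u
        PX = trans (cong (λ c → vert c , proj₂ (around-flag u i) ⊞ ⟦ isB c ⟧) p) (P-around u i)
      choose : around v (next i) ≡ pt (s₂ (q , false)) ⊎ around v (next i) ≡ pt (s₂ (pred q , true)) → _
      choose (inj₁ eq) = via (q , false) refl refl (sym eq)
      choose (inj₂ eq) = via (pred q , true) (pt-pred q) refl (sym eq)

  polyhedral : ∀ {f g} → f ≢ g → (∃[ v ] (v ∈ᶠ f × v ∈ᶠ g)) →
               (∃[ v ] ∀ w → (w ∈ᶠ f × w ∈ᶠ g) ⇔ w ≡ v) ⊎
               (∃[ e ] (e ⊂ᶠ f × e ⊂ᶠ g × (∀ w → (w ∈ᶠ f × w ∈ᶠ g) ⇔ w ∈ᴱ e)))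
  polyhedral {f , i} {g , j} f≢g (u , (s , p) , (t , p′)) = cases (meeting c d (,-injectiveˡ pp))
    where
    c = f , s
    d = g , t
    X = (c , false) , i
    Y = (d , false) , j
    pp : P X ≡ P Y
    pp = trans p (sym p′)
    cases : Meeting c d → _
    -- Copies of one polygon on different levels have no common vertex: it would be the same corner,
    -- which determines the level.
    cases (same r) = ⊥-elim (f≢g (F-unique X Y (vert-injective r (,-injectiveˡ pp)) pp))
    -- All common vertices lie over one vertex of K, and `f` has only one corner there.
    cases (only o) = inj₁ (u , λ w → mk⇔
      (λ { ((a , q) , (b , q′)) → trans (sym q) (trans (cong (λ c → P ((c , false) , i))
             (vert-injective {f , a} {c} refl (only-common {c} {d} {f , a} {g , b} o refl refl (,-injectiveˡ (trans q (sym q′)))))) p) })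
      (λ { refl → (s , p) , (t , p′) }))
    cases (shared z pz ce) = inj₂ (E Z , E⊂f , subst (E Z ⊂ᶠ_) F-S₂Z (E⊂ᶠF-S₂ Z) , λ w → mk⇔
      (λ { ((a , q) , (b , q′)) → to q (common-edge {z} {d} {f , a} {g , b} ce (cong face (sym pz)) refl (,-injectiveˡ (trans q (sym q′)))) })
      (from ∘ ∈ᴱE⇒ Z))
      where
      Z = z , i
      F-Z : F Z ≡ (f , i)
      F-Z = cong (_, i) (trans (sym (face-pt z)) (cong face pz))
      P-Z : P Z ≡ P Y
      P-Z = trans (cong (λ c → vert c , i ⊞ ⟦ isB c ⟧) pz) pp
      E⊂f : E Z ⊂ᶠ (f , i)
      E⊂f = subst (E Z ⊂ᶠ_) F-Z (E⊂ᶠF Z)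
      -- In K the polygon across `z` is `g`; the common vertex forces its level to be `j`.
      F-S₂Z : F (S₂ Z) ≡ (g , j)
      F-S₂Z = F-unique (S₂ Z) Y (vert-injective (trans (face-pt (s₂ z)) (proj₁ ce))
        (trans (vert-s₂ z) (,-injectiveˡ P-Z))) (trans (P-S₂ Z) P-Z)
      to : ∀ {w a} → P (((f , a) , false) , i) ≡ w → (f , a) ≡ pt z ⊎ (f , a) ≡ pt (s₀ z) → w ∈ᴱ E Z
      to q (inj₁ eq) = subst (_∈ᴱ E Z) (trans (cong (λ c → vert c , i ⊞ ⟦ isB c ⟧) (sym eq)) q) (P∈ᴱE Z)
      to q (inj₂ eq) = subst (_∈ᴱ E Z) (trans (cong (λ c → vert c , i ⊞ ⟦ isB c ⟧) (sym eq)) q) (P-S₀∈ᴱE Z)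
      from : ∀ {w} → w ≡ P Z ⊎ w ≡ P (S₀ Z) → w ∈ᶠ (f , i) × w ∈ᶠ (g , j)
      from (inj₁ refl) = subst (P Z ∈ᶠ_) F-Z (P∈ᶠF Z) , subst (P Z ∈ᶠ_) F-S₂Z (P∈ᶠF-S₂ Z)
      from (inj₂ refl) = subst (P (S₀ Z) ∈ᶠ_) F-Z (P∈ᶠF (S₀ Z)) ,
        subst (P (S₀ Z) ∈ᶠ_) F-S₂Z (P∈ᶠF-S₂ (S₀ Z))

-- Connectedness and Euler characteristic of Kᵐ.

cyclic-induction : ∀ {n} (R : Fin n → Set) → (∀ i → R i → R (next i)) → (∀ i → R i → R (prev i)) →
                   ∀ s → R s → ∀ t → R t
cyclic-induction {suc n} R up down s Rs = <-weakInduction R (to-zero s Rs)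
  (λ i Ri → subst R (next-inject₁ i) (up _ Ri))
  where
  to-zero : ∀ s → R s → R zero
  to-zero = <-weakInduction (λ s → R s → R zero) id (λ i Ri⇒R0 → Ri⇒R0 ∘ down (suc i))

module Polyhedral {degrees : List ℕ} {S : Scheme degrees} (ok : IsValid S)
                  (m : ℕ) .{{_ : NonZero m}} where

  open Scheme S
  open IsValid ok
  open Residue m
  open Cover ok m
  open Complex complex using (corner; Joins; _∈ᴱ_; _∈ᶠ_; _⊂ᶠ_; Adjacent; FaceCycle)

  baseFace : Fin #f
  baseFace = face (proj₁ base)

  module _ (Q : Faceᵐ → Set)
           (step : ∀ X → beyond (proj₁ (proj₁ X)) ≡ beyond (opp (proj₁ (proj₁ X))) →
                   Q (F X) → Q (F (S₂ X))) where

    private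
      level-stays : ∀ {c} i → beyond c ≡ beyond (opp c) → i ⊞ jump c ≡ i
      level-stays {c} i eq = trans
        (cong (i ⊞_) (trans (cong (λ b → ⟦ beyond c ⟧ ℤ.- ⟦ b ⟧) (sym eq)) (ℤ.+-inverseʳ ⟦ beyond c ⟧)))
        (⊞-identityʳ i)

      ascend : ∀ f i → Acc Fin._<_ f → Q (baseFace , i) → Q (f , i)
      ascend f i (acc rs) Qb with descend f
      ... | inj₁ refl = Qb
      ... | inj₂ (s , lt , eq) = subst Q (cong₂ _,_ (cong face (opp-opp c)) (level-stays i eq′))
        (step ((opp c , false) , i) eq′ (ascend _ i (rs lt) Qb))
        where
        c = f , s
        eq′ : beyond (opp c) ≡ beyond (opp (opp c))
        eq′ = trans (sym eq) (cong beyond (sym (opp-opp c)))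

      return : ∀ f i → Acc Fin._<_ f → Q (f , i) → Q (baseFace , i)
      return f i (acc rs) Qf with descend f
      ... | inj₁ refl = Qf
      ... | inj₂ (s , lt , eq) = return _ i (rs lt)
        (subst Q (cong (_ ,_) (level-stays i eq)) (step (((f , s) , false) , i) eq Qf))

    -- `Q` is only assumed to pass across sides off C, where the level stays. Each polygon descends
    -- to the base through such sides, and the way back is open too: a single copy of the cut map is
    -- connected, which for `m = 1` says that C does not separate.
    level-induction : ∀ f i → Q (f , i) → ∀ g → Q (g , i)
    level-induction f i Qf g = ascend g i (<-wellFounded g) (return f i (<-wellFounded f) Qf)

  private
    first : Fin len
    first with len | len≥3
    ... | suc _ | _ = zero

    -- Passing through an edge of C from side B leads to side A of the next copy. Either side of the
    -- first edge of C, or its opposite, serves.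
    gate : ∃[ c ] jump c ≡ 1ℤ
    gate with beyond c in p | beyond (opp c) in q | cycle-crosses first
      where c = proj₁ (cycle first)
    ... | true  | false | _ = c , cong₂ (λ a b → ⟦ a ⟧ ℤ.- ⟦ b ⟧) p q
      where c = proj₁ (cycle first)
    ... | false | true  | _ = opp c , cong₂ (λ a b → ⟦ a ⟧ ℤ.- ⟦ b ⟧) q (trans (cong beyond (opp-opp c)) p)
      where c = proj₁ (cycle first)
    ... | true  | true  | ne = ⊥-elim (ne refl)
    ... | false | false | ne = ⊥-elim (ne refl)

  -- Level `n + 1` is entered from level `n` through the gate and then filled by `level-induction`;
  -- every level is the residue of a natural number.
  face-induction : (Q : Faceᵐ → Set) → (∀ X → Q (F X) → Q (F (S₂ X))) →
                   Q (baseFace , ι 0ℤ) → ∀ f → Q f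
  face-induction Q step Qb (f , i) = subst (λ i → Q (f , i)) (ι-toℕ i) (go (toℕ i) f)
    where
    go : ∀ n f → Q (f , ι (+ n))
    go zero    f = level-induction Q (λ X _ → step X) baseFace (ι 0ℤ) Qb f
    go (suc n) f = level-induction Q (λ X _ → step X) (face (opp c)) (ι (+ suc n))
      (subst (λ i → Q (face (opp c) , i)) (trans (cong (ι (+ n) ⊞_) jump≡1) (trans (ι-⊞ (+ n) 1ℤ)
        (cong (ι ∘ +_) (ℕ.+-comm n 1)))) (step ((c , false) , ι (+ n)) (go n (face c)))) f
      where
      c = proj₁ gate
      jump≡1 = proj₂ gate

  private
    Adjacent-sym : ∀ {u v} → Adjacent u v → Adjacent v u
    Adjacent-sym (e , J) = e , Joins-sym J

    around-face : ∀ {u} f s → Star Adjacent u (corner f s) →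
                  ∀ t → Star Adjacent u (corner f t)
    around-face {u} (f , i) s u→s = cyclic-induction (λ t → Star Adjacent u (corner (f , i) t))
      (λ t u→t → u→t ◅◅ (edge-at t ◅ ε))
      (λ t u→t → u→t ◅◅ (subst (λ t′ → Adjacent (corner (f , i) t′) (corner (f , i) (prev t))) (next-prev t)
                           (Adjacent-sym (edge-at (prev t))) ◅ ε)) s u→s
      where
      edge-at : ∀ t → Adjacent (corner (f , i) t) (corner (f , i) (next t))
      edge-at t = _ , E-joins (((f , t) , false) , i)

  P-surjective : ∀ u → ∃[ X ] P X ≡ u
  P-surjective u = around-flag u first-of , P-around u first-of
    where
    first-of : Fin (length degrees)
    first-of with length degrees | degrees≥3
    ... | suc _ | _ = zero

  base→ : ∀ v → Star Adjacent (P (base , ι 0ℤ)) v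
  base→ v with P-surjective v
  ... | X , refl with P∈ᶠF X
  ...   | t , eq = subst (Star Adjacent _) eq (face-induction Q step start (F X) t)
    where
    Q : Faceᵐ → Set
    Q f = ∀ s → Star Adjacent (P (base , ι 0ℤ)) (corner f s)
    start : Q (baseFace , ι 0ℤ)
    start with P∈ᶠF (base , ι 0ℤ)
    ... | s , eq = around-face (baseFace , ι 0ℤ) s (subst (Star Adjacent _) (sym eq) ε)
    step : ∀ X → Q (F X) → Q (F (S₂ X))
    step X QX with P∈ᶠF X | P∈ᶠF-S₂ X
    ... | s , p | t , q = around-face (F (S₂ X)) t (subst (Star Adjacent _) (trans p (sym q)) (QX s))

  isPolyhedralMap : IsPolyhedralMap complex
  isPolyhedralMap = record
    { basepoint        = P (base , ι 0ℤ)
    ; loopless         = λ J → λ { refl → loopless J }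
    ; simple           = simple
    ; polygon          = size≥3 ∘ proj₁
    ; corner-injective = λ f eq → label-injective _ _ _ (vert⇒label (,-injectiveˡ eq))
    ; boundary-edge    = λ (f , i) s → _ , E-joins (((f , s) , false) , i)
    ; two-faces        = two-faces
    ; face-cycle       = λ u → _ , face-cycle u
    ; connected        = λ u v → Star.reverse Adjacent-sym (base→ u) ◅◅ base→ v
    ; polyhedral       = polyhedral
    }
    where
    loopless : ∀ {e u} → ¬ Joins e u u
    loopless J with flag-of-edge J
    ... | (x , i) , _ , p , q = vert-s₀≢ x (,-injectiveˡ (trans q (sym p)))

  polyhedralMap : PolyhedralMap
  polyhedralMap = record { complex = complex ; isPolyhedralMap = isPolyhedralMap }

  χ-cover : PolyhedralMap.χ polyhedralMap ≡ ℤ.- (+ (2 ℕ.* m))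
  χ-cover = begin
    + (#v ℕ.* m) ℤ.- + (#e ℕ.* m) ℤ.+ + (#f ℕ.* m)
      ≡⟨ cong (λ e → + (#v ℕ.* m) ℤ.- + (e ℕ.* m) ℤ.+ + (#f ℕ.* m)) (sym euler) ⟩
    + (#v ℕ.* m) ℤ.- + ((#v ℕ.+ #f ℕ.+ 2) ℕ.* m) ℤ.+ + (#f ℕ.* m)
      ≡⟨ cong₂ (λ x y → x ℤ.- y ℤ.+ + (#f ℕ.* m)) (ℤ.pos-* #v m) (ℤ.pos-* (#v ℕ.+ #f ℕ.+ 2) m) ⟩
    + #v ℤ.* + m ℤ.- (+ #v ℤ.+ + #f ℤ.+ + 2) ℤ.* + m ℤ.+ + (#f ℕ.* m)
      ≡⟨ cong (λ y → + #v ℤ.* + m ℤ.- (+ #v ℤ.+ + #f ℤ.+ + 2) ℤ.* + m ℤ.+ y) (ℤ.pos-* #f m) ⟩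
    + #v ℤ.* + m ℤ.- (+ #v ℤ.+ + #f ℤ.+ + 2) ℤ.* + m ℤ.+ + #f ℤ.* + m
      ≡⟨ lemma (+ #v) (+ #f) (+ m) ⟩
    ℤ.- (+ 2 ℤ.* + m)
      ≡⟨ cong ℤ.-_ (sym (ℤ.pos-* 2 m)) ⟩
    ℤ.- + (2 ℕ.* m) ∎
    where
    open ≡-Reasoning
    lemma : ∀ v f m → v ℤ.* m ℤ.- (v ℤ.+ f ℤ.+ + 2) ℤ.* m ℤ.+ f ℤ.* m ≡ ℤ.- (+ 2 ℤ.* m)
    lemma = solve-∀

  face-degrees : ∀ u i → size (proj₁ (FaceCycle.face (face-cycle u) i)) ≡ lookup degrees i
  face-degrees (v , _) i = around-size v i

-- Automorphism groups

module _ (G H : Group 0ℓ 0ℓ) where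
  private
    module G = Group G
    module H = Group H

  -- In the applications `α` is the evident action of the abstract group on Kᵐ, and `θ` reads the
  -- group element off the image of the origin. As `α` is injective, all properties of `θ` can be
  -- checked after applying `α`.
  ≅-from-section : (α : G.Carrier → H.Carrier) (θ : H.Carrier → G.Carrier) →
    (∀ {x y} → x G.≈ y → α x H.≈ α y) → (∀ {x y} → α x H.≈ α y → x G.≈ y) →
    (∀ x y → α (x G.∙ y) H.≈ α x H.∙ α y) → (∀ h → α (θ h) H.≈ h) → H ≅ G
  ≅-from-section α θ α-cong α-injective α-homo α-θ = θ , record
    { isGroupMonomorphism = record
      { isGroupHomomorphism = record
        { isMonoidHomomorphism = record
          { isMagmaHomomorphism = record
            { isRelHomomorphism = record { cong = θ-cong } ; homo = θ-homo }
          ; ε-homo = θ-ε }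
        ; ⁻¹-homo = θ-⁻¹ }
      ; injective = λ {x} {y} eq → H.trans (H.sym (α-θ x)) (H.trans (α-cong eq) (α-θ y)) }
    ; surjective = λ g → α g , λ {h} eq → α-injective (H.trans (α-θ h) eq)
    }
    where
    θ-cong : ∀ {x y} → x H.≈ y → θ x G.≈ θ y
    θ-cong {x} {y} eq = α-injective (H.trans (α-θ x) (H.trans eq (H.sym (α-θ y))))
    θ-homo : ∀ x y → θ (x H.∙ y) G.≈ θ x G.∙ θ y
    θ-homo x y = α-injective (H.trans (α-θ (x H.∙ y)) (H.sym (H.trans (α-homo (θ x) (θ y))
      (H.∙-cong (α-θ x) (α-θ y)))))
    θ-ε : θ H.ε G.≈ G.ε
    θ-ε = GroupProperties.identityʳ-unique G (θ H.ε) (θ H.ε)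
      (G.trans (G.sym (θ-homo H.ε H.ε)) (θ-cong (H.identityˡ H.ε)))
    θ-⁻¹ : ∀ x → θ (x H.⁻¹) G.≈ θ x G.⁻¹
    θ-⁻¹ x = GroupProperties.inverseˡ-unique G (θ (x H.⁻¹)) (θ x)
      (G.trans (G.sym (θ-homo (x H.⁻¹) x)) (G.trans (θ-cong (H.inverseˡ x)) θ-ε))

data Letter : Set where
  ₀ ₁ ₂ : Letter

module Words {degrees : List ℕ} (S : Scheme degrees) where
  open Scheme S

  step : Letter → Flag × ℤ → Flag × ℤ
  step ₀ (x , k) = s₀ x , k
  step ₁ (x , k) = s₁ x , k
  step ₂ (x , k) = s₂ x , k ℤ.+ jump (proj₁ x)

  -- The level is tracked in ℤ rather than modulo `m`, so that one evaluation serves every `m`.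
  run : List Letter → Flag × ℤ → Flag × ℤ
  run []      x = x
  run (l ∷ w) x = run w (step l x)

  -- If w closes up at base without change of level, no automorphism takes base to y.
  Excludes : Flag → List Letter → Set
  Excludes y w = proj₁ (run w (y , 0ℤ)) ≢ y ⊎ ℤ.∣ proj₂ (run w (y , 0ℤ)) ∣ ≡ 1

-- An involution of K, to be lifted to Kᵐ by sending the level i of a cell to
-- the height of the cell minus i.
record Mirror {degrees : List ℕ} (S : Scheme degrees) : Set where
  open Scheme S
  field
    mirror  : Flag → Flag
    mirrorV : Fin #v → Fin #v
    mirrorE : Fin #e → Fin #e
    mirrorF : Fin #f → Fin #f
    heightV : Fin #v → ℤ
    heightE : Fin #e → ℤ
    heightF : Fin #f → ℤ

-- The sums in `height-V` and `height-E` say that `height - i` gives the same level whether computed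
-- on the cell or on a flag of it. Homologically, the involution turns the change of level into its
-- negative, up to the coboundary of `heightF`. Symmetry of `heightF` makes the lift an involution,
-- and `moves` keeps it apart from the deck translations.
record IsMirror {degrees : List ℕ} {S : Scheme degrees} (M : Mirror S) : Set where
  open Scheme S
  open Mirror M
  field
    mirror-s₀         : ∀ c d → mirror (s₀ (c , d)) ≡ s₀ (mirror (c , d))
    mirror-involutive : ∀ c d → mirror (mirror (c , d)) ≡ (c , d)
    mirror-V          : ∀ c d → vert (pt (mirror (c , d))) ≡ mirrorV (vert (pt (c , d)))
    mirror-E          : ∀ c d → edge (proj₁ (mirror (c , d))) ≡ mirrorE (edge c)
    mirror-F          : ∀ c d → face (proj₁ (mirror (c , d))) ≡ mirrorF (face c)
    height-V          : ∀ c d → heightV (vert (pt (c , d))) ≡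
      heightF (face c) ℤ.+ ⟦ isB (pt (mirror (c , d))) ⟧ ℤ.+ ⟦ isB (pt (c , d)) ⟧
    height-E          : ∀ c d → heightE (edge c) ≡
      heightF (face c) ℤ.+ ⟦ beyond (proj₁ (mirror (c , d))) ⟧ ℤ.+ ⟦ beyond c ⟧
    height-F          : ∀ f → heightF (mirrorF f) ≡ heightF f
    moves             : ∃[ v ] mirrorV v ≢ v

-- Automorphisms of Kᵐ and their action on flags.

module Automorphisms {degrees : List ℕ} {S : Scheme degrees} (ok : IsValid S)
                     (m : ℕ) .{{_ : NonZero m}} where

  open Scheme S
  open IsValid ok
  open Residue m
  open Cover ok m
  open Polyhedral ok m
  open Complex complex using (Joins; _∈ᴱ_; _∈ᶠ_; _⊂ᶠ_; Adjacent; FaceCycle; ends)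
  open Words S

  at-cornerᵐ : ∀ X Y → P X ≡ P Y → F X ≡ F Y → Y ≡ X ⊎ Y ≡ S₁ X
  at-cornerᵐ X@(x , i) Y@(y , j) p q
    with at-corner x y (vert-injective (trans (face-pt x) (trans (,-injectiveˡ q) (sym (face-pt y)))) (,-injectiveˡ p))
  ... | inj₁ refl = inj₁ (cong (x ,_) (sym (,-injectiveʳ q)))
  ... | inj₂ refl = inj₂ (cong (s₁ x ,_) (sym (,-injectiveʳ q)))

  private
    joins-ends : ∀ {e u v} → u ∈ᴱ e → v ∈ᴱ e → u ≢ v → Joins e u v
    joins-ends (inj₁ refl) (inj₁ refl) u≢v = ⊥-elim (u≢v refl)
    joins-ends (inj₁ refl) (inj₂ refl) u≢v = inj₁ refl
    joins-ends (inj₂ refl) (inj₁ refl) u≢v = inj₂ refl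
    joins-ends (inj₂ refl) (inj₂ refl) u≢v = ⊥-elim (u≢v refl)

    P≢ : ∀ X → P X ≢ P (S₀ X)
    P≢ (x , i) eq = vert-s₀≢ x (sym (,-injectiveˡ eq))

  module _ (φ : Automorphism polyhedralMap) where
    open Automorphism φ

    private
      φV = Inverse.to onV
      φE = Inverse.to onE
      φF = Inverse.to onF

    abstract
      -- Distinct end points of an edge go to distinct end points of the image edge, which lies on
      -- the image polygon; `flag-of` turns these incidences into a flag.
      image : ∀ X → ∃[ Y ] (E Y ≡ φE (E X) × P Y ≡ φV (P X) × P (S₀ Y) ≡ φV (P (S₀ X)) × F Y ≡ φF (F X))
      image X = flag-of
        (joins-ends (Equivalence.to (V∈E _ _) (P∈ᴱE X)) (Equivalence.to (V∈E _ _) (P-S₀∈ᴱE X))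
          (P≢ X ∘ Injection.injective (↔⇒↣ onV)))
        (Equivalence.to (E⊂F _ _) (E⊂ᶠF X))

      onFlag : Flagᵐ → Flagᵐ
      onFlag X = proj₁ (image X)

      E-onFlag : ∀ X → E (onFlag X) ≡ φE (E X)
      E-onFlag X = proj₁ (proj₂ (image X))

      P-onFlag : ∀ X → P (onFlag X) ≡ φV (P X)
      P-onFlag X = proj₁ (proj₂ (proj₂ (image X)))

      P-S₀-onFlag : ∀ X → P (S₀ (onFlag X)) ≡ φV (P (S₀ X))
      P-S₀-onFlag X = proj₁ (proj₂ (proj₂ (proj₂ (image X))))

      F-onFlag : ∀ X → F (onFlag X) ≡ φF (F X)
      F-onFlag X = proj₂ (proj₂ (proj₂ (proj₂ (image X))))

    onFlag-S₀ : ∀ X → onFlag (S₀ X) ≡ S₀ (onFlag X)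
    onFlag-S₀ X = Flagᵐ-injective
      (trans (P-onFlag (S₀ X)) (sym (P-S₀-onFlag X)))
      (trans (P-S₀-onFlag (S₀ X)) (trans (cong (φV ∘ P) (S₀-S₀ X))
        (trans (sym (P-onFlag X)) (cong P (sym (S₀-S₀ (onFlag X)))))))
      (trans (F-onFlag (S₀ X)) (sym (F-onFlag X)))

    -- The images of `X` and `S₁ X` share vertex and polygon, so they are equal or exchanged by
    -- `S₁`. If they were equal, injectivity on vertices would give `S₁ X` and `X` the same far end
    -- point.
    onFlag-S₁ : ∀ X → onFlag (S₁ X) ≡ S₁ (onFlag X)
    onFlag-S₁ X = [ ⊥-elim ∘ fixed , id ]′ (at-cornerᵐ (onFlag X) (onFlag (S₁ X))
      (trans (P-onFlag X) (trans (cong φV (sym (P-S₁ X))) (sym (P-onFlag (S₁ X)))))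
      (trans (F-onFlag X) (trans (cong φF (sym (F-S₁ X))) (sym (F-onFlag (S₁ X))))))
      where
      fixed : onFlag (S₁ X) ≢ onFlag X
      fixed eq = s₁≢ (proj₁ X) (cong proj₁ (Flagᵐ-injective {S₁ X} {X} (P-S₁ X)
        (Injection.injective (↔⇒↣ onV)
          (trans (sym (P-S₀-onFlag (S₁ X))) (trans (cong (P ∘ S₀) eq) (P-S₀-onFlag X))))
        (F-S₁ X)))

    -- As for `S₁`, now with vertex and edge shared; equality is excluded by injectivity on
    -- polygons.
    onFlag-S₂ : ∀ X → onFlag (S₂ X) ≡ S₂ (onFlag X)
    onFlag-S₂ X = [ ⊥-elim ∘ fixed , id ]′ (at-edge (onFlag X) (onFlag (S₂ X))
      (trans (E-onFlag X) (trans (cong φE (sym (E-S₂ X))) (sym (E-onFlag (S₂ X)))))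
      (trans (P-onFlag X) (trans (cong φV (sym (P-S₂ X))) (sym (P-onFlag (S₂ X))))))
      where
      fixed : onFlag (S₂ X) ≢ onFlag X
      fixed eq = F-S₂≢ X (Injection.injective (↔⇒↣ onF)
        (trans (sym (F-onFlag (S₂ X))) (trans (cong F eq) (F-onFlag X))))

  origin : Flagᵐ
  origin = base , ι 0ℤ

  module _ (φ ψ : Automorphism polyhedralMap) where

    private
      Agree : Flagᵐ → Set
      Agree X = onFlag φ X ≡ onFlag ψ X

      agree-S₀ : ∀ X → Agree X → Agree (S₀ X)
      agree-S₀ X eq = trans (onFlag-S₀ φ X) (trans (cong S₀ eq) (sym (onFlag-S₀ ψ X)))

      agree-S₁ : ∀ X → Agree X → Agree (S₁ X)
      agree-S₁ X eq = trans (onFlag-S₁ φ X) (trans (cong S₁ eq) (sym (onFlag-S₁ ψ X)))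

      agree-S₂ : ∀ X → Agree X → Agree (S₂ X)
      agree-S₂ X eq = trans (onFlag-S₂ φ X) (trans (cong S₂ eq) (sym (onFlag-S₂ ψ X)))

      agree-face : ∀ X → Agree X → ∀ Y → F Y ≡ F X → Agree Y
      agree-face (((f , s) , d) , i) eq (((.f , t) , d′) , .i) refl = to d′
        (cyclic-induction (λ t → Agree (((f , t) , false) , i))
          (λ t → agree-S₁ (((f , t) , true) , i) ∘ agree-S₀ (((f , t) , false) , i))
          (λ t → agree-S₀ (((f , prev t) , true) , i) ∘ agree-S₁ (((f , t) , false) , i))
          s (from d eq) t)
        where
        from : ∀ d → Agree (((f , s) , d) , i) → Agree (((f , s) , false) , i)
        from false = id
        from true  = agree-S₀ (((f , s) , true) , i)
        to : ∀ d → Agree (((f , t) , false) , i) → Agree (((f , t) , d) , i)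
        to false = id
        to true  = agree-S₀ (((f , t) , false) , i)

    -- Agreement on one flag spreads round its polygon by `S₀` and `S₁` and to neighbouring polygons
    -- by `S₂`, hence everywhere by connectedness.
    rigid : onFlag φ origin ≡ onFlag ψ origin →
            ∀ v → Inverse.to (Automorphism.onV φ) v ≡ Inverse.to (Automorphism.onV ψ) v
    rigid eq v with P-surjective v
    ... | X , refl = trans (sym (P-onFlag φ X)) (trans (cong P (agree X refl)) (P-onFlag ψ X))
      where
      agree : ∀ Y → F Y ≡ F X → Agree Y
      agree = face-induction (λ f → ∀ Y → F Y ≡ f → Agree Y)
        (λ X Q → agree-face (S₂ X) (agree-S₂ X (Q X refl)))
        (agree-face origin eq) (F X)

  private
    stepᵐ : Letter → Flagᵐ → Flagᵐ
    stepᵐ ₀ = S₀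
    stepᵐ ₁ = S₁
    stepᵐ ₂ = S₂

    runᵐ : List Letter → Flagᵐ → Flagᵐ
    runᵐ []      X = X
    runᵐ (l ∷ w) X = runᵐ w (stepᵐ l X)

    runᵐ-run : ∀ w x i k → runᵐ w (x , i ⊞ k) ≡ (proj₁ (run w (x , k)) , i ⊞ proj₂ (run w (x , k)))
    runᵐ-run []      x i k = refl
    runᵐ-run (₀ ∷ w) x i k = runᵐ-run w (s₀ x) i k
    runᵐ-run (₁ ∷ w) x i k = runᵐ-run w (s₁ x) i k
    runᵐ-run (₂ ∷ w) x i k = trans (cong (λ j → runᵐ w (s₂ x , j)) (⊞-assoc i k (jump (proj₁ x))))
      (runᵐ-run w (s₂ x) i (k ℤ.+ jump (proj₁ x)))

    runᵐ-start : ∀ w x i → runᵐ w (x , i) ≡ (proj₁ (run w (x , 0ℤ)) , i ⊞ proj₂ (run w (x , 0ℤ)))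
    runᵐ-start w x i = trans (cong (λ j → runᵐ w (x , j)) (sym (⊞-identityʳ i))) (runᵐ-run w x i 0ℤ)

    onFlag-run : ∀ φ w X → onFlag φ (runᵐ w X) ≡ runᵐ w (onFlag φ X)
    onFlag-run φ []      X = refl
    onFlag-run φ (₀ ∷ w) X = trans (onFlag-run φ w (S₀ X)) (cong (runᵐ w) (onFlag-S₀ φ X))
    onFlag-run φ (₁ ∷ w) X = trans (onFlag-run φ w (S₁ X)) (cong (runᵐ w) (onFlag-S₁ φ X))
    onFlag-run φ (₂ ∷ w) X = trans (onFlag-run φ w (S₂ X)) (cong (runᵐ w) (onFlag-S₂ φ X))

  excluded : 2 ≤ m → ∀ φ w {y} → run w (base , 0ℤ) ≡ (base , 0ℤ) → Excludes y w →
             proj₁ (onFlag φ origin) ≢ y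
  excluded 2≤m φ w {y} closed excl refl = cases excl
    where
    j = proj₂ (onFlag φ origin)
    fixed : onFlag φ origin ≡ (proj₁ (run w (y , 0ℤ)) , j ⊞ proj₂ (run w (y , 0ℤ)))
    fixed = trans (cong (onFlag φ) (sym (trans (runᵐ-start w base (ι 0ℤ))
        (trans (cong₂ (λ x k → x , ι 0ℤ ⊞ k) (,-injectiveˡ closed) (,-injectiveʳ closed))
          (cong (base ,_) (⊞-identityʳ (ι 0ℤ)))))))
      (trans (onFlag-run φ w origin) (runᵐ-start w y j))
    cases : ¬ Excludes y w
    cases (inj₁ moved) = moved (sym (cong proj₁ fixed))
    -- Closing up at `y` means that `m` divides the change of level, which is ±1; this contradicts
    -- `2 ≤ m`.
    cases (inj₂ wind)  = ℕ.>⇒∤ 2≤m (subst (m ℕ.∣_) (trans (ℤ.∣-i∣≡∣i∣ k) wind)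
      (subst (λ l → m ℕ.∣ ℤ.∣ l ∣) (ℤ.+-identityˡ (ℤ.- k))
        (∣⇒∣ᵤ (⊞-injectiveʳ j 0ℤ k (trans (⊞-identityʳ j) (cong proj₂ fixed))))))
      where k = proj₂ (run w (y , 0ℤ))

  private
    -- A cell map that comes from a map of flags. Incidences are then preserved automatically, since
    -- each of them is witnessed by a flag.
    record Lift : Set where
      field
        onVᵐ : Vertexᵐ → Vertexᵐ
        onEᵐ : Edgeᵐ → Edgeᵐ
        onFᵐ : Faceᵐ → Faceᵐ
        lift : Flagᵐ → Flagᵐ
        P-lift  : ∀ X → P (lift X) ≡ onVᵐ (P X)
        E-lift  : ∀ X → E (lift X) ≡ onEᵐ (E X)
        F-lift  : ∀ X → F (lift X) ≡ onFᵐ (F X)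
        lift-S₀ : ∀ X → lift (S₀ X) ≡ S₀ (lift X)

      on-∈ᴱ : ∀ v e → v ∈ᴱ e → onVᵐ v ∈ᴱ onEᵐ e
      on-∈ᴱ v e v∈e with flag-of-edge {e} (inj₁ refl)
      ... | X , refl , _ with ∈ᴱE⇒ X v∈e
      ...   | inj₁ refl = subst₂ _∈ᴱ_ (P-lift X) (E-lift X) (P∈ᴱE (lift X))
      ...   | inj₂ refl = subst₂ _∈ᴱ_ (P-lift (S₀ X)) (E-lift (S₀ X)) (P∈ᴱE (lift (S₀ X)))

      on-∈ᶠ : ∀ v f → v ∈ᶠ f → onVᵐ v ∈ᶠ onFᵐ f
      on-∈ᶠ v (f , i) (s , refl) = subst₂ _∈ᶠ_ (P-lift X) (F-lift X) (P∈ᶠF (lift X))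
        where X = ((f , s) , false) , i

      on-⊂ᶠ : ∀ e f → e ⊂ᶠ f → onEᵐ e ⊂ᶠ onFᵐ f
      on-⊂ᶠ e f e⊂f with flag-of {e} (inj₁ refl) e⊂f
      ... | X , refl , _ , _ , refl = subst₂ _⊂ᶠ_ (E-lift X) (F-lift X) (E⊂ᶠF (lift X))

    open Lift

    record Inverses (A B : Lift) : Set where
      field
        invV : ∀ v → onVᵐ A (onVᵐ B v) ≡ v
        invE : ∀ e → onEᵐ A (onEᵐ B e) ≡ e
        invF : ∀ f → onFᵐ A (onFᵐ B f) ≡ f

    automorphism : (A B : Lift) → Inverses A B → Inverses B A → Automorphism polyhedralMap
    automorphism A B AB BA = record
      { onV = mk↔ₛ′ (onVᵐ A) (onVᵐ B) (invV AB) (invV BA)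
      ; onE = mk↔ₛ′ (onEᵐ A) (onEᵐ B) (invE AB) (invE BA)
      ; onF = mk↔ₛ′ (onFᵐ A) (onFᵐ B) (invF AB) (invF BA)
      ; V∈E = λ v e → mk⇔ (on-∈ᴱ A v e) (subst₂ _∈ᴱ_ (invV BA v) (invE BA e) ∘ on-∈ᴱ B _ _)
      ; V∈F = λ v f → mk⇔ (on-∈ᶠ A v f) (subst₂ _∈ᶠ_ (invV BA v) (invF BA f) ∘ on-∈ᶠ B _ _)
      ; E⊂F = λ e f → mk⇔ (on-⊂ᶠ A e f) (subst₂ _⊂ᶠ_ (invE BA e) (invF BA f) ∘ on-⊂ᶠ B _ _)
      }
      where open Inverses

    onFlag-automorphism : ∀ A B AB BA X → onFlag (automorphism A B AB BA) X ≡ lift A X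
    onFlag-automorphism A B AB BA X = Flagᵐ-injective
      (trans (P-onFlag φ X) (sym (P-lift A X)))
      (trans (P-S₀-onFlag φ X) (trans (sym (P-lift A (S₀ X))) (cong P (lift-S₀ A X))))
      (trans (F-onFlag φ X) (sym (F-lift A X)))
      where φ = automorphism A B AB BA

    ⊞-comm : ∀ i k l → i ⊞ k ⊞ l ≡ i ⊞ l ⊞ k
    ⊞-comm i k l = trans (⊞-assoc i k l) (trans (cong (i ⊞_) (ℤ.+-comm k l)) (sym (⊞-assoc i l k)))

    shift : ℤ → Lift
    shift k = record
      { onVᵐ = λ (v , i) → v , i ⊞ k
      ; onEᵐ = λ (e , i) → e , i ⊞ k
      ; onFᵐ = λ (f , i) → f , i ⊞ k
      ; lift = λ (x , i) → x , i ⊞ k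
      ; P-lift = λ (x , i) → cong (_ ,_) (⊞-comm i k _)
      ; E-lift = λ (x , i) → cong (_ ,_) (⊞-comm i k _)
      ; F-lift = λ _ → refl
      ; lift-S₀ = λ _ → refl
      }

    shift-inverse : ∀ k l → k ℤ.+ l ≡ 0ℤ → Inverses (shift k) (shift l)
    shift-inverse k l eq = record
      { invV = λ (v , i) → cong (v ,_) (cancel i)
      ; invE = λ (e , i) → cong (e ,_) (cancel i)
      ; invF = λ (f , i) → cong (f ,_) (cancel i)
      }
      where
      cancel : ∀ i → i ⊞ l ⊞ k ≡ i
      cancel i = trans (⊞-comm i l k) (trans (⊞-assoc i k l) (trans (cong (i ⊞_) eq) (⊞-identityʳ i)))

    module Reflection {M : Mirror S} (isMirror : IsMirror M) where
      open Mirror M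
      open IsMirror isMirror

      private
        -- Reflecting a polygon and then adding the bit `h′` of the image corner amounts to
        -- reflecting a level already raised by `h`; the height of the cell has to absorb both bits.
        ⊟-shift : ∀ g h h′ i → (g ⊟ i) ⊞ h′ ≡ (g ℤ.+ h′ ℤ.+ h) ⊟ (i ⊞ h)
        ⊟-shift g h h′ i = trans (⊟-⊞ g i h′) (sym (trans (⊟-⊞ʳ (g ℤ.+ h′ ℤ.+ h) i h)
          (cong (_⊟ i) (lemma (g ℤ.+ h′) h))))
          where
          lemma : ∀ g h → g ℤ.+ h ℤ.- h ≡ g
          lemma = solve-∀

      reflect : Flagᵐ → Flagᵐ
      reflect (x , i) = mirror x , heightF (face (proj₁ x)) ⊟ i

      reflectV : Vertexᵐ → Vertexᵐ
      reflectV (v , i) = mirrorV v , heightV v ⊟ i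

      reflectE : Edgeᵐ → Edgeᵐ
      reflectE (e , i) = mirrorE e , heightE e ⊟ i

      reflectF : Faceᵐ → Faceᵐ
      reflectF (f , i) = mirrorF f , heightF f ⊟ i

      P-reflect : ∀ X → P (reflect X) ≡ reflectV (P X)
      P-reflect (x@(c , d) , i) = cong₂ _,_ (mirror-V c d)
        (trans (⊟-shift (heightF (face c)) ⟦ isB (pt x) ⟧ ⟦ isB (pt (mirror x)) ⟧ i)
          (cong (_⊟ (i ⊞ ⟦ isB (pt x) ⟧)) (sym (height-V c d))))

      E-reflect : ∀ X → E (reflect X) ≡ reflectE (E X)
      E-reflect (x@(c , d) , i) = cong₂ _,_ (mirror-E c d)
        (trans (⊟-shift (heightF (face c)) ⟦ beyond c ⟧ ⟦ beyond (proj₁ (mirror x)) ⟧ i)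
          (cong (_⊟ (i ⊞ ⟦ beyond c ⟧)) (sym (height-E c d))))

      F-reflect : ∀ X → F (reflect X) ≡ reflectF (F X)
      F-reflect ((c , d) , i) = cong (_, heightF (face c) ⊟ i) (mirror-F c d)

      reflect-involutive : ∀ X → reflect (reflect X) ≡ X
      reflect-involutive (x@(c , d) , i) = cong₂ _,_ (mirror-involutive c d)
        (trans (cong (_⊟ (heightF (face c) ⊟ i)) (trans (cong heightF (mirror-F c d)) (height-F (face c))))
          (⊟-involutive (heightF (face c)) i))

      -- Involutivity is checked on flags only and descends to vertices because every vertex is the
      -- end point of a flag; edges and faces follow in the same way.
      reflectV-involutive : ∀ v → reflectV (reflectV v) ≡ v
      reflectV-involutive v with P-surjective v
      ... | X , refl = trans (cong reflectV (sym (P-reflect X)))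
        (trans (sym (P-reflect (reflect X))) (cong P (reflect-involutive X)))

      reflectE-involutive : ∀ e → reflectE (reflectE e) ≡ e
      reflectE-involutive e with flag-of-edge {e} (inj₁ refl)
      ... | X , refl , _ = trans (cong reflectE (sym (E-reflect X)))
        (trans (sym (E-reflect (reflect X))) (cong E (reflect-involutive X)))

      reflectF-involutive : ∀ f → reflectF (reflectF f) ≡ f
      reflectF-involutive (f , i) = trans (cong reflectF (sym (F-reflect X)))
        (trans (sym (F-reflect (reflect X))) (cong F (reflect-involutive X)))
        where
        corner₀ : Fin (size f)
        corner₀ with size f | size≥3 f
        ... | suc _ | _ = zero
        X = ((f , corner₀) , false) , i

      reflection-lift : Lift
      reflection-lift = record
        { onVᵐ = reflectV ; onEᵐ = reflectE ; onFᵐ = reflectF ; lift = reflect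
        ; P-lift = P-reflect ; E-lift = E-reflect ; F-lift = F-reflect
        ; lift-S₀ = λ ((c , d) , i) → cong (_, heightF (face c) ⊟ i) (mirror-s₀ c d)
        }

      self-inverse : Inverses reflection-lift reflection-lift
      self-inverse = record
        { invV = reflectV-involutive ; invE = reflectE-involutive ; invF = reflectF-involutive }

      reflection : Automorphism polyhedralMap
      reflection = automorphism reflection-lift reflection-lift self-inverse self-inverse

      onFlag-reflection : ∀ X → onFlag reflection X ≡ reflect X
      onFlag-reflection = onFlag-automorphism reflection-lift reflection-lift self-inverse self-inverse

  translation : ℤ → Automorphism polyhedralMap
  translation k = automorphism (shift k) (shift (ℤ.- k))
    (shift-inverse k (ℤ.- k) (ℤ.+-inverseʳ k)) (shift-inverse (ℤ.- k) k (ℤ.+-inverseˡ k))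

  onFlag-translation : ∀ k x i → onFlag (translation k) (x , i) ≡ (x , i ⊞ k)
  onFlag-translation k x i = onFlag-automorphism (shift k) (shift (ℤ.- k)) _ _ (x , i)

  module _ (2≤m : 2 ≤ m) (words : List (List Letter))
           (closed : All (λ w → run w (base , 0ℤ) ≡ (base , 0ℤ)) words) where

    any-excluded : ∀ φ → ¬ Any (Excludes (proj₁ (onFlag φ origin))) words
    any-excluded φ = go closed
      where
      go : ∀ {ws} → All (λ w → run w (base , 0ℤ) ≡ (base , 0ℤ)) ws → ¬ Any (Excludes (proj₁ (onFlag φ origin))) ws
      go {w ∷ _} (cl ∷ _)  (here ex)   = excluded 2≤m φ w cl ex refl
      go (_ ∷ cls) (there exs) = go cls exs

    cyclic : (∀ y → y ≡ base ⊎ Any (Excludes y) words) → Aut polyhedralMap ≅ ℤ/ m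
    cyclic only-base = ≅-from-section (ℤ/ m) (Aut polyhedralMap) translation
      -- The origin has level 0, so the level of its image is the required translation.
      (λ φ → + toℕ (proj₂ (onFlag φ origin)))
      (λ {k} {l} k≡l (v , i) → cong (v ,_) (⊞-cong i k l k≡l))
      (λ {k} {l} eq → ⊞-injectiveʳ (ι 0ℤ) k l (cong proj₂ (eq (vert (pt base) , ι 0ℤ))))
      (λ k l (v , i) → cong (v ,_) (trans (sym (⊞-assoc i k l)) (⊞-comm i k l)))
      (λ φ → rigid (translation _) φ (trans (onFlag-translation _ base (ι 0ℤ))
        (cong₂ _,_ (sym (at-base φ)) (trans (ι-⊞ 0ℤ (+ toℕ (proj₂ (onFlag φ origin))))
          (trans (cong ι (ℤ.+-identityˡ (+ toℕ (proj₂ (onFlag φ origin))))) (ι-toℕ _))))))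
      where
      at-base : ∀ φ → proj₁ (onFlag φ origin) ≡ base
      at-base φ with only-base (proj₁ (onFlag φ origin))
      ... | inj₁ eq = eq
      ... | inj₂ ex = ⊥-elim (any-excluded φ ex)

    module _ {M : Mirror S} (isMirror : IsMirror M) where
      open Mirror M
      open IsMirror isMirror
      open Reflection isMirror

      private
        infixl 6 _⊕_
        _⊕_ : Vertexᵐ → ℤ → Vertexᵐ
        (v , i) ⊕ k = v , i ⊞ k

        ⊕-+ : ∀ v k l → v ⊕ (k ℤ.+ l) ≡ v ⊕ l ⊕ k
        ⊕-+ (v , i) k l = cong (v ,_) (trans (sym (⊞-assoc i k l)) (⊞-comm i k l))

        -- The dihedral relation: the reflection conjugates each translation to its inverse.
        reflectV-⊕ : ∀ v k → reflectV (v ⊕ k) ≡ reflectV v ⊕ (ℤ.- k)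
        reflectV-⊕ (v , i) k = cong (mirrorV v ,_)
          (trans (⊟-⊞ʳ (heightV v) i k) (sym (⊟-⊞ (heightV v) i (ℤ.- k))))

        α : ℤ × Sign → Automorphism polyhedralMap
        α (k , Sign.+) = translation k
        α (k , Sign.-) = _∘ᴬ_ polyhedralMap (translation k) reflection

        -- The bare action of `α` on vertices. Equality in `Aut` sees nothing else, so the group
        -- laws are verified here.
        onVertex : ℤ × Sign → Vertexᵐ → Vertexᵐ
        onVertex (k , Sign.+) v = v ⊕ k
        onVertex (k , Sign.-) v = reflectV v ⊕ k

        α-onVertex : ∀ g v → Inverse.to (Automorphism.onV (α g)) v ≡ onVertex g v
        α-onVertex (_ , Sign.+) _ = refl
        α-onVertex (_ , Sign.-) _ = refl

        onVertex-∙ : ∀ g h v → onVertex (Group._∙_ (𝔻 m) g h) v ≡ onVertex g (onVertex h v)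
        onVertex-∙ (k , Sign.+) (l , Sign.+) v = ⊕-+ v k l
        onVertex-∙ (k , Sign.+) (l , Sign.-) v = ⊕-+ (reflectV v) k l
        onVertex-∙ (k , Sign.-) (l , Sign.+) v =
          trans (⊕-+ (reflectV v) k (ℤ.- l)) (cong (_⊕ k) (sym (reflectV-⊕ v l)))
        onVertex-∙ (k , Sign.-) (l , Sign.-) v = trans (⊕-+ v k (ℤ.- l)) (cong (_⊕ k)
          (trans (cong (_⊕ (ℤ.- l)) (sym (reflectV-involutive v))) (sym (reflectV-⊕ (reflectV v) l))))

        onVertex-cong : ∀ {g h} → Group._≈_ (𝔻 m) g h → ∀ v → onVertex g v ≡ onVertex h v
        onVertex-cong {k , Sign.+} {l , _} (k≡l , refl) (v , i) = cong (v ,_) (⊞-cong i k l k≡l)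
        onVertex-cong {k , Sign.-} {l , _} (k≡l , refl) (v , i) =
          cong (mirrorV v ,_) (⊞-cong (heightV v ⊟ i) k l k≡l)

        moved = proj₁ moves

        onVertex-injective : ∀ {g h} → (∀ v → onVertex g v ≡ onVertex h v) → Group._≈_ (𝔻 m) g h
        onVertex-injective {k , Sign.+} {l , Sign.+} eq =
          ⊞-injectiveʳ (ι 0ℤ) k l (cong proj₂ (eq (moved , ι 0ℤ))) , refl
        onVertex-injective {k , Sign.-} {l , Sign.-} eq =
          ⊞-injectiveʳ (heightV moved ⊟ ι 0ℤ) k l (cong proj₂ (eq (moved , ι 0ℤ))) , refl
        -- A translation fixes every vertex of K below, a reflection moves at least one.
        onVertex-injective {k , Sign.+} {l , Sign.-} eq =
          ⊥-elim (proj₂ moves (sym (cong proj₁ (eq (moved , ι 0ℤ)))))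
        onVertex-injective {k , Sign.-} {l , Sign.+} eq =
          ⊥-elim (proj₂ moves (cong proj₁ (eq (moved , ι 0ℤ))))

        onFlag-∘ : ∀ φ ψ X → onFlag (_∘ᴬ_ polyhedralMap φ ψ) X ≡ onFlag φ (onFlag ψ X)
        onFlag-∘ φ ψ X = Flagᵐ-injective
          (trans (P-onFlag φψ X) (sym (trans (P-onFlag φ (onFlag ψ X)) (cong (Inverse.to (Automorphism.onV φ)) (P-onFlag ψ X)))))
          (trans (P-S₀-onFlag φψ X) (sym (trans (P-S₀-onFlag φ (onFlag ψ X)) (cong (Inverse.to (Automorphism.onV φ)) (P-S₀-onFlag ψ X)))))
          (trans (F-onFlag φψ X) (sym (trans (F-onFlag φ (onFlag ψ X)) (cong (Inverse.to (Automorphism.onF φ)) (F-onFlag ψ X)))))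
          where φψ = _∘ᴬ_ polyhedralMap φ ψ

      dihedral : (∀ y → y ≡ base ⊎ y ≡ mirror base ⊎ Any (Excludes y) words) →
                 Aut polyhedralMap ≅ 𝔻 m
      dihedral only-two = ≅-from-section (𝔻 m) (Aut polyhedralMap) α (λ φ → proj₁ (find φ))
        (λ {g} {h} g≈h v → trans (α-onVertex g v) (trans (onVertex-cong {g} {h} g≈h v) (sym (α-onVertex h v))))
        (λ {g} {h} eq → onVertex-injective {g} {h} (λ v → trans (sym (α-onVertex g v)) (trans (eq v) (α-onVertex h v))))
        (λ g h v → trans (α-onVertex (Group._∙_ (𝔻 m) g h) v) (trans (onVertex-∙ g h v)
          (sym (trans (α-onVertex g (Inverse.to (Automorphism.onV (α h)) v)) (cong (onVertex g) (α-onVertex h v))))))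
        (λ φ → rigid (α (proj₁ (find φ))) φ (proj₂ (find φ)))
        where
        -- The image of the origin lies over `base` or over `mirror base`; a translation, preceded
        -- by the reflection in the second case, reaches the right level.
        find : ∀ φ → ∃[ g ] onFlag (α g) origin ≡ onFlag φ origin
        find φ with only-two (proj₁ (onFlag φ origin))
        ... | inj₁ p = (+ toℕ (proj₂ (onFlag φ origin)) ℤ.- + toℕ (ι 0ℤ) , Sign.+) ,
          trans (onFlag-translation _ base (ι 0ℤ))
            (cong₂ _,_ (sym p) (⊞-transitive (ι 0ℤ) (proj₂ (onFlag φ origin))))
        ... | inj₂ (inj₁ p) = (+ toℕ (proj₂ (onFlag φ origin)) ℤ.- + toℕ i , Sign.-) ,
          trans (onFlag-∘ (translation _) reflection origin)
            (trans (cong (onFlag (translation _)) (onFlag-reflection origin))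
              (trans (onFlag-translation _ (mirror base) i)
                (cong₂ _,_ (sym p) (⊞-transitive i (proj₂ (onFlag φ origin))))))
          where i = heightF (face (proj₁ base)) ⊟ ι 0ℤ
        ... | inj₂ (inj₂ ex) = ⊥-elim (any-excluded φ ex)

-- The identification of the copies of the cut map

module _ (K : PolyhedralMap) (C : Cycle K) (S : Sides K C) where
  open PolyhedralMap K
  open Cycle C
  open Sides S

  -- A view of `cut`, which keeps the case distinctions of its definition out of later goals.
  data Cut (f : Face) (v : Vertex) : CutVertex K C → Set where
    off-C : (o : ¬ OnV v) → Cut f v (interior v o)
    onA : ∀ j → vtx j ≡ v → side j f ≡ sideA → Cut f v (pᴬ j)
    onB : ∀ j → vtx j ≡ v → side j f ≡ sideB → Cut f v (qᴮ j)

  cut-view : ∀ f v → Cut f v (cut K C S f v)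
  cut-view f v with Fin.any? (λ j → vtx j ≟ⱽ v)
  ... | no o = off-C o
  ... | yes (j , p) with side j f in eq
  ...   | sideA = onA j p eq
  ...   | sideB = onB j p eq

bit-injective : ∀ x y → bit x ≡ bit y → x ≡ y
bit-injective false false _ = refl
bit-injective true  true  _ = refl

module Covering {degrees : List ℕ} {S : Scheme degrees} (ok : IsValid S)
                (m : ℕ) .{{_ : NonZero m}} where

  open Scheme S
  open IsValid ok
  open Residue m using (_⊞_; ⊞-identityʳ; next≡⊞1)
  module K = Cover ok 1
  module L = Cover ok m
  open Polyhedral ok 1 using (level-induction) renaming (polyhedralMap to Kmap)
  open Polyhedral ok m using () renaming (polyhedralMap to Lmap)
  open PolyhedralMap Kmap using (Joins; _∈ᴱ_; _∈ᶠ_; _⊂ᶠ_)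

  trivial : (i j : Fin 1) → i ≡ j
  trivial zero zero = refl

  at₀ : Flag → K.Flagᵐ
  at₀ x = x , zero

  C : Cycle Kmap
  C = record
    { len = len ; len≥3 = len≥3
    ; vtx = λ j → K.P (at₀ (cycle j))
    ; vtx-injective = λ {i} {j} eq → cycle-injective i j
        (K.vert⇒label {pt (cycle i)} {pt (cycle j)} (,-injectiveˡ eq))
    ; edge = λ j → K.E (at₀ (cycle j))
    ; joins = λ j → subst (Joins (K.E (at₀ (cycle j))) (K.P (at₀ (cycle j))))
        (cong₂ _,_ (K.label⇒vert {pt (s₀ (cycle j))} {pt (cycle (next j))} (cycle-joins j)) (trivial _ _))
        (K.E-joins (at₀ (cycle j)))
    }

  open Cycle C using (vtx; OnV; OnE; joins) renaming (edge to cycleEdge)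

  Crossed : Corner → Set
  Crossed c = beyond c ≢ beyond (opp c)

  crossed-opp : ∀ {c} → Crossed c → Crossed (opp c)
  crossed-opp {c} ne eq = ne (sym (trans eq (cong beyond (K.opp-opp c))))

  OnE⇒ : ∀ X → OnE (K.E X) → Crossed (proj₁ (proj₁ X))
  OnE⇒ ((c , b) , i) (j , eq) with K.same-edge (proj₁ (cycle j)) c (,-injectiveˡ eq)
  ... | inj₁ p = subst Crossed (sym p) (cycle-crosses j)
  ... | inj₂ p = subst Crossed (sym p) (crossed-opp {proj₁ (cycle j)} (cycle-crosses j))

  OnE⇐ : ∀ X → Crossed (proj₁ (proj₁ X)) → OnE (K.E X)
  OnE⇐ ((c , b) , i) ne with cycle-complete c
  ... | inj₁ eq = ⊥-elim (ne eq)
  ... | inj₂ (j , eq) = j , cong₂ _,_ eq (trivial _ _)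

  toSide : Bool → Side Kmap C
  toSide false = sideA
  toSide true  = sideB

  toSide-injective : ∀ x y → toSide x ≡ toSide y → x ≡ y
  toSide-injective false false _ = refl
  toSide-injective true  true  _ = refl

  side : Fin len → K.Faceᵐ → Side Kmap C
  side j (f , _) with Fin.any? (λ s → vert (f , s) Fin.≟ vert (pt (cycle j)))
  ... | yes (s , _) = toSide (isB (f , s))
  -- An arbitrary value: `side` carries meaning only for polygons containing the vertex.
  ... | no  _       = sideA

  side-at : ∀ j f s i → vert (f , s) ≡ vert (pt (cycle j)) → side j (f , i) ≡ toSide (isB (f , s))
  side-at j f s i eq with Fin.any? (λ s → vert (f , s) Fin.≟ vert (pt (cycle j)))
  ... | yes (t , eq′) = cong (toSide ∘ isB) (K.vert-injective {f , t} {f , s} refl (trans eq′ (sym eq)))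
  ... | no  none      = ⊥-elim (none (s , eq))

  side-flag : ∀ j X → K.P X ≡ vtx j → side j (K.F X) ≡ toSide (isB (pt (proj₁ X)))
  side-flag j (((f , s) , false) , i) eq = side-at j f s i (,-injectiveˡ eq)
  side-flag j (((f , s) , true)  , i) eq = side-at j f (next s) i (,-injectiveˡ eq)

  isB-s₂ : ∀ x → bit (isB (pt x)) ℕ.+ bit (beyond (opp (proj₁ x)))
               ≡ bit (isB (pt (s₂ x))) ℕ.+ bit (beyond (proj₁ x))
  isB-s₂ (c , b) = s₂-level c b

  -- In `s₂-level`, equal bits at the two corners cancel and leave equal values of `beyond`; the
  -- converse below cancels in the other order.
  crossed⇒sides : ∀ x → Crossed (proj₁ x) → isB (pt x) ≢ isB (pt (s₂ x))
  crossed⇒sides x ne eq = ne (sym (bit-injective _ _ (ℕ.+-cancelˡ-≡ (bit (isB (pt x))) _ _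
    (trans (isB-s₂ x) (cong (λ h → bit h ℕ.+ bit (beyond (proj₁ x))) (sym eq))))))

  sides⇒crossed : ∀ x → isB (pt x) ≢ isB (pt (s₂ x)) → Crossed (proj₁ x)
  sides⇒crossed x ne eq = ne (bit-injective _ _ (ℕ.+-cancelʳ-≡ (bit (beyond (opp (proj₁ x)))) _ _
    (trans (isB-s₂ x) (cong (λ d → bit (isB (pt (s₂ x))) ℕ.+ bit d) eq))))

  coherent-s₂ : ∀ x → isB (pt x) ≡ isB (pt (s₀ x)) → isB (pt (s₂ x)) ≡ isB (pt (s₀ (s₂ x)))
  coherent-s₂ x@(c , _) eq = trans
    (bit-injective _ _ (ℕ.+-cancelʳ-≡ (bit (beyond c)) _ _
      (trans (sym (isB-s₂ x)) (trans (cong (λ h → bit h ℕ.+ bit (beyond (opp c))) eq) (isB-s₂ (s₀ x))))))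
    (cong (isB ∘ pt) (K.s₂-s₀ x))

  ends-of : ∀ {v e} → v ∈ᴱ e → ∃[ w ] Joins e v w
  ends-of (inj₁ refl) = _ , inj₁ refl
  ends-of (inj₂ refl) = _ , inj₂ refl

  divide : ∀ j {e f g} → vtx j ∈ᴱ e → f ≢ g → e ⊂ᶠ f → e ⊂ᶠ g → OnE e ⇔ (side j f ≢ side j g)
  divide j v∈e f≢g e⊂f e⊂g with K.flag-of (proj₂ (ends-of v∈e)) e⊂f
  ... | X , refl , PX , _ , refl with K.faces-of-edge X _ e⊂g
  ...   | inj₁ g≡f  = ⊥-elim (f≢g (sym g≡f))
  ...   | inj₂ refl = mk⇔
    (λ on eq → crossed⇒sides (proj₁ X) (OnE⇒ X on) (toSide-injective _ _
      (trans (sym (side-flag j X PX)) (trans eq (side-flag j (K.S₂ X) (trans (K.P-S₂ X) PX))))))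
    (λ ne → OnE⇐ X (sides⇒crossed (proj₁ X) (λ eq → ne (trans (side-flag j X PX)
      (trans (cong toSide eq) (sym (side-flag j (K.S₂ X) (trans (K.P-S₂ X) PX))))))))

  coherent : ∀ j {f} → cycleEdge j ⊂ᶠ f → side j f ≡ side (next j) f
  coherent j e⊂f with K.flag-of (joins j) e⊂f
  ... | X , EX , PX , P₀X , refl = trans (side-flag j X PX)
    (trans (cong toSide (same (K.at-edge (at₀ (cycle j)) X (sym EX) (sym PX))))
      (sym (side-flag (next j) (K.S₀ X) P₀X)))
    where
    same : X ≡ at₀ (cycle j) ⊎ X ≡ K.S₂ (at₀ (cycle j)) → isB (pt (proj₁ X)) ≡ isB (pt (s₀ (proj₁ X)))
    same (inj₁ refl) = cycle-coherent j
    same (inj₂ refl) = coherent-s₂ (cycle j) (cycle-coherent j)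

  sides : Sides Kmap C
  sides = record { side = side ; divide = divide ; coherent = coherent }

  OffCycle : K.Faceᵐ → K.Faceᵐ → Set
  OffCycle h k = ∃[ e ] (¬ OnE e × e ⊂ᶠ h × e ⊂ᶠ k)

  off-cycle-connected : ∀ f g → Star OffCycle f g
  off-cycle-connected (f , i) (g , j) = subst (λ j → Star OffCycle (f , i) (g , j)) (trivial i j)
    (level-induction (Star OffCycle (f , i))
      (λ X eq f→X → f→X ◅◅ ((K.E X , (λ on → OnE⇒ X on eq) , K.E⊂ᶠF X , K.E⊂ᶠF-S₂ X) ◅ ε))
      f i ε g)

  first : Fin len
  first with len | len≥3
  ... | suc _ | _ = zero

  _≟ᶠ_ : (f g : K.Faceᵐ) → Dec (f ≡ g)
  _≟ᶠ_ = ≡-dec Fin._≟_ Fin._≟_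

  open DecMembership _≟ᶠ_ using (_∈?_)

  -- If C bounded the union of `fs`, an edge of C would have one polygon inside and one outside. Yet
  -- these two are joined by a chain crossing no edge of C, and such a chain cannot leave the union.
  not-contractible : ¬ Contractible Kmap C
  not-contractible D = [ (λ (f∈ , g∉) → g∉ (spread (off-cycle-connected _ _) f∈))
                       , (λ (f∉ , g∈) → f∉ (spread (off-cycle-connected _ _) g∈)) ]′
    (Equivalence.to (boundary (K.F-S₂≢ X ∘ sym) (K.E⊂ᶠF X) (K.E⊂ᶠF-S₂ X)) (first , refl))
    where
    open Contractible D
    X = at₀ (cycle first)
    step : ∀ {h k} → OffCycle h k → h ∈ fs → k ∈ fs
    step {h} {k} (e , off , e⊂h , e⊂k) h∈ with k ∈? fs | h ≟ᶠ k
    ... | yes k∈ | _        = k∈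
    ... | no  _  | yes refl = h∈
    ... | no  k∉ | no  h≢k  = ⊥-elim (off (Equivalence.from (boundary h≢k e⊂h e⊂k) (inj₁ (h∈ , k∉))))
    spread : ∀ {f g} → Star OffCycle f g → f ∈ fs → g ∈ fs
    spread ε        = id
    spread (s ◅ ss) = spread ss ∘ step s

  nontrivial : NonTrivial Kmap C
  nontrivial = not-contractible , λ (_ , f , g , ¬f→g) → ¬f→g (off-cycle-connected f g)

  Cutᵐ : Set
  Cutᵐ = CutVertex Kmap C × Fin m

  -- The vertex on A in copy `i` keeps level `i`, its twin on B moves to the level of the copy it is
  -- glued to.
  glueᵐ : Cutᵐ → L.Vertexᵐ
  glueᵐ (interior (v , _) _ , i) = v , i
  glueᵐ (pᴬ j , i) = vert (pt (cycle j)) , i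
  glueᵐ (qᴮ j , i) = vert (pt (cycle j)) , next i

  surjective : ∀ w → ∃[ x ] glueᵐ x ≡ w
  surjective (v , i) with Fin.any? (λ j → vert (pt (cycle j)) Fin.≟ v)
  ... | yes (j , refl) = (pᴬ j , i) , refl
  ... | no  none       = (interior (v , zero) (λ (j , eq) → none (j , ,-injectiveˡ eq)) , i) , refl

  _~_ : Cutᵐ → Cutᵐ → Set
  _~_ = EqClosure (Seam Kmap C)

  -- A normal form for the seam relation: points on B are rewritten to points on A of the next copy.
  -- `glueᵐ` is injective on normal forms, which yields `identify`.
  unglued : ∀ x → ∃[ y ] (x ~ y × glueᵐ y ≡ glueᵐ x × (∀ j i → y ≢ (qᴮ j , i)))
  unglued x@(interior _ _ , _) = x , EqClosure.reflexive _ , refl , λ _ _ ()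
  unglued x@(pᴬ _ , _)         = x , EqClosure.reflexive _ , refl , λ _ _ ()
  unglued (qᴮ j , i)           = (pᴬ j , next i) , EqClosure.return (seam j i) , refl , λ _ _ ()

  unglued-unique : ∀ x y → (∀ j i → x ≢ (qᴮ j , i)) → (∀ j i → y ≢ (qᴮ j , i)) → glueᵐ x ≡ glueᵐ y → x ≡ y
  unglued-unique (qᴮ j , i) _ nx _ _ = ⊥-elim (nx j i refl)
  unglued-unique _ (qᴮ j , i) _ ny _ = ⊥-elim (ny j i refl)
  unglued-unique (interior (v , zero) _ , i) (interior (.v , zero) _ , .i) _ _ refl = refl
  unglued-unique (interior (v , k) off , i) (pᴬ j , i′) _ _ eq =
    -- The proof that an interior vertex is off C is irrelevant data, so the contradiction must be
    -- an irrelevant one.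
    ⊥-elim-irr (off (j , cong₂ _,_ (sym (,-injectiveˡ eq)) (trivial _ _)))
  unglued-unique (pᴬ j , i′) (interior (v , k) off , i) _ _ eq =
    ⊥-elim-irr (off (j , cong₂ _,_ (,-injectiveˡ eq) (trivial _ _)))
  unglued-unique (pᴬ j , i) (pᴬ k , i′) _ _ eq = cong₂ (λ j i → pᴬ j , i)
    (cycle-injective j k (K.vert⇒label {pt (cycle j)} {pt (cycle k)} (,-injectiveˡ eq))) (,-injectiveʳ eq)

  identify : ∀ x y → glueᵐ x ≡ glueᵐ y ⇔ x ~ y
  identify x y = mk⇔ to (EqClosure.gfold isEquivalence glueᵐ (λ { (seam _ _) → refl }))
    where
    to : glueᵐ x ≡ glueᵐ y → x ~ y
    to eq with unglued x | unglued y
    ... | x′ , x~x′ , ex , nx | y′ , y~y′ , ey , ny = EqClosure.transitive _ x~x′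
      (subst (_~ y) (sym (unglued-unique x′ y′ nx ny (trans ex (trans eq (sym ey)))))
        (EqClosure.symmetric _ y~y′))

  private
    ⊞-bit : ∀ i b → toSide b ≡ sideA → i ⊞ ⟦ b ⟧ ≡ i
    ⊞-bit i false _ = ⊞-identityʳ i

    ⊞-bit′ : ∀ i b → toSide b ≡ sideB → i ⊞ ⟦ b ⟧ ≡ next i
    ⊞-bit′ i true _ = sym (next≡⊞1 i)

  -- Off C the bit is false by `isB-cycle`; on C it records whether `cut` chose A or B.
  corner-glue : ∀ f k i s → L.P (((f , s) , false) , i) ≡
                glueᵐ (cut Kmap C sides (f , k) (K.P (((f , s) , false) , k)) , i)
  corner-glue f k i s = from-view (cut-view Kmap C sides (f , k) (K.P (((f , s) , false) , k)))
    where
    from-view : ∀ {x} → Cut Kmap C sides (f , k) (K.P (((f , s) , false) , k)) x →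
           L.P (((f , s) , false) , i) ≡ glueᵐ (x , i)
    from-view (off-C o) = cong (vert (f , s) ,_) (⊞-bit i (isB (f , s)) (cong toSide notB))
      where
      notB : isB (f , s) ≡ false
      notB with isB-cycle (f , s)
      ... | inj₁ eq       = eq
      ... | inj₂ (j , eq) = ⊥-elim (o (j , cong₂ _,_ (K.label⇒vert {pt (cycle j)} {f , s} eq) (trivial _ _)))
    from-view (onA j p e) = cong₂ _,_ (sym (,-injectiveˡ p))
      (⊞-bit i (isB (f , s)) (trans (sym (side-at j f s k (sym (,-injectiveˡ p)))) e))
    from-view (onB j p e) = cong₂ _,_ (sym (,-injectiveˡ p))
      (⊞-bit′ i (isB (f , s)) (trans (sym (side-at j f s k (sym (,-injectiveˡ p)))) e))

  isCovering : IsCovering m Kmap Lmap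
  isCovering = record
    { C = C ; nontrivial = nontrivial ; sides = sides
    ; glue = glueᵐ ; surjective = surjective ; identify = identify
    ; onF = mk↔ₛ′ (λ ((f , _) , i) → f , i) (λ (f , i) → (f , zero) , i)
        (λ _ → refl) (λ ((f , k) , i) → cong (λ k → (f , k) , i) (trivial zero k))
    ; deg-onF = λ _ _ → refl
    ; corner-onF = λ (f , k) i s → trans (cong (λ s → L.P (((f , s) , false) , i)) (Fin.cast-is-id refl s))
        (corner-glue f k i s)
    }

-- Evaluation

-- A function on Fin n given by the tuple of its values, so that each value
-- is computed at most once.
Tuple : ∀ {n} → (Fin n → Set) → Set
Tuple {zero}  B = ⊤
Tuple {suc n} B = B zero × Tuple (B ∘ suc)

tabulate : ∀ {n} {B : Fin n → Set} → (∀ i → B i) → Tuple B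
tabulate {zero}  f = tt
tabulate {suc n} f = f zero , tabulate (f ∘ suc)

component : ∀ {n} {B : Fin n → Set} → Tuple B → ∀ i → B i
component (x , _)  zero    = x
component (_ , xs) (suc i) = component xs i

Array : ℕ → Set → Set
Array n B = Tuple {n} (λ _ → B)

infixl 9 _!_
_!_ : ∀ {n B} → Array n B → Fin n → B
_!_ {B = B} = component {B = λ _ → B}

findᵇ : {A : Set} → (A → Bool) → A → List A → A
findᵇ p d []       = d
findᵇ p d (x ∷ xs) = if p x then x else findᵇ p d xs

mem : ℕ → ℕ → List (ℕ × ℕ) → Bool
mem k l []             = false
mem k l ((i , j) ∷ xs) = if (k ≡ᵇ i) ∧ (l ≡ᵇ j) then true else mem k l xs

nth : List ℕ → ℕ → ℕ
nth []       _       = 0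
nth (x ∷ xs) zero    = x
nth (x ∷ xs) (suc n) = nth xs n

-- Vertices and polygons are numbered; a corner (f , s) of C on side B is listed
-- in atB, and path runs through the flags (f , s , b) along C.
record Plan : Set where
  constructor plan
  field
    #v-1     : ℕ
    corner₀  : ℕ
    corners₀ : List ℕ
    polygons : List (List ℕ)
    atB      : List (ℕ × ℕ)
    path     : List (ℕ × ℕ × Bool)

-- Each stage takes the tables of the previous ones as arguments, so that
-- evaluation shares them.
module Build (degrees : List ℕ) (n : ℕ) where

  #v : ℕ
  #v = suc n

  module Polygons {#f-1 #s-1 : ℕ} (size′ : Fin #f-1 → ℕ)  where

    #f : ℕ
    #f = suc #f-1

    -- The first polygon is split off with a corner of its own, so that the flag `base` exists
    -- before any check.
    size : Fin #f → ℕ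
    size zero    = suc #s-1
    size (suc f) = size′ f

    Corner Flag : Set
    Corner = Σ (Fin #f) (Fin ∘ size)
    Flag = Corner × Bool

    Table : Set → Set
    Table B = Tuple {#f} (λ f → Array (size f) B)

    table : {B : Set} → (Corner → B) → Table B
    table {B} g = tabulate (λ f → tabulate {B = λ _ → B} (λ s → g (f , s)))

    row : {B : Set} → Table B → ∀ f → Fin (size f) → B
    row {B} t f = component {B = λ _ → B} (component {B = λ f → Array (size f) B} t f)

    _at_ : {B : Set} → Table B → Corner → B
    t at (f , s) = row t f s

    base : Flag
    base = (zero , zero) , false

    corners : List Corner
    corners = List.concatMap (λ f → List.map (f ,_) (List.allFin (size f))) (List.allFin #f)

    _is_ : Corner → ℕ × ℕ → Bool
    (f , s) is (k , l) = (toℕ f ≡ᵇ k) ∧ (toℕ s ≡ᵇ l)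

    _==_ : Corner → Corner → Bool
    c == (f , s) = c is (toℕ f , toℕ s)

    succ pred : Corner → Corner
    succ (f , s) = f , next s
    pred (f , s) = f , prev s

    pt : Flag → Corner
    pt (c , false) = c
    pt (c , true)  = succ c

    s₁ : Flag → Flag
    s₁ (c , false) = pred c , true
    s₁ (c , true)  = succ c , false

    corner-at : ℕ × ℕ → Corner
    corner-at p = findᵇ (_is p) (zero , zero) corners

    module Glue (labelT : Table ℕ) (vertT : Table (Fin #v)) (stars : Array #v (List Corner)) where

      search : Corner → ℕ → List Corner → Corner × Bool
      -- Fallback for a side without partner; `s₂-face` rejects it.
      search c w []       = c , false
      search c w (d ∷ ds) =
        -- The candidate corners lie at the first end point of the side `c`: a partner starting
        -- there runs in the same direction, one ending there is reversed.
        if (labelT at succ d ≡ᵇ w) ∧ not (d == c) then (d , false) else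
        if (labelT at pred d ≡ᵇ w) ∧ not (pred d == c) then (pred d , true) else
        search c w ds

      glue : Corner → Corner × Bool
      glue c = search c (labelT at succ c) (stars ! (vertT at c))

    module Walk (stars : Array #v (List Corner)) (glueT : Table (Corner × Bool)) (isBT : Table Bool) where

      opp : Corner → Corner
      opp c = proj₁ (glueT at c)

      s₂ : Flag → Flag
      s₂ (c , b) = opp c , proj₂ (glueT at c) xor b

      -- Only an edge of C has its two polygons on different sides of C at an end point.
      beyond : Corner → Bool
      beyond c = (isBT at c) ∧ not (isBT at (pt (s₂ (c , false))))

      -- Tests whether the polygons met by turning round the vertex from `x` have the prescribed
      -- sizes; `start` tries both directions at every corner, as a type is only given up to
      -- rotation and reversal.
      fits : Flag → List ℕ → Bool
      fits x []       = true
      fits x (d ∷ ds) = (size (proj₁ (proj₁ x)) ≡ᵇ d) ∧ fits (s₁ (s₂ x)) ds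

      start : List Corner → Flag
      start []       = base
      start (c ∷ cs) = if fits (c , false) degrees then (c , false) else
        if fits (s₁ (c , false)) degrees then s₁ (c , false) else start cs

      go : ∀ k → Flag → Array k Corner
      go zero    x = tt
      go (suc k) x = pt x , go k (s₁ (s₂ x))

      walk : Fin #v → Array (length degrees) Corner
      walk v = go (length degrees) (start (stars ! v))

      -- On C the side not beyond it is chosen, as `rep-near` demands; elsewhere the polygon with
      -- the smaller number decides.
      isRep : Table Bool → Corner → Bool
      isRep beyondT c = not (beyondT at c) ∧ ((beyondT at opp c) ∨ (toℕ (proj₁ c) <ᵇ toℕ (proj₁ (opp c))))

      position : ℕ → List ℕ → ℕ → ℕ
      position c []       k = k
      position c (d ∷ ds) k = if c ≡ᵇ d then k else position c ds (suc k)

    module _ (labelT : Table ℕ) (vertT : Table (Fin #v)) (stars : Array #v (List Corner))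
             (glueT : Table (Corner × Bool)) (isBT : Table Bool) (path : List Flag) where

      open Walk stars glueT isBT

      assemble : (beyondT : Table Bool) (r : Corner) (rs : List Corner)
                 (repT : Array (suc (length rs)) Corner) (edgeT : Table (Fin (suc (length rs))))
                 (aroundT : Array #v (Array (length degrees) Corner)) → Scheme degrees
      assemble beyondT r rs repT edgeT aroundT = record
        { #v = #v ; #e = suc (length rs) ; #f = #f ; size = size
        ; vert = vertT at_ ; labels = row labelT ; glue = glueT at_ ; isB = isBT at_ ; beyond = beyondT at_
        ; edge = edgeT at_ ; rep = repT !_ ; around = λ v → aroundT ! v !_
        ; base = base ; len = length path ; cycle = lookup path }

      edges : Table Bool → List Corner → Scheme degrees
      edges beyondT []       = edges beyondT ((zero , zero) ∷ [])
      edges beyondT (r ∷ rs) = assemble beyondT r rs (tabulate (lookup (r ∷ rs)))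
        (edgeTable (code r) (List.map code rs))
        (tabulate walk)
        where
        -- Injective for polygons with at most 32 sides.
        code : Corner → ℕ
        code (f , s) = toℕ f ℕ.* 32 ℕ.+ toℕ s
        edgeTable : ℕ → List ℕ → Table (Fin (suc (length rs)))
        edgeTable k ks = table λ c →
          position (code (if isRep beyondT c then c else opp c)) (k ∷ ks) 0 ℕ.mod suc (length rs)

      fromBeyond : Table Bool → Scheme degrees
      fromBeyond beyondT = edges beyondT (List.filterᵇ (isRep beyondT) corners)

      fromTables : Scheme degrees
      fromTables = fromBeyond (table beyond)

    fromStars : Table ℕ → Table (Fin #v) → List (ℕ × ℕ) → List (ℕ × ℕ × Bool) → Array #v (List Corner) → Scheme degrees
    fromStars labelT vertT atB path stars = fromTables labelT vertT stars
      (table (Glue.glue labelT vertT stars)) (table (λ (f , s) → mem (toℕ f) (toℕ s) atB))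
      (List.map (λ (f , s , b) → corner-at (f , s) , b) path)

    fromLabels : List (ℕ × ℕ) → List (ℕ × ℕ × Bool) → Table ℕ → Scheme degrees
    -- Reduction modulo `#v` turns labels into vertices; `label-vert` later confirms that it changed
    -- none of them.
    fromLabels atB path labelT = fromStars labelT (table (λ c → (labelT at c) ℕ.mod #v)) atB path
      (stars (List.map (λ c → c , labelT at c) corners))
      where
      star : ℕ → List (Corner × ℕ) → List Corner
      star v []             = []
      star v ((c , u) ∷ cs) = if u ≡ᵇ v then c ∷ star v cs else star v cs
      stars : List (Corner × ℕ) → Array #v (List Corner)
      stars darts = tabulate (λ v → star (toℕ v) darts)

scheme : ∀ degrees → Plan → Scheme degrees
scheme degrees p = fromSizes (tabulate (λ f → length (lookup polygons f)))
  where
  open Plan p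
  fromSizes : Array (length polygons) ℕ → Scheme degrees
  fromSizes sizes = B.fromLabels atB path
    (B.table (λ (f , s) → nth (lookup ((corner₀ ∷ corners₀) ∷ polygons) f) (toℕ s)))
    where module B = Build.Polygons degrees #v-1 {length polygons} {length corners₀} (sizes !_)

-- Decision procedures for the finite conditions.

module Check {degrees : List ℕ} (S : Scheme degrees) where
  open Scheme S

  all? : ∀ {n} {P : Fin n → Set} → (∀ i → Dec (P i)) → Dec (∀ i → P i)
  all? {zero}  P? = yes λ ()
  all? {suc n} P? = map′ (λ { (p , q) zero → p ; (p , q) (suc i) → q i }) (λ h → h zero , h ∘ suc)
    (P? zero ×-dec all? (P? ∘ suc))

  -- Comparison passes through ℕ, where it is built in.
  _≟_ : ∀ {n} → DecidableEquality (Fin n)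
  i ≟ j = map′ Fin.toℕ-injective (cong toℕ) (toℕ i ℕ.≟ toℕ j)

  _≟ᶜ_ : DecidableEquality Corner
  (f , s) ≟ᶜ (g , t) = map′ to from (toℕ f ℕ.≟ toℕ g ×-dec toℕ s ℕ.≟ toℕ t)
    where
    to : toℕ f ≡ toℕ g × toℕ s ≡ toℕ t → (f , s) ≡ (g , t)
    to (p , q) with refl ← Fin.toℕ-injective p = cong (f ,_) (Fin.toℕ-injective q)
    from : (f , s) ≡ (g , t) → toℕ f ≡ toℕ g × toℕ s ≡ toℕ t
    from refl = refl , refl

  _≟ᶠ_ : DecidableEquality Flag
  (c , b) ≟ᶠ (d , b′) = map′ (λ { (refl , refl) → refl }) (λ { refl → refl , refl }) (b Bool.≟ b′ ×-dec c ≟ᶜ d)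

  ∀ᶜ? : ∀ {P : Corner → Set} → (∀ c → Dec (P c)) → Dec (∀ c → P c)
  ∀ᶜ? P? = map′ (λ h (f , s) → h f s) (λ h f s → h (f , s)) (all? (λ f → all? (λ s → P? (f , s))))

  ∀ᵇ? : ∀ {P : Bool → Set} → (∀ b → Dec (P b)) → Dec (∀ b → P b)
  ∀ᵇ? P? = map′ (λ { (p , q) false → p ; (p , q) true → q }) (λ h → h false , h true) (P? false ×-dec P? true)

  -- `inner` receives `r s` as an argument so that it is shared by all `t`, and `P?` is consulted
  -- only where the labels agree.
  common? : ∀ {m n} (r : Fin m → ℕ) (r′ : Fin n → ℕ) {P : ℕ → Set} → (∀ l → Dec (P l)) →
            Dec (∀ s t → r s ≡ r′ t → P (r s))
  common? {n = n} r r′ {P} P? = all? λ s → inner (r s)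
    where
    inner : ∀ l → Dec (∀ t → l ≡ r′ t → P l)
    inner l = all? λ t → (l ℕ.≟ r′ t) →-dec P? l

  onlyCommon? : ∀ q q′ → Dec (OnlyCommon q q′)
  onlyCommon? q q′ = common? (labels (face q)) (labels (face q′)) (ℕ._≟ label q)

  commonEdge? : ∀ x q′ → Dec (CommonEdge x q′)
  commonEdge? x@(c , _) q′ = (face (opp c) ≟ face q′) ×-dec
    common? (labels (face c)) (labels (face q′)) (λ l → (l ℕ.≟ label (pt x)) ⊎-dec (l ℕ.≟ label (pt (s₀ x))))

  injective? : ∀ {n} (r : Fin n → ℕ) → Dec (∀ s t → r s ≡ r t → s ≡ t)
  injective? r = all? λ s → inner s (r s)
    where
    inner : ∀ s l → Dec (∀ t → l ≡ r t → s ≡ t)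
    inner s l = all? λ t → (l ℕ.≟ r t) →-dec (s ≟ t)

  meets? : ∀ q q′ → Dec (face q′ ≡ face q ⊎ CommonEdge (q , false) q′ ⊎ CommonEdge (pred q , true) q′
                         ⊎ OnlyCommon q q′)
  meets? q q′ = (face q′ ≟ face q) ⊎-dec commonEdge? (q , false) q′ ⊎-dec commonEdge? (pred q , true) q′
    ⊎-dec onlyCommon? q q′

  valid? : Dec (IsValid S)
  valid? = map′
    (λ (a₁ , a₂ , a₃ , a₄ , a₅ , a₆ , a₇ , a₈ , a₉ , b₁ , b₂ , b₃ , b₄ , b₅ , b₆ , b₇ , b₈ , b₉
        , d₁ , d₂ , d₃ , d₄ , d₅ , d₆ , d₇ , d₈ , d₉) → record
      { degrees≥3 = a₁ ; size≥3 = a₂ ; label-vert = a₃ ; label-injective = a₄ ; s₂-involutive = a₅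
      ; s₂-face = a₆ ; s₂-label = a₇ ; s₂-level = a₈ ; edge-opp = a₉ ; edge-rep = b₁ ; rep-edge = b₂
      ; rep-near = b₃ ; around-vert = b₄ ; around-size = b₅ ; around-inj = b₆ ; around-surj = b₇
      ; around-step = b₈ ; meets = b₉ ; descend = d₁ ; euler = d₂ ; len≥3 = d₃ ; cycle-joins = d₄
      ; cycle-injective = d₅ ; cycle-crosses = d₆ ; cycle-coherent = d₇ ; cycle-complete = d₈
      ; isB-cycle = d₉ })
    (λ ok → let open IsValid ok in
      degrees≥3 , size≥3 , label-vert , label-injective , s₂-involutive , s₂-face , s₂-label , s₂-level ,
      edge-opp , edge-rep , rep-edge , rep-near , around-vert , around-size , around-inj , around-surj ,
      around-step , meets , descend , euler , len≥3 , cycle-joins , cycle-injective , cycle-crosses ,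
      cycle-coherent , cycle-complete , isB-cycle)
    ( (3 ℕ.≤? length degrees)
    ×-dec (all? λ f → 3 ℕ.≤? size f)
    ×-dec (∀ᶜ? λ c → label c ℕ.≟ toℕ (vert c))
    ×-dec (all? λ f → injective? (labels f))
    ×-dec (∀ᶜ? λ c → ∀ᵇ? λ b → s₂ (s₂ (c , b)) ≟ᶠ (c , b))
    ×-dec (∀ᶜ? λ c → ¬? (face (opp c) ≟ face c))
    ×-dec (∀ᶜ? λ c → ∀ᵇ? λ b → label (pt (s₂ (c , b))) ℕ.≟ label (pt (c , b)))
    ×-dec (∀ᶜ? λ c → ∀ᵇ? λ b → (bit (isB (pt (c , b))) ℕ.+ bit (beyond (opp c)))
                            ℕ.≟ (bit (isB (pt (s₂ (c , b)))) ℕ.+ bit (beyond c)))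
    ×-dec (∀ᶜ? λ c → edge (opp c) ≟ edge c)
    ×-dec (all? λ e → edge (rep e) ≟ e)
    ×-dec (∀ᶜ? λ c → (rep (edge c) ≟ᶜ c) ⊎-dec (rep (edge c) ≟ᶜ opp c))
    ×-dec (all? λ e → beyond (rep e) Bool.≟ false)
    ×-dec (all? λ v → all? λ i → vert (around v i) ≟ v)
    ×-dec (all? λ v → all? λ i → size (face (around v i)) ℕ.≟ lookup degrees i)
    ×-dec (all? λ v → all? λ i → all? λ j → (around v i ≟ᶜ around v j) →-dec (i ≟ j))
    ×-dec (∀ᶜ? λ c → Fin.any? λ i → around (vert c) i ≟ᶜ c)
    ×-dec (all? λ v → all? λ i → (around v (next i) ≟ᶜ pt (s₂ (around v i , false)))
                            ⊎-dec (around v (next i) ≟ᶜ pt (s₂ (pred (around v i) , true))))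
    ×-dec (∀ᶜ? λ q → all? λ i → meets? q (around (vert q) i))
    ×-dec (all? λ f → (f ≟ face (proj₁ base)) ⊎-dec
            (Fin.any? λ s → (toℕ (face (opp (f , s))) ℕ.<? toℕ f)
                      ×-dec (beyond (f , s) Bool.≟ beyond (opp (f , s)))))
    ×-dec ((#v ℕ.+ #f ℕ.+ 2) ℕ.≟ #e)
    ×-dec (3 ℕ.≤? len)
    ×-dec (all? λ j → label (pt (s₀ (cycle j))) ℕ.≟ label (pt (cycle (next j))))
    ×-dec (all? λ i → all? λ j → (label (pt (cycle i)) ℕ.≟ label (pt (cycle j))) →-dec (i ≟ j))
    ×-dec (all? λ j → ¬? (beyond (proj₁ (cycle j)) Bool.≟ beyond (opp (proj₁ (cycle j)))))
    ×-dec (all? λ j → isB (pt (cycle j)) Bool.≟ isB (pt (s₀ (cycle j))))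
    ×-dec (∀ᶜ? λ c → (beyond c Bool.≟ beyond (opp c)) ⊎-dec
            (Fin.any? λ j → edge (proj₁ (cycle j)) ≟ edge c))
    ×-dec (∀ᶜ? λ c → (isB c Bool.≟ false) ⊎-dec
            (Fin.any? λ j → label (pt (cycle j)) ℕ.≟ label c)))

  open Words S

  closed? : ∀ words → Dec (All (λ w → run w (base , 0ℤ) ≡ (base , 0ℤ)) words)
  closed? = All.all? λ w → _≟ˣ_ (run w (base , 0ℤ)) (base , 0ℤ)
    where
    _≟ˣ_ : DecidableEquality (Flag × ℤ)
    _≟ˣ_ = ≡-dec _≟ᶠ_ ℤ._≟_

  excludes? : ∀ y w → Dec (Excludes y w)
  excludes? y w = decide (run w (y , 0ℤ))
    where
    decide : ∀ z → Dec (proj₁ z ≢ y ⊎ ℤ.∣ proj₂ z ∣ ≡ 1)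
    decide (x , k) = ¬? (x ≟ᶠ y) ⊎-dec (ℤ.∣ k ∣ ℕ.≟ 1)

  mirror? : ∀ M → Dec (IsMirror {S = S} M)
  mirror? M = map′
    (λ (a₁ , a₂ , a₃ , a₄ , a₅ , a₆ , a₇ , a₈ , a₉) → record
      { mirror-s₀ = a₁ ; mirror-involutive = a₂ ; mirror-V = a₃ ; mirror-E = a₄ ; mirror-F = a₅
      ; height-V = a₆ ; height-E = a₇ ; height-F = a₈ ; moves = a₉ })
    (λ ok → let open IsMirror ok in
      mirror-s₀ , mirror-involutive , mirror-V , mirror-E , mirror-F , height-V , height-E , height-F , moves)
    ( (∀ᶜ? λ c → ∀ᵇ? λ d → mirror (s₀ (c , d)) ≟ᶠ s₀ (mirror (c , d)))
    ×-dec (∀ᶜ? λ c → ∀ᵇ? λ d → mirror (mirror (c , d)) ≟ᶠ (c , d))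
    ×-dec (∀ᶜ? λ c → ∀ᵇ? λ d → vert (pt (mirror (c , d))) ≟ mirrorV (vert (pt (c , d))))
    ×-dec (∀ᶜ? λ c → ∀ᵇ? λ d → edge (proj₁ (mirror (c , d))) ≟ mirrorE (edge c))
    ×-dec (∀ᶜ? λ c → ∀ᵇ? λ d → face (proj₁ (mirror (c , d))) ≟ mirrorF (face c))
    ×-dec (∀ᶜ? λ c → ∀ᵇ? λ d → heightV (vert (pt (c , d))) ℤ.≟
            (heightF (face c) ℤ.+ ⟦ isB (pt (mirror (c , d))) ⟧ ℤ.+ ⟦ isB (pt (c , d)) ⟧))
    ×-dec (∀ᶜ? λ c → ∀ᵇ? λ d → heightE (edge c) ℤ.≟
            (heightF (face c) ℤ.+ ⟦ beyond (proj₁ (mirror (c , d))) ⟧ ℤ.+ ⟦ beyond c ⟧))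
    ×-dec (all? λ f → heightF (mirrorF f) ℤ.≟ heightF f)
    ×-dec (Fin.any? λ v → ¬? (mirrorV v ≟ v)))
    where open Mirror M

  -- The reflection taking the flag of the corner (f , 0) to the f-th of the
  -- given flags, at the given height.
  reflection : List ((ℕ × ℕ × Bool) × ℤ) → Mirror S
  reflection images = fromImages (tabulate (λ f → image (toℕ f) images))
    where
    corners : List Corner
    corners = List.concatMap (λ f → List.map (f ,_) (List.allFin (size f))) (List.allFin #f)

    image : ℕ → List ((ℕ × ℕ × Bool) × ℤ) → Flag × ℤ
    image _       []                        = base , 0ℤ
    image zero    (((f , s , b) , k) ∷ _) =
      (findᵇ (λ (g , t) → (toℕ g ≡ᵇ f) ∧ (toℕ t ≡ᵇ s)) (proj₁ base) corners , b) , k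
    image (suc n) (_ ∷ images)              = image n images

    -- A mirror commutes with `s₀` and `s₁`, so the image of one flag of a polygon determines those
    -- of the following corners.
    spin : ∀ k → Flag → Array k Flag
    spin zero    x = tt
    spin (suc k) x = x , spin k (s₁ (s₀ x))

    first : ∀ {n} → Corner → (Fin n → Corner) → Corner
    first {zero}  c _ = c
    first {suc n} _ g = g zero

    fromRows : Array #f (Flag × ℤ) → Tuple (λ f → Array (size f) Flag) → Mirror S
    fromRows images rows = record
      { mirror  = mirror
      -- The data on cells are read off at one flag each; `IsMirror` then says that every other flag
      -- gives the same.
      ; mirrorV = λ v → vert (pt (mirror (anchor v)))
      ; mirrorE = λ e → edge (proj₁ (mirror (rep e , false)))
      ; mirrorF = λ f → face (proj₁ (proj₁ (images ! f)))
      ; heightV = λ v → height (anchor v) ℤ.+ ⟦ isB (pt (mirror (anchor v))) ⟧ ℤ.+ ⟦ isB (pt (anchor v)) ⟧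
      ; heightE = λ e → height (rep e , false) ℤ.+ ⟦ beyond (proj₁ (mirror (rep e , false))) ⟧
                                             ℤ.+ ⟦ beyond (rep e) ⟧
      ; heightF = λ f → proj₂ (images ! f)
      }
      where
      mirror : Flag → Flag
      mirror ((f , s) , false) = component {B = λ _ → Flag} (component {B = λ f → Array (size f) Flag} rows f) s
      mirror ((f , s) , true)  = s₀ (component {B = λ _ → Flag} (component {B = λ f → Array (size f) Flag} rows f) s)
      anchor : Fin #v → Flag
      anchor v = first (proj₁ base) (around v) , false
      height : Flag → ℤ
      height ((f , _) , _) = proj₂ (images ! f)

    fromImages : Array #f (Flag × ℤ) → Mirror S
    fromImages images = fromRows images (tabulate (λ f → spin (size f) (proj₁ (images ! f))))

proper? : ∀ X → Dec (ProperType X)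
proper? X = map′ (λ (p , q) → record { bounds = p ; distinct = q })
  (λ p → ProperType.bounds p , ProperType.distinct p)
  ( All.all? (λ (p , n) → (3 ℕ.≤? p) ×-dec (1 ℕ.≤? n)) X
  ×-dec ((1 ℕ.<? length X) →-dec Fin.all? (λ r → ¬? (proj₁ (lookup X r) ℕ.≟ proj₁ (lookup X (next r))))))

-- From checked plans to realisations.

Realisation : VertexType → ℕ → Set₁
Realisation X m = Σ[ Kᵐ ∈ PolyhedralMap ]
  ( SemiEquivelar Kᵐ X
  × (Σ[ K ∈ PolyhedralMap ] (SemiEquivelar K X × PolyhedralMap.χ K ≡ ℤ.- (+ 2) × IsCovering m K Kᵐ))
  × PolyhedralMap.χ Kᵐ ≡ ℤ.- (+ (2 ℕ.* m))
  × (Aut Kᵐ ≅ 𝔻 m ⊎ Aut Kᵐ ≅ ℤ/ m))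

module _ {X : VertexType} (proper : ProperType X) {S : Scheme (expand X)} (ok : IsValid S) where
  open Polyhedral ok

  semiEquivelar : ∀ m .{{_ : NonZero m}} → SemiEquivelar (polyhedralMap m) X
  semiEquivelar m = proper , λ u → Cover.face-cycle ok m u , face-degrees m u

  realisation : ∀ m .{{_ : NonZero m}} →
    Aut (polyhedralMap m) ≅ 𝔻 m ⊎ Aut (polyhedralMap m) ≅ ℤ/ m → Realisation X m
  realisation m aut = polyhedralMap m , semiEquivelar m
    , (polyhedralMap 1 , semiEquivelar 1 , χ-cover 1 , Covering.isCovering ok m)
    , χ-cover m , aut

≥2⇒NonZero : ∀ {m} → 2 ≤ m → NonZero m
≥2⇒NonZero (s≤s _) = _

module _ (X : VertexType) (S : Scheme (expand X)) (words : List (List Letter)) where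
  open Scheme S
  open Words S
  open Check S

  Asymmetric : Set
  Asymmetric = ProperType X × IsValid S
    × All (λ w → run w (base , 0ℤ) ≡ (base , 0ℤ)) words
    × (∀ c d → (c , d) ≡ base ⊎ Any (Excludes (c , d)) words)

  asymmetric? : Dec Asymmetric
  asymmetric? = proper? X ×-dec valid? ×-dec closed? words ×-dec
    (∀ᶜ? λ c → ∀ᵇ? λ d → ((c , d) ≟ᶠ base) ⊎-dec Any.any? (excludes? (c , d)) words)

  asymmetric : Asymmetric → ∀ m → 2 ≤ m → Realisation X m
  asymmetric (proper , ok , closed , only) m 2≤m = realisation proper ok m
    (inj₂ (Automorphisms.cyclic ok m 2≤m words closed (λ (c , d) → only c d)))
    where instance _ = ≥2⇒NonZero 2≤m

  Symmetric : Mirror S → Set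
  Symmetric M = ProperType X × IsValid S × IsMirror M
    × All (λ w → run w (base , 0ℤ) ≡ (base , 0ℤ)) words
    × (∀ c d → (c , d) ≡ base ⊎ (c , d) ≡ Mirror.mirror M base ⊎ Any (Excludes (c , d)) words)

  symmetric? : ∀ M → Dec (Symmetric M)
  symmetric? M = proper? X ×-dec valid? ×-dec mirror? M ×-dec closed? words ×-dec
    (∀ᶜ? λ c → ∀ᵇ? λ d → ((c , d) ≟ᶠ base) ⊎-dec ((c , d) ≟ᶠ Mirror.mirror M base)
                         ⊎-dec Any.any? (excludes? (c , d)) words)

  symmetric : ∀ {M} → Symmetric M → ∀ m → 2 ≤ m → Realisation X m
  symmetric (proper , ok , isMirror , closed , only) m 2≤m = realisation proper ok m
    (inj₁ (Automorphisms.dihedral ok m 2≤m words closed isMirror (λ (c , d) → only c d)))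
    where instance _ = ≥2⇒NonZero 2≤m

Realisable : VertexType → Set₁
Realisable X = ∀ m → 2 ≤ m → Realisation X m

-- Once the decision evaluates to `yes`, the implicit argument has the unit type and is filled in by
-- η; this is where a plan is verified.
viaℤ : ∀ {X} (p : Plan) words → {True (asymmetric? X (scheme (expand X) p) words)} → Realisable X
viaℤ {X} p words {t} = asymmetric X (scheme (expand X) p) words (toWitness t)

via𝔻 : ∀ {X} (p : Plan) images words → let S = scheme (expand X) p in
  {True (symmetric? X S words (Check.reflection S images))} → Realisable X
via𝔻 {X} p images words {t} = symmetric X (scheme (expand X) p) words (toWitness t)

-- The maps

infixr 6 _&_
infixr 7 _/_

-- Tighter versions of _∷_ and _,_, for lists of lists and lists of pairs.
pattern _&_ x xs = x ∷ xs
pattern _/_ x y  = x , y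

realise-3⁷ : Realisable ((3 , 7) ∷ [])
realise-3⁷ = viaℤ
  -- A vertex of this type contributes 1 - 7/2 + 7/3 = -1/6 to the Euler characteristic, so -2
  -- forces 12 vertices. The number of vertices is forced likewise in every plan.
  (plan 11 0 (1 & 2 & [])
    (0 & 2 & 3 & [] ∷ 1 & 0 & 4 & [] ∷ 1 & 2 & 5 & [] ∷ 3 & 2 & 6 & [] ∷ 3 & 0 & 7 & [] ∷
     5 & 0 & 4 & [] ∷ 1 & 4 & 3 & [] ∷ 5 & 2 & 4 & [] ∷ 8 & 1 & 5 & [] ∷ 6 & 2 & 9 & [] ∷
     6 & 3 & 1 & [] ∷ 7 & 0 & 10 & [] ∷ 7 & 3 & 11 & [] ∷ 10 & 0 & 5 & [] ∷ 11 & 4 & 3 & [] ∷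
     4 & 2 & 9 & [] ∷ 6 & 1 & 8 & [] ∷ 8 & 5 & 11 & [] ∷ 9 & 7 & 6 & [] ∷ 10 & 7 & 6 & [] ∷
     10 & 5 & 11 & [] ∷ 9 & 4 & 11 & [] ∷ 10 & 6 & 8 & [] ∷ 7 & 11 & 8 & [] ∷ 9 & 11 & 10 & [] ∷
     8 & 10 & 9 & [] ∷ 8 & 7 & 9 & [] ∷ [])
    (18 / 2 & 21 / 2 & 24 / 0 & 24 / 1 & 25 / 0 & 25 / 1 & 26 / 2 & 27 / 1 & 27 / 2 & [])
    (22 / 2 / true & 13 / 2 / false & 19 / 0 / true & []))
  (₀ & ₁ & ₀ & ₂ & ₁ & ₀ & ₂ & ₁ & ₀ & ₂ & ₁ & ₀ & ₂ & ₁ & ₂ & [] ∷ ₀ & ₂ & ₁ & ₂ & ₁ & ₀ & ₂ & ₁ &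
   ₂ & ₁ & ₀ & ₂ & ₁ & ₀ & ₂ & ₁ & [] ∷ [])

realise-3⁵-4 : Realisable ((3 , 5) ∷ (4 , 1) ∷ [])
realise-3⁵-4 = viaℤ
  (plan 23 0 (1 & 2 & 3 & [])
    (1 & 4 & 0 & [] ∷ 2 & 5 & 1 & [] ∷ 3 & 2 & 6 & [] ∷ 7 & 0 & 3 & [] ∷ 8 & 4 & 1 & [] ∷
     5 & 4 & 0 & [] ∷ 9 & 5 & 2 & [] ∷ 10 & 5 & 1 & [] ∷ 6 & 2 & 11 & [] ∷ 6 & 3 & 12 & [] ∷
     10 & 0 & 7 & [] ∷ 13 & 7 & 3 & [] ∷ 14 & 4 & 8 & [] ∷ 8 & 1 & 10 & [] ∷ 4 & 5 & 9 & 15 & [] ∷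
     0 & 5 & 10 & [] ∷ 2 & 9 & 11 & [] ∷ 11 & 6 & 16 & 17 & [] ∷ 12 & 3 & 13 & [] ∷
     18 & 12 & 6 & [] ∷ 19 & 10 & 7 & 20 & [] ∷ 13 & 15 & 7 & [] ∷ 15 & 4 & 14 & [] ∷
     14 & 8 & 18 & 21 & [] ∷ 8 & 10 & 19 & [] ∷ 9 & 15 & 13 & [] ∷ 11 & 9 & 22 & [] ∷
     6 & 18 & 16 & [] ∷ 23 & 17 & 16 & [] ∷ 21 & 17 & 11 & [] ∷ 12 & 13 & 22 & 23 & [] ∷
     12 & 19 & 18 & [] ∷ 20 & 15 & 7 & [] ∷ 15 & 14 & 20 & [] ∷ 19 & 8 & 18 & [] ∷
     17 & 14 & 21 & [] ∷ 13 & 9 & 22 & [] ∷ 22 & 11 & 21 & [] ∷ 21 & 18 & 16 & [] ∷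
     17 & 20 & 23 & [] ∷ 16 & 23 & 22 & [] ∷ 23 & 19 & 12 & [] ∷ 20 & 14 & 17 & [] ∷
     22 & 21 & 16 & [] ∷ 19 & 20 & 23 & [] ∷ [])
    (21 / 0 & 21 / 3 & 24 / 2 & 24 / 3 & 25 / 2 & 33 / 0 & 34 / 2 & 35 / 0 & 35 / 2 & 36 / 0 &
     36 / 2 & 43 / 0 & 43 / 2 & [])
    (32 / 1 / true & 21 / 3 / true & 40 / 0 / true & 30 / 0 / true & 24 / 2 / true & []))
  -- The first word goes once round a 4-gon; in a triangle it ends one corner off.
  (₀ & ₁ & ₀ & ₁ & ₀ & ₁ & ₀ & ₁ & [] ∷ ₀ & ₁ & ₂ & ₁ & ₀ & ₂ & ₁ & ₂ & ₁ & ₀ & ₂ & ₁ & ₂ & ₁ & ₂ &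
   [] ∷ [])

realise-3⁴-4² : Realisable ((3 , 4) ∷ (4 , 2) ∷ [])
realise-3⁴-4² = via𝔻
  (plan 11 0 (1 & 2 & 3 & [])
    (0 & 4 & 3 & [] ∷ 5 & 6 & 3 & 2 & [] ∷ 1 & 7 & 2 & [] ∷ 8 & 9 & 1 & 0 & [] ∷ 5 & 4 & 0 & [] ∷
     3 & 4 & 10 & [] ∷ 11 & 10 & 6 & 5 & [] ∷ 6 & 9 & 3 & [] ∷ 2 & 5 & 8 & [] ∷ 6 & 7 & 1 & [] ∷
     11 & 7 & 2 & [] ∷ 4 & 7 & 9 & 8 & [] ∷ 11 & 0 & 8 & [] ∷ 8 & 4 & 5 & [] ∷ 0 & 5 & 11 & [] ∷
     7 & 4 & 10 & 11 & [] ∷ 3 & 9 & 10 & [] ∷ 1 & 10 & 6 & [] ∷ 11 & 8 & 2 & [] ∷ 9 & 7 & 6 & [] ∷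
     1 & 9 & 10 & [] ∷ [])
    (0 / 1 & 3 / 0 & 4 / 1 & 4 / 2 & 10 / 0 & 10 / 2 & 12 / 2 & 20 / 0 & 20 / 2 & [])
    (8 / 0 / false & 4 / 1 / false & 10 / 2 / false & []))
  -- The mirror takes C, the cycle 6-9-1, to 9-6-10. The triangles 18 and 21 fill the gap between
  -- the two cycles and have height 1.
  ((16 / 2 / true , + 0) & (11 / 2 / true , + 0) & (12 / 2 / true , + 0) & (6 / 2 / false , + 0) &
   (7 / 2 / true , + 0) & (19 / 1 / false , + 0) & (3 / 1 / false , + 0) & (4 / 2 / true , + 0) &
   (20 / 2 / true , + 0) & (14 / 0 / true , + 0) & (17 / 0 / true , + 0) & (1 / 2 / true , + 0) &
   (2 / 2 / true , + 0) & (15 / 2 / true , + 0) & (9 / 0 / true , + 0) & (13 / 2 / true , + 0) &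
   (0 / 2 / true , + 0) & (10 / 0 / true , + 0) & (21 / 2 / false , + 1) & (5 / 2 / false , + 0) &
   (8 / 2 / true , + 0) & (18 / 1 / false , + 1) & [])
  (₀ & ₁ & ₀ & ₁ & ₂ & ₁ & ₂ & ₁ & ₀ & ₂ & ₁ & ₂ & ₁ & ₀ & ₂ & ₁ & ₂ & [] ∷ ₁ & ₂ & ₁ & ₀ & ₂ & ₁ &
   ₂ & ₁ & ₀ & ₂ & ₁ & ₂ & ₁ & ₀ & ₁ & ₂ & [] ∷ [])

realise-3³-4-3-4 : Realisable ((3 , 3) ∷ (4 , 1) ∷ (3 , 1) ∷ (4 , 1) ∷ [])
realise-3³-4-3-4 = viaℤ
  (plan 11 0 (1 & 2 & [])
    (3 & 1 & 0 & 4 & [] ∷ 2 & 1 & 5 & 6 & [] ∷ 7 & 8 & 2 & 0 & [] ∷ 1 & 3 & 8 & [] ∷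
     0 & 4 & 9 & [] ∷ 4 & 3 & 10 & [] ∷ 11 & 1 & 5 & [] ∷ 8 & 3 & 7 & [] ∷ 7 & 0 & 6 & [] ∷
     8 & 1 & 11 & [] ∷ 11 & 8 & 4 & 9 & [] ∷ 9 & 0 & 6 & [] ∷ 5 & 3 & 10 & 9 & [] ∷
     2 & 4 & 10 & [] ∷ 7 & 5 & 11 & [] ∷ 7 & 3 & 5 & [] ∷ 6 & 7 & 11 & 10 & [] ∷ 4 & 8 & 2 & [] ∷
     9 & 10 & 11 & [] ∷ 9 & 5 & 6 & [] ∷ 6 & 2 & 10 & [] ∷ [])
    (1 / 0 & 4 / 1 & 4 / 2 & 6 / 1 & 9 / 2 & 10 / 0 & 11 / 1 & 12 / 2 & 13 / 0 & 13 / 1 & 14 / 0 &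
     17 / 0 & 18 / 1 & 18 / 2 & 20 / 1 & 20 / 2 & 21 / 0 & 21 / 1 & [])
    (2 / 3 / false & 3 / 1 / true & 4 / 1 / true & 13 / 0 / true & 2 / 2 / false & []))
  (₀ & ₂ & ₁ & ₂ & ₁ & ₀ & ₂ & ₁ & ₂ & ₁ & ₀ & ₁ & ₂ & ₁ & ₀ & ₂ & ₁ & ₂ & [] ∷ [])

realise-3⁵-5 : Realisable ((3 , 5) ∷ (5 , 1) ∷ [])
realise-3⁵-5 = viaℤ
  (plan 14 0 (1 & 2 & [])
    (3 & 0 & 1 & 4 & 5 & [] ∷ 2 & 0 & 6 & [] ∷ 7 & 1 & 2 & [] ∷ 0 & 3 & 8 & [] ∷ 5 & 3 & 9 & [] ∷
     10 & 0 & 6 & [] ∷ 2 & 6 & 8 & [] ∷ 7 & 11 & 1 & [] ∷ 12 & 2 & 7 & [] ∷ 8 & 3 & 6 & [] ∷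
     8 & 0 & 10 & [] ∷ 9 & 3 & 11 & [] ∷ 10 & 6 & 11 & 7 & 13 & [] ∷ 2 & 8 & 9 & 14 & 12 & [] ∷
     4 & 7 & 12 & [] ∷ 11 & 3 & 6 & [] ∷ 9 & 8 & 10 & [] ∷ 13 & 7 & 4 & [] ∷ 13 & 10 & 5 & [] ∷
     11 & 9 & 14 & [] ∷ 12 & 13 & 14 & [] ∷ 4 & 5 & 12 & [] ∷ 10 & 9 & 5 & [] ∷ 14 & 4 & 13 & [] ∷
     13 & 5 & 12 & [] ∷ 14 & 11 & 1 & [] ∷ 14 & 1 & 4 & [] ∷ [])
    (14 / 2 & 15 / 0 & 17 / 0 & 18 / 2 & 19 / 2 & 20 / 0 & 20 / 1 & 22 / 0 & 22 / 1 & 23 / 1 &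
     23 / 2 & 24 / 1 & 25 / 1 & 26 / 1 & 26 / 2 & 27 / 1 & 27 / 2 & [])
    (1 / 2 / true & 8 / 1 / true & 12 / 2 / false & 5 / 2 / false & 1 / 3 / true & []))
  (₁ & ₀ & ₂ & ₁ & ₀ & ₂ & ₁ & ₀ & ₂ & ₁ & ₀ & ₂ & ₁ & ₀ & ₂ & ₁ & ₂ & [] ∷ ₀ & ₁ & ₂ & ₁ & ₀ & ₂ &
   ₁ & ₀ & ₂ & ₁ & ₀ & ₁ & ₂ & ₁ & ₀ & ₂ & ₁ & ₂ & ₁ & [] ∷ [])

realise-3⁴-7 : Realisable ((3 , 4) ∷ (7 , 1) ∷ [])
realise-3⁴-7 = viaℤ
  (plan 83 0 (1 & 2 & [])
    (0 & 3 & 1 & [] ∷ 2 & 4 & 0 & [] ∷ 3 & 0 & 5 & [] ∷ 1 & 3 & 6 & [] ∷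
     7 & 8 & 9 & 4 & 0 & 5 & 10 & [] ∷ 5 & 11 & 3 & [] ∷ 6 & 3 & 11 & 12 & 13 & 14 & 15 & [] ∷
     16 & 7 & 8 & [] ∷ 17 & 8 & 9 & [] ∷ 18 & 5 & 10 & [] ∷ 19 & 10 & 7 & [] ∷ 5 & 18 & 11 & [] ∷
     20 & 12 & 11 & [] ∷ 21 & 13 & 12 & [] ∷ 22 & 14 & 13 & [] ∷ 23 & 7 & 16 & [] ∷
     8 & 24 & 16 & [] ∷ 17 & 8 & 24 & [] ∷ 9 & 25 & 17 & [] ∷ 10 & 26 & 18 & [] ∷
     19 & 26 & 10 & [] ∷ 7 & 23 & 19 & [] ∷ 11 & 18 & 20 & [] ∷ 12 & 20 & 27 & [] ∷
     13 & 28 & 21 & [] ∷ 12 & 27 & 21 & [] ∷ 29 & 14 & 22 & [] ∷ 13 & 28 & 22 & [] ∷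
     23 & 16 & 30 & [] ∷ 30 & 16 & 24 & 31 & 32 & 33 & 34 & [] ∷ 24 & 17 & 35 & [] ∷
     36 & 25 & 17 & 35 & 37 & 38 & 39 & [] ∷ 26 & 18 & 20 & 40 & 41 & 42 & 43 & [] ∷
     26 & 19 & 44 & [] ∷ 45 & 23 & 19 & 44 & 46 & 47 & 48 & [] ∷ 27 & 20 & 40 & [] ∷
     28 & 21 & 49 & [] ∷ 50 & 51 & 49 & 21 & 27 & 52 & 53 & [] ∷ 14 & 29 & 54 & [] ∷
     29 & 22 & 55 & [] ∷ 55 & 22 & 28 & 56 & 57 & 58 & 59 & [] ∷ 30 & 45 & 23 & [] ∷
     35 & 31 & 24 & [] ∷ 42 & 32 & 31 & [] ∷ 57 & 33 & 32 & [] ∷ 60 & 34 & 33 & [] ∷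
     61 & 30 & 34 & [] ∷ 41 & 35 & 37 & [] ∷ 52 & 37 & 38 & [] ∷ 62 & 38 & 39 & [] ∷
     37 & 40 & 41 & [] ∷ 31 & 41 & 42 & [] ∷ 58 & 42 & 43 & [] ∷ 44 & 43 & 26 & [] ∷
     59 & 44 & 46 & [] ∷ 63 & 46 & 47 & [] ∷ 64 & 47 & 48 & [] ∷ 65 & 48 & 45 & [] ∷
     40 & 52 & 27 & [] ∷ 49 & 56 & 28 & [] ∷ 66 & 51 & 50 & [] ∷ 67 & 49 & 51 & [] ∷
     38 & 53 & 52 & [] ∷ 68 & 50 & 53 & [] ∷ 69 & 68 & 62 & 70 & 54 & 29 & 63 & [] ∷
     55 & 63 & 29 & [] ∷ 71 & 57 & 56 & [] ∷ 32 & 58 & 57 & [] ∷ 43 & 59 & 58 & [] ∷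
     46 & 55 & 59 & [] ∷ 45 & 61 & 30 & [] ∷ 35 & 31 & 41 & [] ∷ 32 & 42 & 58 & [] ∷
     33 & 71 & 57 & [] ∷ 34 & 72 & 60 & [] ∷ 33 & 71 & 60 & [] ∷ 34 & 72 & 61 & [] ∷
     37 & 40 & 52 & [] ∷ 53 & 62 & 38 & [] ∷ 39 & 70 & 62 & [] ∷ 44 & 59 & 43 & [] ∷
     63 & 46 & 55 & [] ∷ 47 & 69 & 63 & [] ∷ 64 & 47 & 69 & [] ∷ 48 & 73 & 64 & [] ∷
     65 & 48 & 73 & [] ∷ 45 & 61 & 65 & [] ∷ 56 & 67 & 49 & [] ∷ 66 & 74 & 51 & [] ∷
     50 & 75 & 66 & [] ∷ 51 & 74 & 67 & [] ∷ 75 & 68 & 50 & [] ∷ 53 & 62 & 68 & [] ∷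
     75 & 68 & 69 & [] ∷ 56 & 67 & 71 & [] ∷ 72 & 60 & 76 & [] ∷
     60 & 71 & 67 & 74 & 2 & 1 & 76 & [] ∷ 61 & 72 & 77 & 78 & 79 & 80 & 65 & [] ∷
     69 & 64 & 75 & [] ∷ 73 & 81 & 82 & 83 & 66 & 75 & 64 & [] ∷ 73 & 65 & 80 & [] ∷
     74 & 66 & 83 & [] ∷ 76 & 77 & 72 & [] ∷ 83 & 2 & 74 & [] ∷ 6 & 76 & 1 & [] ∷
     15 & 78 & 77 & [] ∷ 70 & 79 & 78 & [] ∷ 36 & 80 & 79 & [] ∷ 80 & 81 & 73 & [] ∷
     25 & 82 & 81 & [] ∷ 4 & 83 & 82 & [] ∷ 76 & 77 & 6 & [] ∷ 83 & 4 & 2 & [] ∷ 15 & 78 & 54 & [] ∷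
     77 & 6 & 15 & [] ∷ 79 & 70 & 39 & [] ∷ 78 & 54 & 70 & [] ∷ 80 & 36 & 81 & [] ∷
     79 & 39 & 36 & [] ∷ 25 & 82 & 9 & [] ∷ 81 & 36 & 25 & [] ∷ 82 & 9 & 4 & [] ∷
     54 & 15 & 14 & [] ∷ [])
    (97 / 4 & 97 / 5 & 104 / 1 & 105 / 0 & 105 / 2 & 106 / 0 & 107 / 0 & 108 / 0 & 110 / 0 &
     111 / 0 & 112 / 2 & 113 / 1 & 113 / 2 & 114 / 0 & 114 / 2 & 115 / 1 & 115 / 2 & 116 / 1 &
     116 / 2 & 117 / 1 & 117 / 2 & 118 / 1 & 119 / 1 & 119 / 2 & 120 / 0 & 120 / 2 & 121 / 1 &
     121 / 2 & 122 / 1 & 122 / 2 & 123 / 0 & 123 / 1 & 123 / 2 & [])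
    (7 / 5 / false & 7 / 6 / false & 4 / 2 / false & 0 / 1 / false & 2 / 0 / false & 5 / 2 / true &
     19 / 0 / false & 32 / 0 / true & 32 / 6 / true & 80 / 0 / false & 65 / 3 / false &
     39 / 2 / false & []))
  (₀ & ₁ & ₂ & ₁ & ₀ & ₁ & ₂ & ₁ & ₀ & ₂ & ₁ & ₂ & ₁ & ₀ & ₁ & ₀ & ₁ & ₀ & ₂ & ₁ & ₀ & ₂ & ₁ & ₀ & ₂
   & ₁ & ₀ & ₁ & ₀ & ₂ & ₁ & ₀ & ₂ & ₁ & ₀ & ₂ & ₁ & ₀ & ₂ & ₁ & [] ∷ [])

realise-3⁴-8 : Realisable ((3 , 4) ∷ (8 , 1) ∷ [])
realise-3⁴-8 = viaℤ
  (plan 47 0 (1 & 2 & [])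
    (3 & 0 & 2 & [] ∷ 4 & 2 & 1 & 5 & 6 & 7 & 8 & 9 & [] ∷ 1 & 10 & 0 & [] ∷ 3 & 0 & 11 & [] ∷
     2 & 3 & 12 & [] ∷ 12 & 4 & 2 & [] ∷ 13 & 1 & 5 & [] ∷ 14 & 5 & 6 & [] ∷ 15 & 7 & 8 & [] ∷
     16 & 8 & 9 & [] ∷ 17 & 9 & 4 & [] ∷ 1 & 10 & 13 & [] ∷
     0 & 10 & 18 & 19 & 16 & 20 & 21 & 11 & [] ∷ 11 & 22 & 3 & [] ∷
     12 & 3 & 22 & 23 & 24 & 13 & 25 & 26 & [] ∷ 4 & 27 & 12 & [] ∷ 5 & 25 & 13 & [] ∷
     5 & 25 & 14 & [] ∷ 7 & 28 & 15 & [] ∷ 8 & 29 & 15 & [] ∷ 16 & 8 & 29 & [] ∷ 9 & 20 & 16 & [] ∷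
     17 & 9 & 20 & [] ∷ 4 & 27 & 17 & [] ∷ 10 & 13 & 24 & [] ∷ 24 & 18 & 10 & [] ∷
     30 & 19 & 18 & [] ∷ 29 & 16 & 19 & [] ∷ 31 & 21 & 20 & [] ∷ 32 & 11 & 21 & [] ∷
     32 & 11 & 22 & [] ∷ 33 & 23 & 22 & [] ∷ 34 & 24 & 23 & [] ∷ 35 & 26 & 25 & [] ∷
     27 & 12 & 26 & [] ∷ 25 & 14 & 35 & [] ∷ 7 & 28 & 36 & [] ∷ 28 & 15 & 37 & [] ∷
     33 & 38 & 39 & 40 & 29 & 15 & 37 & 32 & [] ∷ 20 & 17 & 31 & [] ∷
     27 & 41 & 42 & 43 & 36 & 28 & 31 & 17 & [] ∷ 24 & 18 & 34 & [] ∷ 19 & 40 & 30 & [] ∷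
     18 & 34 & 30 & [] ∷ 19 & 40 & 29 & [] ∷ 31 & 21 & 37 & [] ∷ 21 & 37 & 32 & [] ∷
     22 & 32 & 33 & [] ∷ 33 & 23 & 44 & [] ∷ 23 & 44 & 34 & [] ∷ 26 & 41 & 35 & [] ∷
     26 & 41 & 27 & [] ∷ 37 & 31 & 28 & [] ∷ 44 & 33 & 38 & [] ∷ 42 & 38 & 39 & [] ∷
     45 & 39 & 40 & [] ∷ 46 & 42 & 41 & [] ∷ 40 & 30 & 45 & [] ∷
     44 & 46 & 35 & 14 & 47 & 45 & 30 & 34 & [] ∷ 41 & 35 & 46 & [] ∷ 38 & 46 & 44 & [] ∷
     38 & 46 & 42 & [] ∷ 39 & 43 & 42 & [] ∷ 43 & 45 & 39 & [] ∷ 6 & 47 & 14 & [] ∷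
     43 & 45 & 47 & [] ∷ 6 & 47 & 36 & [] ∷ 47 & 36 & 43 & [] ∷ 36 & 6 & 7 & [] ∷ [])
    (55 / 0 & 59 / 1 & 59 / 2 & 59 / 3 & 61 / 1 & 62 / 1 & 62 / 2 & 63 / 1 & 63 / 2 & 64 / 0 &
     65 / 0 & 65 / 2 & 66 / 0 & 67 / 0 & 67 / 2 & 68 / 1 & 68 / 2 & 69 / 0 & 69 / 1 & 69 / 2 & [])
    (59 / 1 / false & 36 / 1 / true & 8 / 2 / true & 2 / 4 / false & 37 / 2 / true & 41 / 3 / true &
     41 / 2 / true & 57 / 0 / true & []))
  (₀ & ₁ & ₀ & ₂ & ₁ & ₀ & ₁ & ₀ & ₁ & ₂ & ₁ & ₀ & ₂ & ₁ & ₀ & ₂ & ₁ & ₀ & ₁ & ₀ & ₁ & ₀ & ₁ & ₂ & ₁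
   & ₂ & [] ∷ [])

realise-3⁴-9 : Realisable ((3 , 4) ∷ (9 , 1) ∷ [])
realise-3⁴-9 = viaℤ
  (plan 35 0 (1 & 2 & [])
    (2 & 3 & 0 & [] ∷ 4 & 5 & 6 & 7 & 1 & 2 & 8 & 9 & 10 & [] ∷ 1 & 11 & 0 & [] ∷ 2 & 3 & 12 & [] ∷
     3 & 0 & 13 & [] ∷ 14 & 5 & 4 & [] ∷ 15 & 6 & 5 & [] ∷ 16 & 7 & 6 & [] ∷ 17 & 1 & 7 & [] ∷
     12 & 8 & 2 & [] ∷ 18 & 9 & 8 & [] ∷ 19 & 10 & 9 & [] ∷ 20 & 4 & 10 & [] ∷ 17 & 1 & 11 & [] ∷
     20 & 21 & 13 & 0 & 11 & 22 & 23 & 18 & 24 & [] ∷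
     25 & 14 & 26 & 27 & 28 & 16 & 29 & 3 & 12 & [] ∷ 13 & 29 & 3 & [] ∷ 5 & 30 & 14 & [] ∷
     4 & 25 & 14 & [] ∷ 15 & 6 & 28 & [] ∷ 5 & 30 & 15 & [] ∷ 31 & 16 & 7 & [] ∷ 6 & 28 & 16 & [] ∷
     7 & 31 & 17 & [] ∷ 24 & 12 & 8 & [] ∷ 32 & 18 & 9 & [] ∷ 8 & 24 & 18 & [] ∷ 21 & 19 & 10 & [] ∷
     9 & 32 & 19 & [] ∷ 25 & 20 & 4 & [] ∷ 10 & 21 & 20 & [] ∷ 11 & 17 & 33 & [] ∷
     34 & 13 & 21 & [] ∷ 33 & 22 & 11 & [] ∷ 27 & 23 & 22 & [] ∷ 32 & 18 & 23 & [] ∷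
     25 & 20 & 24 & [] ∷ 30 & 14 & 26 & [] ∷ 31 & 16 & 29 & [] ∷ 24 & 12 & 25 & [] ∷
     13 & 29 & 34 & [] ∷ 15 & 35 & 32 & 19 & 34 & 31 & 17 & 33 & 30 & [] ∷ 21 & 19 & 34 & [] ∷
     33 & 22 & 26 & [] ∷ 35 & 27 & 23 & [] ∷ 22 & 26 & 27 & [] ∷ 23 & 35 & 32 & [] ∷
     29 & 34 & 31 & [] ∷ 28 & 15 & 35 & [] ∷ 26 & 33 & 30 & [] ∷ 35 & 27 & 28 & [] ∷ [])
    (35 / 0 & 42 / 0 & 42 / 8 & 44 / 2 & 45 / 1 & 46 / 1 & 46 / 2 & 49 / 0 & 49 / 1 & 50 / 0 &
     50 / 2 & 51 / 1 & 51 / 2 & [])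
    (16 / 2 / true & 38 / 2 / false & 21 / 1 / false & 20 / 2 / true & 16 / 3 / true & []))
  (₀ & ₁ & ₀ & ₂ & ₁ & ₀ & ₁ & ₂ & ₁ & ₀ & ₂ & ₁ & ₂ & ₁ & ₀ & ₁ & ₀ & ₁ & ₀ & ₁ & ₀ & ₂ & ₁ & ₂ &
   [] ∷ [])

realise-3⁴-10 : Realisable ((3 , 4) ∷ (10 , 1) ∷ [])
realise-3⁴-10 = viaℤ
  (plan 29 0 (1 & 2 & [])
    (3 & 0 & 2 & [] ∷ 1 & 4 & 5 & 6 & 7 & 8 & 9 & 10 & 11 & 2 & [] ∷ 1 & 12 & 0 & [] ∷
     3 & 0 & 13 & [] ∷ 2 & 3 & 14 & [] ∷ 15 & 1 & 4 & [] ∷ 16 & 4 & 5 & [] ∷ 17 & 5 & 6 & [] ∷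
     18 & 6 & 7 & [] ∷ 19 & 7 & 8 & [] ∷ 20 & 9 & 10 & [] ∷ 21 & 10 & 11 & [] ∷ 14 & 11 & 2 & [] ∷
     1 & 12 & 15 & [] ∷ 12 & 18 & 22 & 21 & 23 & 24 & 25 & 16 & 13 & 0 & [] ∷ 13 & 17 & 3 & [] ∷
     15 & 26 & 20 & 27 & 19 & 28 & 14 & 3 & 17 & 29 & [] ∷ 4 & 26 & 15 & [] ∷ 26 & 16 & 4 & [] ∷
     5 & 13 & 16 & [] ∷ 17 & 5 & 13 & [] ∷ 6 & 29 & 17 & [] ∷ 6 & 29 & 18 & [] ∷ 7 & 22 & 18 & [] ∷
     7 & 22 & 19 & [] ∷ 10 & 27 & 20 & [] ∷ 10 & 27 & 21 & [] ∷ 11 & 23 & 21 & [] ∷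
     23 & 14 & 11 & [] ∷ 12 & 15 & 29 & [] ∷ 29 & 18 & 12 & [] ∷ 27 & 21 & 22 & [] ∷
     28 & 24 & 23 & [] ∷ 9 & 25 & 24 & [] ∷ 26 & 16 & 25 & [] ∷ 25 & 20 & 26 & [] ∷
     8 & 28 & 19 & [] ∷ 23 & 14 & 28 & [] ∷ 22 & 19 & 27 & [] ∷ 8 & 28 & 24 & [] ∷
     9 & 25 & 20 & [] ∷ 24 & 8 & 9 & [] ∷ [])
    (17 / 2 & 17 / 3 & 17 / 4 & 34 / 0 & 36 / 1 & 37 / 0 & 37 / 2 & 40 / 0 & 41 / 0 & 41 / 2 &
     42 / 1 & 42 / 2 & [])
    (2 / 5 / true & 10 / 2 / false & 17 / 3 / true & 17 / 2 / true & 11 / 0 / false & []))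
  (₀ & ₁ & ₂ & ₁ & ₀ & ₁ & ₀ & ₂ & ₁ & ₀ & ₂ & ₁ & ₀ & ₂ & ₁ & ₀ & ₁ & ₂ & ₁ & ₂ & [] ∷ ₀ & ₁ & ₀ &
   ₂ & ₁ & ₀ & ₁ & ₂ & ₁ & ₀ & ₂ & ₁ & ₂ & ₁ & ₀ & ₁ & ₀ & ₁ & ₀ & ₁ & ₀ & ₂ & ₁ & ₂ & [] ∷ [])

realise-3²-5-3-5 : Realisable ((3 , 2) ∷ (5 , 1) ∷ (3 , 1) ∷ (5 , 1) ∷ [])
realise-3²-5-3-5 = viaℤ
  (plan 19 0 (1 & 2 & [])
    (3 & 1 & 2 & 4 & 5 & [] ∷ 0 & 1 & 6 & 7 & 8 & [] ∷ 9 & 0 & 2 & [] ∷ 1 & 3 & 10 & [] ∷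
     4 & 2 & 11 & [] ∷ 6 & 4 & 5 & [] ∷ 5 & 3 & 12 & [] ∷ 10 & 1 & 6 & [] ∷ 5 & 6 & 7 & [] ∷
     7 & 8 & 13 & [] ∷ 8 & 0 & 14 & [] ∷ 10 & 3 & 14 & 0 & 9 & [] ∷ 9 & 2 & 11 & 15 & 13 & [] ∷
     11 & 4 & 16 & [] ∷ 6 & 10 & 17 & 16 & 4 & [] ∷ 12 & 3 & 14 & [] ∷ 7 & 5 & 12 & 18 & 15 & [] ∷
     13 & 17 & 18 & 19 & 8 & [] ∷ 15 & 7 & 13 & [] ∷ 8 & 14 & 19 & [] ∷ 9 & 10 & 17 & [] ∷
     13 & 9 & 17 & [] ∷ 16 & 12 & 14 & 19 & 11 & [] ∷ 18 & 12 & 16 & [] ∷ 19 & 15 & 18 & [] ∷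
     18 & 16 & 17 & [] ∷ 19 & 11 & 15 & [] ∷ [])
    (10 / 2 & 17 / 4 & 18 / 0 & 18 / 1 & 19 / 0 & 19 / 2 & 23 / 0 & 23 / 4 & 24 / 2 & 25 / 1 &
     26 / 1 & 26 / 2 & 27 / 1 & 27 / 2 & [])
    (13 / 2 / true & 14 / 2 / true & 15 / 2 / true & 18 / 0 / true & 13 / 3 / true & []))
  (₀ & ₁ & ₀ & ₂ & ₁ & ₀ & ₁ & ₀ & ₂ & ₁ & ₀ & ₂ & ₁ & ₂ & ₁ & ₀ & ₁ & ₀ & ₂ & [] ∷ ₀ & ₁ & ₂ & ₁ &
   ₀ & ₂ & ₁ & ₀ & ₂ & ₁ & ₀ & ₁ & ₀ & ₂ & ₁ & ₂ & ₁ & [] ∷ [])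

realise-3³-4-6 : Realisable ((3 , 3) ∷ (4 , 1) ∷ (6 , 1) ∷ [])
realise-3³-4-6 = via𝔻
  (plan 23 0 (1 & 2 & 3 & [])
    (1 & 2 & 4 & [] ∷ 0 & 1 & 5 & 6 & 7 & 8 & [] ∷ 0 & 3 & 9 & [] ∷ 9 & 5 & 6 & 10 & [] ∷
     6 & 7 & 11 & [] ∷ 12 & 13 & 7 & 8 & [] ∷ 8 & 0 & 14 & [] ∷ 9 & 3 & 5 & [] ∷ 9 & 0 & 14 & [] ∷
     10 & 6 & 15 & [] ∷ 14 & 9 & 10 & 12 & 13 & 16 & [] ∷ 11 & 17 & 7 & [] ∷ 6 & 11 & 15 & [] ∷
     7 & 17 & 13 & [] ∷ 12 & 8 & 18 & [] ∷ 18 & 14 & 8 & [] ∷ 10 & 15 & 19 & [] ∷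
     12 & 19 & 10 & [] ∷ 13 & 16 & 20 & [] ∷ 18 & 21 & 16 & 14 & [] ∷ 11 & 22 & 4 & 17 & [] ∷
     2 & 3 & 22 & 11 & 15 & 23 & [] ∷ 13 & 20 & 17 & [] ∷ 12 & 18 & 19 & [] ∷
     15 & 23 & 20 & 19 & [] ∷ 20 & 23 & 16 & [] ∷ 17 & 4 & 21 & 18 & 19 & 20 & [] ∷
     23 & 21 & 16 & [] ∷ 4 & 22 & 1 & [] ∷ 22 & 3 & 5 & [] ∷ 23 & 2 & 21 & [] ∷ 21 & 2 & 4 & [] ∷
     5 & 22 & 1 & [] ∷ [])
    (21 / 2 & 22 / 0 & 22 / 1 & 27 / 1 & 29 / 0 & 29 / 2 & 30 / 1 & 30 / 2 & 31 / 1 & 32 / 1 &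
     32 / 2 & 33 / 0 & 33 / 2 & [])
    (0 / 2 / true & 1 / 1 / false & 1 / 2 / false & 2 / 1 / false & 8 / 1 / true & []))
  ((0 / 2 / false , + 0) & (3 / 0 / true , + 0) & (22 / 0 / false , -[1+ 0 ]) &
   (1 / 0 / true , + 0) & (21 / 1 / true , -[1+ 0 ]) & (13 / 1 / false , -[1+ 0 ]) &
   (25 / 2 / false , -[1+ 0 ]) & (31 / 0 / false , -[1+ 0 ]) & (29 / 2 / true , -[1+ 0 ]) &
   (32 / 1 / true , -[1+ 0 ]) & (12 / 0 / true , -[1+ 0 ]) & (27 / 1 / true , -[1+ 0 ]) &
   (10 / 0 / true , -[1+ 0 ]) & (5 / 2 / false , -[1+ 0 ]) & (17 / 0 / true , -[1+ 0 ]) &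
   (26 / 0 / false , -[1+ 0 ]) & (28 / 1 / true , -[1+ 0 ]) & (14 / 0 / true , -[1+ 0 ]) &
   (23 / 0 / true , -[1+ 0 ]) & (24 / 1 / true , -[1+ 0 ]) & (20 / 2 / false , -[1+ 0 ]) &
   (4 / 1 / true , -[1+ 0 ]) & (2 / 0 / false , -[1+ 0 ]) & (18 / 0 / true , -[1+ 0 ]) &
   (19 / 1 / true , -[1+ 0 ]) & (6 / 2 / false , -[1+ 0 ]) & (15 / 0 / false , -[1+ 0 ]) &
   (11 / 1 / true , -[1+ 0 ]) & (16 / 1 / true , -[1+ 0 ]) & (8 / 2 / true , -[1+ 0 ]) &
   (33 / 2 / true , -[1+ 1 ]) & (7 / 0 / false , -[1+ 0 ]) & (9 / 1 / true , -[1+ 0 ]) &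
   (30 / 2 / true , -[1+ 1 ]) & [])
  (₀ & ₁ & ₀ & ₁ & ₀ & ₁ & ₀ & ₁ & [] ∷ ₀ & ₂ & ₁ & ₀ & ₁ & ₂ & ₁ & ₀ & ₂ & ₁ & ₀ & ₂ & ₁ & ₀ & ₂ &
   ₁ & [] ∷ [])

realise-3²-4-3-6 : Realisable ((3 , 2) ∷ (4 , 1) ∷ (3 , 1) ∷ (6 , 1) ∷ [])
realise-3²-4-3-6 = via𝔻
  (plan 23 0 (1 & 2 & 3 & [])
    (2 & 3 & 4 & [] ∷ 0 & 1 & 5 & [] ∷ 1 & 2 & 6 & [] ∷ 4 & 7 & 8 & 9 & 10 & 3 & [] ∷
     4 & 11 & 2 & [] ∷ 12 & 5 & 1 & 13 & 14 & 15 & [] ∷ 5 & 16 & 0 & [] ∷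
     11 & 17 & 18 & 19 & 6 & 2 & [] ∷ 6 & 13 & 1 & [] ∷ 12 & 4 & 7 & [] ∷ 17 & 7 & 8 & [] ∷
     14 & 8 & 9 & [] ∷ 19 & 9 & 10 & [] ∷ 4 & 11 & 20 & 12 & [] ∷ 7 & 5 & 12 & [] ∷
     21 & 14 & 13 & [] ∷ 9 & 15 & 14 & [] ∷ 20 & 12 & 15 & [] ∷ 7 & 5 & 16 & 17 & [] ∷
     16 & 17 & 11 & [] ∷ 10 & 6 & 19 & [] ∷ 10 & 6 & 13 & 22 & [] ∷ 8 & 18 & 17 & [] ∷
     18 & 21 & 14 & 8 & [] ∷ 9 & 15 & 23 & 19 & [] ∷ 11 & 20 & 16 & [] ∷ 13 & 22 & 21 & [] ∷
     15 & 23 & 20 & [] ∷ 22 & 10 & 3 & [] ∷ 18 & 21 & 23 & [] ∷ 23 & 19 & 18 & [] ∷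
     20 & 23 & 21 & 22 & 0 & 16 & [] ∷ 3 & 0 & 22 & [] ∷ [])
    (8 / 1 & 8 / 2 & 8 / 3 & 20 / 0 & 20 / 1 & 21 / 0 & 21 / 2 & 22 / 0 & 26 / 2 & 29 / 1 & 29 / 2 &
     32 / 4 & 32 / 5 & 33 / 0 & 33 / 1 & [])
    (7 / 1 / false & 0 / 3 / true & 4 / 4 / true & 13 / 2 / false & 8 / 2 / true & 8 / 1 / true &
     19 / 2 / true & []))
  ((0 / 2 / false , + 0) & (2 / 0 / false , + 0) & (1 / 0 / false , + 0) &
   (33 / 0 / false , -[1+ 0 ]) & (6 / 0 / true , + 0) & (7 / 0 / false , + 0) &
   (4 / 0 / true , + 0) & (5 / 0 / false , + 0) & (32 / 5 / false , -[1+ 0 ]) &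
   (29 / 0 / false , -[1+ 0 ]) & (15 / 0 / false , + 0) & (18 / 0 / false , + 0) &
   (17 / 0 / false , + 0) & (16 / 0 / false , + 0) & (19 / 1 / false , + 0) &
   (10 / 0 / false , + 0) & (13 / 0 / false , + 0) & (12 / 0 / false , + 0) &
   (11 / 0 / false , + 0) & (14 / 3 / false , + 0) & (26 / 0 / false , -[1+ 0 ]) &
   (27 / 0 / false , -[1+ 0 ]) & (22 / 2 / false , -[1+ 0 ]) & (28 / 0 / false , + 0) &
   (25 / 2 / false , + 0) & (24 / 2 / false , + 0) & (20 / 0 / false , -[1+ 0 ]) &
   (21 / 0 / false , -[1+ 0 ]) & (23 / 0 / false , + 0) & (9 / 0 / false , -[1+ 0 ]) &
   (31 / 0 / false , + 0) & (30 / 0 / false , + 0) & (8 / 1 / false , -[1+ 0 ]) &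
   (3 / 0 / false , -[1+ 0 ]) & [])
  (₀ & ₂ & ₁ & ₀ & ₂ & ₁ & ₀ & ₂ & ₁ & ₀ & ₂ & ₁ & ₀ & ₂ & ₁ & ₀ & ₂ & ₁ & ₂ & ₁ & ₀ & ₁ & [] ∷ [])

realise-3-4-3-4² : Realisable ((3 , 1) ∷ (4 , 1) ∷ (3 , 1) ∷ (4 , 2) ∷ [])
realise-3-4-3-4² = viaℤ
  (plan 23 0 (1 & 2 & 3 & [])
    (4 & 3 & 0 & 5 & [] ∷ 6 & 3 & 2 & [] ∷ 7 & 8 & 1 & 2 & [] ∷ 1 & 0 & 9 & [] ∷ 3 & 4 & 8 & [] ∷
     0 & 5 & 10 & [] ∷ 5 & 4 & 6 & [] ∷ 8 & 3 & 6 & 11 & [] ∷ 2 & 6 & 5 & 12 & [] ∷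
     11 & 8 & 1 & [] ∷ 12 & 2 & 7 & [] ∷ 9 & 0 & 10 & 13 & [] ∷ 11 & 1 & 9 & 14 & [] ∷
     8 & 4 & 15 & 7 & [] ∷ 10 & 5 & 12 & 16 & [] ∷ 15 & 4 & 6 & 11 & [] ∷ 17 & 10 & 13 & [] ∷
     13 & 9 & 18 & [] ∷ 14 & 9 & 18 & 19 & [] ∷ 7 & 15 & 20 & [] ∷ 21 & 12 & 16 & [] ∷
     16 & 10 & 17 & 22 & [] ∷ 14 & 11 & 15 & [] ∷ 17 & 13 & 23 & 19 & [] ∷ 22 & 18 & 13 & 23 & [] ∷
     21 & 16 & 18 & 19 & [] ∷ 14 & 15 & 20 & 23 & [] ∷ 12 & 7 & 20 & 21 & [] ∷
     21 & 20 & 22 & 17 & [] ∷ 18 & 16 & 22 & [] ∷ 23 & 14 & 19 & [] ∷ 17 & 21 & 19 & [] ∷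
     20 & 23 & 22 & [] ∷ [])
    (5 / 2 & 8 / 0 & 8 / 3 & 14 / 0 & 14 / 3 & 16 / 3 & 20 / 0 & 23 / 0 & 23 / 1 & 24 / 3 & 27 / 0 &
     28 / 0 & 28 / 1 & 28 / 3 & 29 / 0 & 31 / 1 & 31 / 2 & 32 / 1 & 32 / 2 & [])
    (21 / 0 / false & 11 / 2 / true & 3 / 0 / false & 8 / 3 / true & 13 / 3 / true & 19 / 3 / true &
     26 / 3 / false & []))
  (₀ & ₁ & ₀ & ₁ & ₂ & ₁ & ₀ & ₂ & ₁ & ₀ & ₂ & ₁ & ₂ & ₁ & ₀ & ₁ & ₂ & ₁ & [] ∷ [])

realise-3-4⁴ : Realisable ((3 , 1) ∷ (4 , 4) ∷ [])
realise-3-4⁴ = via𝔻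
  (plan 11 0 (1 & 2 & 3 & [])
    (2 & 4 & 1 & [] ∷ 5 & 6 & 3 & 2 & [] ∷ 7 & 5 & 0 & 1 & [] ∷ 8 & 4 & 2 & 9 & [] ∷
     10 & 4 & 1 & 11 & [] ∷ 9 & 2 & 5 & 7 & [] ∷ 1 & 11 & 6 & 7 & [] ∷ 4 & 8 & 5 & 6 & [] ∷
     9 & 8 & 11 & 3 & [] ∷ 6 & 4 & 10 & 7 & [] ∷ 0 & 8 & 11 & 10 & [] ∷ 7 & 9 & 10 & [] ∷
     6 & 11 & 3 & [] ∷ 5 & 8 & 0 & [] ∷ 0 & 3 & 9 & 10 & [] ∷ [])
    (7 / 2 & 8 / 2 & 8 / 3 & 9 / 3 & 10 / 0 & 11 / 0 & 13 / 0 & 13 / 2 & 14 / 0 & 14 / 2 & 15 / 0 &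
     15 / 1 & [])
    (3 / 1 / true & 2 / 0 / false & 2 / 1 / false & 0 / 3 / false & []))
  ((3 / 2 / true , + 0) & (14 / 0 / false , -[1+ 0 ]) & (6 / 0 / true , + 0) &
   (0 / 2 / true , + 0) & (8 / 0 / false , -[1+ 0 ]) & (11 / 1 / true , -[1+ 0 ]) &
   (2 / 0 / true , + 0) & (15 / 3 / true , -[1+ 0 ]) & (4 / 0 / false , -[1+ 0 ]) &
   (10 / 0 / false , -[1+ 0 ]) & (9 / 0 / false , -[1+ 0 ]) & (5 / 1 / true , -[1+ 0 ]) &
   (13 / 2 / false , -[1+ 0 ]) & (12 / 1 / false , -[1+ 0 ]) & (1 / 0 / false , -[1+ 0 ]) &
   (7 / 3 / true , -[1+ 0 ]) & [])
  (₀ & ₁ & ₀ & ₁ & ₂ & ₁ & ₀ & ₂ & ₁ & ₂ & ₁ & ₀ & ₁ & ₂ & [] ∷ [])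

realise-3-7-3-7 : Realisable ((3 , 1) ∷ (7 , 1) ∷ (3 , 1) ∷ (7 , 1) ∷ [])
realise-3-7-3-7 = viaℤ
  (plan 41 0 (1 & 2 & 3 & 4 & 5 & 6 & [])
    (6 & 0 & 7 & [] ∷ 0 & 1 & 8 & [] ∷ 1 & 2 & 9 & [] ∷ 3 & 2 & 10 & [] ∷ 4 & 3 & 11 & [] ∷
     5 & 4 & 12 & [] ∷ 5 & 13 & 6 & [] ∷ 7 & 14 & 15 & 16 & 17 & 8 & 0 & [] ∷
     6 & 7 & 18 & 19 & 20 & 21 & 13 & [] ∷ 8 & 22 & 23 & 24 & 20 & 9 & 1 & [] ∷
     10 & 25 & 26 & 27 & 21 & 9 & 2 & [] ∷ 11 & 28 & 29 & 30 & 31 & 10 & 3 & [] ∷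
     12 & 16 & 32 & 33 & 34 & 11 & 4 & [] ∷ 13 & 27 & 35 & 22 & 17 & 12 & 5 & [] ∷
     7 & 14 & 18 & [] ∷ 14 & 15 & 36 & [] ∷ 15 & 16 & 32 & [] ∷ 12 & 17 & 16 & [] ∷
     17 & 22 & 8 & [] ∷ 20 & 19 & 24 & [] ∷ 21 & 20 & 9 & [] ∷ 13 & 27 & 21 & [] ∷
     22 & 35 & 23 & [] ∷ 24 & 23 & 37 & [] ∷ 25 & 10 & 31 & [] ∷ 26 & 25 & 38 & [] ∷
     35 & 27 & 26 & [] ∷ 11 & 34 & 28 & [] ∷ 37 & 29 & 30 & [] ∷ 30 & 31 & 39 & [] ∷
     32 & 33 & 39 & [] ∷ 33 & 34 & 40 & [] ∷ 18 & 40 & 34 & 28 & 41 & 36 & 14 & [] ∷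
     36 & 38 & 25 & 31 & 39 & 32 & 15 & [] ∷ 23 & 37 & 29 & 41 & 38 & 26 & 35 & [] ∷
     40 & 33 & 39 & 30 & 37 & 24 & 19 & [] ∷ 28 & 41 & 29 & [] ∷ 41 & 36 & 38 & [] ∷
     18 & 19 & 40 & [] ∷ [])
    (12 / 1 & 12 / 2 & 13 / 4 & 28 / 1 & 28 / 2 & 29 / 0 & 29 / 1 & 32 / 1 & 32 / 2 & 36 / 0 &
     36 / 4 & 36 / 5 & 36 / 6 & 39 / 0 & 39 / 1 & 39 / 2 & [])
    (20 / 1 / false & 24 / 2 / true & 29 / 0 / false & 12 / 1 / true & 28 / 1 / true &
     32 / 1 / false & 33 / 0 / true & 9 / 2 / false & []))
  (₁ & ₀ & ₁ & ₀ & ₁ & ₂ & ₁ & ₀ & ₂ & ₁ & ₀ & ₁ & ₂ & ₁ & ₀ & ₂ & ₁ & ₀ & ₂ & ₁ & ₂ & [] ∷ ₀ & ₁ &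
   ₀ & ₂ & ₁ & ₀ & ₂ & ₁ & ₀ & ₁ & ₂ & ₁ & ₀ & ₂ & ₁ & ₀ & ₁ & ₂ & ₁ & ₀ & ₂ & ₁ & [] ∷ [])

realise-3-4-7-4 : Realisable ((3 , 1) ∷ (4 , 1) ∷ (7 , 1) ∷ (4 , 1) ∷ [])
realise-3-4-7-4 = viaℤ
  (plan 83 0 (1 & 2 & 3 & [])
    (3 & 0 & 4 & [] ∷ 5 & 6 & 7 & 1 & 0 & 8 & 9 & [] ∷ 2 & 10 & 1 & [] ∷
     11 & 12 & 13 & 14 & 2 & 3 & 15 & [] ∷ 0 & 4 & 16 & 8 & [] ∷ 17 & 15 & 3 & 4 & [] ∷
     5 & 18 & 19 & 6 & [] ∷ 7 & 20 & 21 & 6 & [] ∷ 10 & 1 & 7 & 22 & [] ∷ 9 & 23 & 24 & 8 & [] ∷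
     25 & 5 & 9 & 26 & [] ∷ 2 & 10 & 27 & 14 & [] ∷ 11 & 28 & 29 & 12 & [] ∷
     12 & 30 & 31 & 13 & [] ∷ 13 & 32 & 33 & 14 & [] ∷ 34 & 11 & 15 & 35 & [] ∷
     17 & 4 & 16 & 36 & 37 & 38 & 39 & [] ∷ 8 & 24 & 16 & [] ∷ 35 & 17 & 15 & [] ∷
     25 & 5 & 18 & [] ∷ 40 & 41 & 42 & 43 & 44 & 19 & 18 & [] ∷ 6 & 19 & 21 & [] ∷
     7 & 20 & 22 & [] ∷ 20 & 45 & 46 & 47 & 48 & 49 & 21 & [] ∷
     10 & 22 & 50 & 51 & 52 & 53 & 27 & [] ∷ 26 & 9 & 23 & [] ∷
     54 & 55 & 32 & 33 & 56 & 24 & 23 & [] ∷ 34 & 57 & 25 & 26 & 58 & 59 & 35 & [] ∷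
     14 & 33 & 27 & [] ∷ 11 & 28 & 34 & [] ∷ 28 & 60 & 61 & 62 & 63 & 64 & 29 & [] ∷
     12 & 30 & 29 & [] ∷ 30 & 65 & 66 & 67 & 68 & 69 & 31 & [] ∷ 13 & 32 & 31 & [] ∷
     24 & 16 & 36 & 56 & [] ∷ 53 & 36 & 37 & 52 & [] ∷ 38 & 70 & 71 & 37 & [] ∷
     72 & 39 & 38 & 73 & [] ∷ 35 & 17 & 39 & 59 & [] ∷ 57 & 40 & 18 & 25 & [] ∷
     40 & 60 & 61 & 41 & [] ∷ 74 & 41 & 42 & 75 & [] ∷ 43 & 68 & 67 & 42 & [] ∷
     76 & 43 & 44 & 77 & [] ∷ 19 & 21 & 49 & 44 & [] ∷ 20 & 22 & 50 & 45 & [] ∷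
     78 & 48 & 47 & 79 & [] ∷ 77 & 49 & 48 & 80 & [] ∷ 71 & 52 & 51 & 81 & [] ∷
     33 & 27 & 53 & 56 & [] ∷ 58 & 54 & 23 & 26 & [] ∷ 54 & 82 & 83 & 55 & [] ∷
     32 & 31 & 69 & 55 & [] ∷ 28 & 34 & 57 & 60 & [] ∷ 59 & 72 & 82 & 58 & [] ∷
     81 & 62 & 61 & 74 & [] ∷ 50 & 63 & 62 & 51 & [] ∷ 63 & 45 & 46 & 64 & [] ∷
     30 & 29 & 64 & 65 & [] ∷ 46 & 65 & 66 & 47 & [] ∷ 67 & 75 & 79 & 66 & [] ∷
     69 & 83 & 76 & 68 & [] ∷ 56 & 53 & 36 & [] ∷ 37 & 71 & 52 & [] ∷ 38 & 70 & 73 & [] ∷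
     70 & 78 & 79 & 75 & 74 & 81 & 71 & [] ∷ 59 & 72 & 39 & [] ∷
     72 & 73 & 80 & 77 & 76 & 83 & 82 & [] ∷ 57 & 40 & 60 & [] ∷ 61 & 74 & 41 & [] ∷
     42 & 67 & 75 & [] ∷ 76 & 43 & 68 & [] ∷ 77 & 49 & 44 & [] ∷ 80 & 78 & 48 & [] ∷
     58 & 54 & 82 & [] ∷ 55 & 69 & 83 & [] ∷ 51 & 81 & 62 & [] ∷ 50 & 63 & 45 & [] ∷
     64 & 46 & 65 & [] ∷ 66 & 47 & 79 & [] ∷ 70 & 73 & 80 & 78 & [] ∷ [])
    (42 / 0 & 42 / 3 & 56 / 0 & 56 / 3 & 57 / 0 & 57 / 3 & 58 / 1 & 58 / 2 & 60 / 0 & 60 / 3 &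
     61 / 1 & 61 / 2 & 70 / 1 & 71 / 2 & 77 / 0 & 77 / 1 & 78 / 0 & 78 / 2 & 79 / 1 & 80 / 1 &
     80 / 2 & [])
    (25 / 2 / true & 46 / 2 / false & 24 / 1 / false & 24 / 2 / false & 47 / 2 / false &
     61 / 1 / true & 42 / 3 / false & 56 / 3 / false & 49 / 2 / true & []))
  (₀ & ₁ & ₀ & ₁ & ₂ & ₁ & ₀ & ₁ & ₂ & ₁ & ₀ & ₁ & ₂ & ₁ & ₀ & ₁ & ₀ & ₁ & ₂ & ₁ & ₀ & ₁ & ₂ & ₁ & ₀
   & ₁ & ₂ & [] ∷ ₁ & ₀ & ₁ & ₂ & ₁ & ₀ & ₁ & ₀ & ₂ & ₁ & ₀ & ₁ & ₂ & ₁ & ₀ & ₁ & ₀ & ₁ & ₀ & ₂ & ₁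
   & ₀ & ₁ & ₂ & ₁ & ₀ & ₁ & ₀ & ₁ & ₂ & [] ∷ [])

realise-3-4-8-4 : Realisable ((3 , 1) ∷ (4 , 1) ∷ (8 , 1) ∷ (4 , 1) ∷ [])
realise-3-4-8-4 = viaℤ
  (plan 47 0 (1 & 2 & 3 & [])
    (4 & 3 & 0 & [] ∷ 5 & 6 & 7 & 8 & 9 & 1 & 0 & 10 & [] ∷ 2 & 11 & 1 & [] ∷
     12 & 13 & 14 & 15 & 16 & 17 & 3 & 2 & [] ∷ 4 & 3 & 17 & 18 & [] ∷ 0 & 4 & 19 & 10 & [] ∷
     12 & 5 & 6 & 13 & [] ∷ 20 & 6 & 7 & 21 & [] ∷ 8 & 18 & 22 & 7 & [] ∷ 17 & 8 & 9 & 16 & [] ∷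
     9 & 23 & 11 & 1 & [] ∷ 5 & 24 & 25 & 10 & [] ∷ 24 & 12 & 2 & 11 & [] ∷ 26 & 14 & 13 & 20 & [] ∷
     14 & 27 & 28 & 15 & [] ∷ 23 & 16 & 15 & 29 & [] ∷ 17 & 8 & 18 & [] ∷
     4 & 18 & 22 & 30 & 31 & 32 & 33 & 19 & [] ∷ 10 & 25 & 19 & [] ∷ 24 & 12 & 5 & [] ∷
     6 & 13 & 20 & [] ∷ 22 & 7 & 21 & [] ∷ 26 & 20 & 21 & 34 & 35 & 36 & 37 & 38 & [] ∷
     9 & 23 & 16 & [] ∷ 24 & 11 & 23 & 29 & 39 & 40 & 41 & 25 & [] ∷ 27 & 26 & 14 & [] ∷
     29 & 28 & 15 & [] ∷ 34 & 30 & 22 & 21 & [] ∷ 30 & 42 & 43 & 31 & [] ∷ 25 & 19 & 33 & 41 & [] ∷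
     35 & 44 & 42 & 34 & [] ∷ 40 & 35 & 36 & 39 & [] ∷ 36 & 45 & 43 & 37 & [] ∷
     32 & 38 & 37 & 31 & [] ∷ 27 & 26 & 38 & 46 & [] ∷ 29 & 28 & 45 & 39 & [] ∷
     44 & 40 & 41 & 47 & [] ∷ 30 & 42 & 34 & [] ∷ 27 & 46 & 47 & 44 & 42 & 43 & 45 & 28 & [] ∷
     47 & 33 & 41 & [] ∷ 35 & 44 & 40 & [] ∷ 45 & 39 & 36 & [] ∷ 37 & 31 & 43 & [] ∷
     46 & 32 & 38 & [] ∷ 47 & 33 & 32 & 46 & [] ∷ [])
    (18 / 4 & 18 / 5 & 18 / 6 & 29 / 2 & 29 / 3 & 30 / 2 & 37 / 3 & 39 / 0 & 39 / 1 & 39 / 2 &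
     39 / 5 & 39 / 6 & 39 / 7 & 40 / 0 & 40 / 1 & [])
    (33 / 1 / false & 29 / 2 / false & 18 / 4 / false & 18 / 5 / false & 40 / 0 / true &
     39 / 1 / true & 35 / 3 / false & 15 / 1 / false & 36 / 1 / false & []))
  (₀ & ₂ & ₁ & ₀ & ₁ & ₀ & ₂ & ₁ & ₀ & ₁ & ₂ & ₁ & ₀ & ₁ & ₂ & ₁ & ₀ & ₁ & [] ∷ ₀ & ₁ & ₀ & ₁ & ₂ &
   ₁ & ₀ & ₁ & ₂ & ₁ & ₀ & ₁ & ₂ & ₁ & ₀ & ₁ & ₀ & ₁ & ₂ & [] ∷ [])

realise-4³-5 : Realisable ((4 , 3) ∷ (5 , 1) ∷ [])
realise-4³-5 = viaℤ
  (plan 39 0 (1 & 2 & 3 & [])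
    (4 & 5 & 2 & 1 & [] ∷ 1 & 0 & 6 & 7 & 8 & [] ∷ 9 & 10 & 0 & 3 & [] ∷ 11 & 2 & 3 & 12 & 13 & [] ∷
     4 & 5 & 14 & 15 & [] ∷ 11 & 16 & 5 & 2 & [] ∷ 1 & 4 & 17 & 8 & [] ∷ 6 & 18 & 10 & 0 & [] ∷
     19 & 6 & 7 & 20 & [] ∷ 8 & 12 & 13 & 7 & [] ∷ 9 & 10 & 21 & 22 & [] ∷ 3 & 9 & 23 & 12 & [] ∷
     24 & 11 & 13 & 25 & [] ∷ 16 & 26 & 27 & 14 & 5 & [] ∷ 28 & 29 & 14 & 15 & [] ∷
     4 & 15 & 30 & 31 & 17 & [] ∷ 8 & 12 & 23 & 17 & [] ∷ 18 & 31 & 19 & 6 & [] ∷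
     18 & 32 & 33 & 21 & 10 & [] ∷ 7 & 20 & 25 & 13 & [] ∷ 19 & 20 & 22 & 9 & 23 & [] ∷
     21 & 34 & 35 & 22 & [] ∷ 24 & 36 & 29 & 35 & 25 & [] ∷ 27 & 36 & 29 & 14 & [] ∷
     34 & 35 & 29 & 28 & [] ∷ 15 & 28 & 37 & 30 & [] ∷ 18 & 31 & 30 & 32 & [] ∷
     31 & 19 & 23 & 17 & [] ∷ 33 & 27 & 26 & 32 & [] ∷ 38 & 33 & 21 & 34 & [] ∷
     35 & 22 & 20 & 25 & [] ∷ 39 & 38 & 34 & 28 & 37 & [] ∷ 26 & 32 & 30 & 37 & [] ∷
     38 & 33 & 27 & 36 & [] ∷ 39 & 24 & 36 & 38 & [] ∷ 16 & 39 & 37 & 26 & [] ∷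
     11 & 16 & 39 & 24 & [] ∷ [])
    (29 / 1 & 29 / 2 & 33 / 0 & 34 / 2 & 34 / 3 & 35 / 1 & 35 / 2 & 36 / 0 & 36 / 3 & 37 / 0 &
     37 / 1 & 37 / 3 & [])
    (13 / 0 / false & 6 / 0 / false & 14 / 0 / false & 14 / 1 / false & 24 / 0 / false &
     23 / 0 / true & []))
  (₀ & ₂ & ₁ & ₀ & ₁ & ₂ & ₁ & ₀ & ₁ & ₂ & ₁ & ₀ & ₁ & ₂ & ₁ & ₀ & ₁ & [] ∷ ₁ & ₀ & ₂ & ₁ & ₀ & ₂ &
   ₁ & ₀ & ₂ & ₁ & ₀ & ₁ & ₂ & ₁ & ₀ & ₁ & ₂ & ₁ & ₀ & ₁ & ₂ & [] ∷ [])

realise-3-4-9-4 : Realisable ((3 , 1) ∷ (4 , 1) ∷ (9 , 1) ∷ (4 , 1) ∷ [])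
realise-3-4-9-4 = viaℤ
  (plan 35 0 (1 & 2 & [])
    (3 & 4 & 2 & 0 & [] ∷ 1 & 2 & 5 & 6 & [] ∷ 4 & 7 & 3 & [] ∷
     8 & 5 & 2 & 4 & 9 & 10 & 11 & 12 & 13 & [] ∷ 14 & 3 & 0 & 15 & 16 & 17 & 18 & 19 & 20 & [] ∷
     6 & 5 & 20 & [] ∷ 4 & 7 & 21 & 9 & [] ∷ 14 & 22 & 7 & 3 & [] ∷ 8 & 14 & 20 & 5 & [] ∷
     23 & 10 & 9 & 24 & [] ∷ 25 & 11 & 10 & 26 & [] ∷ 11 & 27 & 28 & 12 & [] ∷
     17 & 12 & 13 & 16 & [] ∷ 22 & 8 & 13 & 29 & [] ∷ 19 & 30 & 6 & 20 & [] ∷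
     22 & 7 & 21 & 31 & 32 & 25 & 26 & 33 & 29 & [] ∷ 21 & 24 & 9 & [] ∷ 8 & 14 & 22 & [] ∷
     10 & 26 & 23 & [] ∷ 34 & 24 & 23 & 35 & 1 & 6 & 30 & 27 & 28 & [] ∷ 11 & 27 & 25 & [] ∷
     28 & 17 & 12 & [] ∷ 13 & 29 & 16 & [] ∷ 34 & 31 & 21 & 24 & [] ∷ 31 & 18 & 19 & 32 & [] ∷
     27 & 25 & 32 & 30 & [] ∷ 26 & 23 & 35 & 33 & [] ∷ 29 & 16 & 15 & 33 & [] ∷
     0 & 1 & 35 & 15 & [] ∷ 18 & 34 & 28 & 17 & [] ∷ 34 & 31 & 18 & [] ∷ 32 & 19 & 30 & [] ∷
     35 & 33 & 15 & [] ∷ [])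
    (13 / 0 & 13 / 3 & 20 / 4 & 20 / 5 & 20 / 6 & 22 / 1 & 23 / 2 & 25 / 1 & 25 / 2 & 26 / 3 &
     28 / 1 & 28 / 2 & 29 / 0 & 29 / 1 & 29 / 3 & 30 / 0 & 30 / 3 & 31 / 2 & 32 / 1 & 32 / 2 &
     33 / 2 & [])
    (5 / 6 / true & 5 / 5 / true & 5 / 4 / true & 5 / 3 / true & 5 / 2 / true & 0 / 0 / false &
     2 / 3 / true & 15 / 1 / true & 15 / 0 / true & []))
  (₀ & ₁ & ₂ & ₁ & ₀ & ₂ & ₁ & ₀ & ₁ & ₀ & ₁ & ₀ & ₁ & ₂ & ₁ & ₀ & ₁ & ₂ & ₁ & ₀ & ₁ & ₀ & ₁ & ₀ & ₂
   & ₁ & ₂ & [] ∷ [])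

realise-3-4-10-4 : Realisable ((3 , 1) ∷ (4 , 1) ∷ (10 , 1) ∷ (4 , 1) ∷ [])
realise-3-4-10-4 = viaℤ
  (plan 29 0 (1 & 2 & 3 & [])
    (1 & 4 & 0 & [] ∷ 5 & 6 & 7 & 8 & 9 & 10 & 2 & 1 & 11 & 12 & [] ∷ 13 & 3 & 2 & [] ∷
     14 & 15 & 16 & 17 & 18 & 19 & 20 & 3 & 0 & 21 & [] ∷ 1 & 4 & 22 & 11 & [] ∷
     4 & 0 & 21 & 23 & [] ∷ 5 & 14 & 21 & 6 & [] ∷ 23 & 6 & 7 & 24 & [] ∷ 8 & 16 & 15 & 7 & [] ∷
     9 & 25 & 26 & 8 & [] ∷ 19 & 10 & 9 & 20 & [] ∷ 10 & 27 & 13 & 2 & [] ∷ 12 & 17 & 18 & 11 & [] ∷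
     13 & 3 & 20 & 25 & [] ∷ 27 & 19 & 18 & 22 & [] ∷
     28 & 24 & 23 & 4 & 22 & 27 & 13 & 25 & 26 & 29 & [] ∷ 18 & 22 & 11 & [] ∷ 6 & 21 & 23 & [] ∷
     15 & 24 & 7 & [] ∷ 16 & 26 & 8 & [] ∷ 25 & 20 & 9 & [] ∷ 27 & 19 & 10 & [] ∷
     14 & 28 & 24 & 15 & [] ∷ 16 & 26 & 29 & 17 & [] ∷ 28 & 5 & 12 & 29 & [] ∷ 5 & 14 & 28 & [] ∷
     17 & 29 & 12 & [] ∷ [])
    (9 / 1 & 9 / 2 & 19 / 0 & 20 / 0 & 23 / 0 & 23 / 3 & 24 / 0 & 24 / 3 & 25 / 1 & 25 / 2 &
     26 / 0 & 26 / 1 & 27 / 0 & 27 / 2 & [])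
    (2 / 9 / true & 13 / 0 / false & 4 / 2 / true & 4 / 1 / true & 4 / 0 / true & 7 / 0 / true & []))
  (₀ & ₁ & ₀ & ₂ & ₁ & ₀ & ₁ & ₀ & ₂ & ₁ & ₀ & ₁ & ₂ & ₁ & ₀ & ₁ & ₀ & ₂ & ₁ & [] ∷ ₀ & ₁ & ₂ & ₁ &
   ₀ & ₁ & ₀ & ₁ & ₀ & ₁ & ₀ & ₂ & ₁ & ₀ & ₁ & ₂ & ₁ & ₀ & ₁ & ₂ & ₁ & [] ∷ [])

realise-3-5³ : Realisable ((3 , 1) ∷ (5 , 3) ∷ [])
realise-3-5³ = viaℤ
  (plan 29 0 (1 & 2 & 3 & 4 & [])
    (2 & 5 & 6 & 7 & 3 & [] ∷ 8 & 9 & 10 & 3 & 4 & [] ∷ 11 & 4 & 0 & 12 & 13 & [] ∷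
     7 & 6 & 1 & 0 & 14 & [] ∷ 15 & 2 & 1 & [] ∷ 16 & 5 & 2 & 15 & 17 & [] ∷ 9 & 5 & 6 & [] ∷
     3 & 10 & 7 & [] ∷ 6 & 9 & 8 & 15 & 1 & [] ∷ 5 & 9 & 10 & 18 & 16 & [] ∷ 4 & 8 & 11 & [] ∷
     14 & 0 & 12 & [] ∷ 13 & 11 & 19 & 20 & 21 & [] ∷ 7 & 10 & 18 & 22 & 14 & [] ∷
     8 & 15 & 17 & 19 & 11 & [] ∷ 23 & 16 & 17 & [] ∷ 16 & 18 & 24 & 25 & 23 & [] ∷
     26 & 19 & 20 & [] ∷ 27 & 22 & 24 & 20 & 21 & [] ∷ 22 & 18 & 24 & [] ∷
     19 & 17 & 23 & 28 & 26 & [] ∷ 26 & 20 & 24 & 25 & 29 & [] ∷ 25 & 27 & 21 & 28 & 23 & [] ∷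
     29 & 12 & 13 & 28 & 26 & [] ∷ 25 & 29 & 27 & [] ∷ 21 & 13 & 28 & [] ∷
     22 & 14 & 12 & 29 & 27 & [] ∷ [])
    (23 / 1 & 23 / 2 & 24 / 1 & 24 / 2 & 25 / 2 & 26 / 0 & 26 / 1 & 27 / 0 & 27 / 1 & 27 / 2 &
     27 / 4 & [])
    (14 / 3 / false & 12 / 2 / true & 3 / 3 / false & 13 / 4 / true & 19 / 4 / false &
     19 / 0 / false & []))
  (₀ & ₁ & ₀ & ₂ & ₁ & ₀ & ₁ & ₀ & ₁ & ₂ & ₁ & ₀ & [] ∷ ₀ & ₁ & ₀ & ₁ & ₀ & ₂ & ₁ & ₀ & ₁ & ₀ & ₂ &
   ₁ & ₀ & ₁ & ₀ & ₂ & [] ∷ [])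

realise-3-6-4-6 : Realisable ((3 , 1) ∷ (6 , 1) ∷ (4 , 1) ∷ (6 , 1) ∷ [])
realise-3-6-4-6 = viaℤ
  (plan 23 0 (1 & 2 & 3 & 4 & 5 & [])
    (4 & 6 & 7 & 5 & [] ∷ 8 & 4 & 3 & [] ∷ 9 & 3 & 2 & 10 & [] ∷ 1 & 2 & 11 & [] ∷
     12 & 1 & 0 & 13 & [] ∷ 14 & 5 & 0 & [] ∷ 6 & 4 & 8 & 15 & 16 & 17 & [] ∷
     18 & 6 & 7 & 12 & 1 & 11 & [] ∷ 9 & 7 & 5 & 14 & 19 & 10 & [] ∷ 3 & 8 & 20 & 13 & 12 & 9 & [] ∷
     14 & 16 & 21 & 22 & 13 & 0 & [] ∷ 15 & 8 & 20 & 23 & [] ∷ 16 & 15 & 21 & [] ∷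
     16 & 17 & 19 & 14 & [] ∷ 17 & 6 & 18 & [] ∷ 9 & 12 & 7 & [] ∷ 19 & 23 & 10 & [] ∷
     22 & 20 & 13 & [] ∷ 18 & 11 & 21 & 22 & [] ∷ 22 & 18 & 17 & 19 & 23 & 20 & [] ∷
     23 & 15 & 21 & 11 & 2 & 10 & [] ∷ [])
    (0 / 2 & 3 / 2 & 3 / 3 & 4 / 1 & 4 / 2 & 7 / 5 & 8 / 0 & 8 / 5 & 9 / 4 & 9 / 5 & 14 / 1 &
     14 / 2 & 15 / 0 & 15 / 2 & 17 / 0 & 17 / 1 & 17 / 2 & [])
    (17 / 0 / true & 14 / 1 / true & 15 / 2 / true & 8 / 5 / true & 4 / 1 / true & 3 / 2 / false &
     17 / 1 / true & []))
  (₀ & ₂ & ₁ & ₀ & ₂ & ₁ & ₀ & ₁ & ₂ & ₁ & ₀ & ₁ & ₂ & ₁ & ₀ & ₁ & [] ∷ ₁ & ₀ & ₁ & ₀ & ₂ & ₁ & ₀ &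
   ₂ & ₁ & ₀ & ₁ & ₀ & ₂ & ₁ & ₀ & ₂ & ₁ & ₀ & ₁ & ₂ & ₁ & ₂ & [] ∷ [])

realise-4-6-18 : Realisable ((4 , 1) ∷ (6 , 1) ∷ (18 , 1) ∷ [])
realise-4-6-18 = viaℤ
  (plan 71 0 (1 & 2 & 3 & 4 & 5 & [])
    (6 & 7 & 4 & 3 & [] ∷
     8 & 9 & 10 & 7 & 4 & 5 & 11 & 12 & 13 & 14 & 15 & 16 & 17 & 18 & 19 & 20 & 21 & 22 & [] ∷
     11 & 23 & 0 & 5 & [] ∷
     24 & 25 & 26 & 27 & 28 & 29 & 30 & 31 & 32 & 23 & 0 & 1 & 33 & 34 & 35 & 36 & 37 & 38 & [] ∷
     1 & 2 & 39 & 33 & [] ∷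
     40 & 41 & 42 & 43 & 44 & 45 & 46 & 6 & 3 & 2 & 39 & 47 & 48 & 49 & 50 & 51 & 52 & 53 & [] ∷
     54 & 46 & 6 & 7 & 10 & 55 & [] ∷ 24 & 8 & 9 & 56 & 57 & 25 & [] ∷ 9 & 56 & 55 & 10 & [] ∷
     50 & 12 & 11 & 23 & 32 & 51 & [] ∷ 50 & 12 & 13 & 49 & [] ∷ 48 & 58 & 59 & 14 & 13 & 49 & [] ∷
     15 & 60 & 59 & 14 & [] ∷ 27 & 16 & 15 & 60 & 61 & 26 & [] ∷ 27 & 16 & 17 & 28 & [] ∷
     62 & 18 & 17 & 28 & 29 & 63 & [] ∷ 19 & 64 & 62 & 18 & [] ∷ 44 & 20 & 19 & 64 & 65 & 45 & [] ∷
     44 & 20 & 21 & 43 & [] ∷ 38 & 22 & 21 & 43 & 42 & 37 & [] ∷ 24 & 8 & 22 & 38 & [] ∷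
     57 & 25 & 26 & 61 & [] ∷ 30 & 66 & 63 & 29 & [] ∷ 67 & 53 & 52 & 31 & 30 & 66 & [] ∷
     32 & 51 & 52 & 31 & [] ∷ 47 & 68 & 69 & 34 & 33 & 39 & [] ∷ 70 & 35 & 34 & 69 & [] ∷
     40 & 71 & 70 & 35 & 36 & 41 & [] ∷ 36 & 41 & 42 & 37 & [] ∷ 65 & 45 & 46 & 54 & [] ∷
     56 & 57 & 61 & 60 & 59 & 58 & 68 & 69 & 70 & 71 & 67 & 66 & 63 & 62 & 64 & 65 & 54 & 55 & [] ∷
     48 & 58 & 68 & 47 & [] ∷ 40 & 71 & 67 & 53 & [] ∷ [])
    (10 / 0 & 10 / 5 & 11 / 0 & 11 / 3 & 12 / 0 & 12 / 5 & 24 / 1 & 24 / 2 & 25 / 1 & 25 / 2 &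
     31 / 6 & 31 / 7 & 31 / 8 & 31 / 9 & 32 / 0 & 32 / 2 & 32 / 3 & 33 / 0 & 33 / 1 & 33 / 3 & [])
    (6 / 15 / false & 6 / 16 / false & 6 / 17 / false & 28 / 0 / false & 28 / 1 / false &
     27 / 3 / true & 26 / 1 / true & 26 / 0 / true & 6 / 11 / false & 6 / 12 / false &
     6 / 13 / false & 6 / 14 / false & []))
  -- The first word goes once round a hexagon and therefore moves all flags of 4-gons and 18-gons.
  (₀ & ₁ & ₀ & ₁ & ₀ & ₁ & ₀ & ₁ & ₀ & ₁ & ₀ & ₁ & [] ∷ ₀ & ₂ & ₁ & ₀ & ₁ & ₀ & ₁ & ₀ & ₁ & ₀ & ₁ &
   ₀ & ₁ & ₀ & ₁ & ₀ & ₁ & ₂ & ₁ & ₀ & ₁ & ₀ & ₂ & ₁ & ₀ & ₁ & ₀ & ₁ & ₀ & ₁ & ₀ & ₂ & ₁ & ₀ & ₁ &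
   [] ∷ [])

realise-4³-6 : Realisable ((4 , 3) ∷ (6 , 1) ∷ [])
realise-4³-6 = via𝔻
  (plan 23 0 (1 & 2 & 3 & 4 & 5 & [])
    (1 & 6 & 7 & 0 & [] ∷ 0 & 8 & 9 & 5 & [] ∷ 10 & 4 & 5 & 11 & [] ∷ 3 & 12 & 13 & 4 & [] ∷
     14 & 2 & 3 & 15 & [] ∷ 16 & 1 & 2 & 17 & [] ∷ 1 & 6 & 18 & 16 & [] ∷
     6 & 14 & 15 & 10 & 11 & 7 & [] ∷ 7 & 0 & 8 & 19 & [] ∷ 18 & 8 & 9 & 20 & 21 & 22 & [] ∷
     23 & 9 & 5 & 11 & [] ∷ 13 & 21 & 10 & 4 & [] ∷ 20 & 15 & 3 & 12 & [] ∷
     16 & 19 & 23 & 12 & 13 & 17 & [] ∷ 22 & 14 & 2 & 17 & [] ∷ 6 & 18 & 22 & 14 & [] ∷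
     18 & 16 & 19 & 8 & [] ∷ 20 & 15 & 10 & 21 & [] ∷ 19 & 7 & 11 & 23 & [] ∷
     17 & 22 & 21 & 13 & [] ∷ 12 & 20 & 9 & 23 & [] ∷ [])
    (8 / 3 & 8 / 4 & 13 / 0 & 14 / 2 & 18 / 0 & 18 / 2 & 18 / 3 & 19 / 2 & 19 / 3 & 21 / 1 &
     21 / 2 & 21 / 3 & [])
    (10 / 3 / true & 10 / 2 / true & 11 / 0 / true & 11 / 3 / true & 3 / 3 / false & 12 / 1 / true &
     []))
  ((14 / 0 / true , + 0) & (17 / 0 / true , + 0) & (19 / 0 / false , + 0) & (21 / 0 / true , + 0) &
   (4 / 2 / false , + 0) & (20 / 0 / true , + 0) & (6 / 0 / true , + 0) & (7 / 2 / true , + 0) &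
   (10 / 5 / true , + 0) & (9 / 2 / false , + 0) & (8 / 5 / true , + 0) & (11 / 2 / false , + 1) &
   (13 / 1 / true , + 0) & (12 / 1 / true , + 0) & (0 / 0 / true , + 0) & (15 / 0 / true , + 0) &
   (16 / 0 / true , + 0) & (1 / 0 / true , + 0) & (18 / 2 / false , -[1+ 0 ]) &
   (2 / 0 / false , + 0) & (5 / 0 / true , + 0) & (3 / 0 / true , + 0) & [])
  (₀ & ₁ & ₀ & ₂ & ₁ & ₀ & ₁ & ₂ & ₁ & ₀ & ₁ & ₂ & ₁ & ₀ & ₁ & ₂ & ₁ & ₀ & ₁ & ₀ & ₁ & [] ∷ [])

realise-5-4-5-4 : Realisable ((5 , 1) ∷ (4 , 1) ∷ (5 , 1) ∷ (4 , 1) ∷ [])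
realise-5-4-5-4 = viaℤ
  (plan 19 0 (1 & 2 & 3 & 4 & [])
    (1 & 5 & 6 & 0 & [] ∷ 1 & 2 & 7 & 8 & [] ∷ 9 & 2 & 3 & 10 & [] ∷ 11 & 12 & 3 & 4 & [] ∷
     4 & 0 & 13 & 14 & [] ∷ 15 & 5 & 1 & 8 & 16 & [] ∷ 14 & 5 & 6 & 11 & 4 & [] ∷
     13 & 7 & 8 & 6 & 0 & [] ∷ 17 & 9 & 2 & 7 & 18 & [] ∷ 15 & 10 & 3 & 12 & 17 & [] ∷
     14 & 10 & 9 & 19 & 13 & [] ∷ 14 & 10 & 15 & 5 & [] ∷ 16 & 8 & 6 & 11 & [] ∷
     16 & 18 & 17 & 15 & [] ∷ 7 & 13 & 19 & 18 & [] ∷ 9 & 19 & 12 & 17 & [] ∷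
     18 & 19 & 12 & 11 & 16 & [] ∷ [])
    (4 / 0 & 4 / 1 & 6 / 4 & 7 / 3 & 10 / 3 & 10 / 4 & 13 / 0 & 13 / 3 & 14 / 0 & 14 / 1 & 14 / 2 &
     [])
    (14 / 0 / true & 13 / 3 / true & 4 / 0 / false & 10 / 3 / false & 9 / 4 / true & []))
  (₀ & ₁ & ₂ & ₁ & ₀ & ₁ & ₂ & ₁ & ₀ & ₁ & ₀ & ₂ & ₁ & ₂ & [] ∷ ₀ & ₂ & ₁ & ₀ & ₁ & ₂ & ₁ & ₀ & ₁ &
   ₀ & ₂ & ₁ & ₀ & ₂ & ₁ & [] ∷ [])

realise-4-6-14 : Realisable ((4 , 1) ∷ (6 , 1) ∷ (14 , 1) ∷ [])
realise-4-6-14 = viaℤ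
  -- The sum 1/4 + 1/6 + 1/14 falls short of 1/2 by only 1/84, so this K is the largest of all, with
  -- 168 vertices.
  (plan 167 0 (1 & 2 & 3 & [])
    (4 & 5 & 1 & 2 & 6 & 7 & [] ∷
     2 & 6 & 8 & 9 & 10 & 11 & 12 & 13 & 14 & 15 & 16 & 17 & 18 & 3 & [] ∷
     3 & 0 & 19 & 20 & 21 & 18 & [] ∷
     22 & 23 & 24 & 25 & 26 & 27 & 28 & 29 & 19 & 0 & 1 & 5 & 30 & 31 & [] ∷ 30 & 32 & 4 & 5 & [] ∷
     6 & 7 & 33 & 8 & [] ∷ 32 & 34 & 35 & 36 & 37 & 38 & 39 & 40 & 41 & 42 & 43 & 33 & 7 & 4 & [] ∷
     33 & 8 & 9 & 44 & 45 & 43 & [] ∷ 9 & 44 & 46 & 10 & [] ∷ 46 & 10 & 11 & 47 & 48 & 49 & [] ∷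
     11 & 47 & 50 & 12 & [] ∷ 51 & 13 & 12 & 50 & 52 & 53 & [] ∷ 14 & 54 & 51 & 13 & [] ∷
     55 & 56 & 57 & 15 & 14 & 54 & [] ∷ 57 & 15 & 16 & 58 & [] ∷ 16 & 58 & 59 & 60 & 61 & 17 & [] ∷
     21 & 18 & 17 & 61 & [] ∷ 19 & 20 & 62 & 29 & [] ∷
     20 & 21 & 61 & 60 & 63 & 64 & 65 & 66 & 67 & 68 & 69 & 70 & 71 & 62 & [] ∷
     22 & 72 & 73 & 74 & 75 & 23 & [] ∷ 75 & 23 & 24 & 76 & [] ∷ 76 & 24 & 25 & 77 & 78 & 79 & [] ∷
     25 & 77 & 80 & 26 & [] ∷ 81 & 27 & 26 & 80 & 82 & 83 & [] ∷ 28 & 84 & 81 & 27 & [] ∷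
     62 & 29 & 28 & 84 & 85 & 71 & [] ∷ 86 & 31 & 30 & 32 & 34 & 87 & [] ∷ 22 & 72 & 86 & 31 & [] ∷
     34 & 87 & 88 & 35 & [] ∷ 35 & 88 & 89 & 90 & 91 & 36 & [] ∷ 91 & 36 & 37 & 92 & [] ∷
     37 & 92 & 93 & 94 & 95 & 38 & [] ∷ 95 & 38 & 39 & 96 & [] ∷ 41 & 97 & 98 & 40 & [] ∷
     99 & 100 & 101 & 42 & 41 & 97 & [] ∷ 45 & 43 & 42 & 101 & [] ∷
     44 & 45 & 101 & 100 & 102 & 103 & 104 & 105 & 106 & 107 & 108 & 109 & 49 & 46 & [] ∷
     77 & 78 & 110 & 111 & 112 & 113 & 114 & 115 & 48 & 47 & 50 & 52 & 82 & 80 & [] ∷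
     48 & 49 & 109 & 115 & [] ∷ 82 & 83 & 53 & 52 & [] ∷
     84 & 85 & 116 & 117 & 118 & 119 & 120 & 121 & 55 & 54 & 51 & 53 & 83 & 81 & [] ∷
     122 & 121 & 55 & 56 & [] ∷
     72 & 73 & 123 & 122 & 56 & 57 & 58 & 59 & 124 & 125 & 89 & 88 & 87 & 86 & [] ∷
     124 & 63 & 60 & 59 & [] ∷ 126 & 125 & 124 & 63 & 64 & 127 & [] ∷ 64 & 127 & 128 & 65 & [] ∷
     128 & 65 & 66 & 129 & 130 & 131 & [] ∷ 66 & 129 & 132 & 67 & [] ∷
     132 & 67 & 68 & 133 & 134 & 135 & [] ∷ 136 & 69 & 68 & 133 & [] ∷
     70 & 116 & 117 & 137 & 136 & 69 & [] ∷ 85 & 71 & 70 & 116 & [] ∷ 73 & 74 & 138 & 123 & [] ∷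
     74 & 75 & 76 & 79 & 139 & 140 & 141 & 142 & 143 & 144 & 145 & 146 & 147 & 138 & [] ∷
     78 & 79 & 139 & 110 & [] ∷ 89 & 90 & 126 & 125 & [] ∷
     90 & 91 & 92 & 93 & 148 & 149 & 150 & 151 & 152 & 153 & 131 & 128 & 127 & 126 & [] ∷
     93 & 94 & 154 & 148 & [] ∷ 155 & 102 & 100 & 99 & [] ∷ 154 & 148 & 149 & 107 & 106 & 156 & [] ∷
     150 & 108 & 107 & 149 & [] ∷ 109 & 115 & 114 & 151 & 150 & 108 & [] ∷
     110 & 139 & 140 & 157 & 158 & 111 & [] ∷ 158 & 111 & 112 & 159 & [] ∷
     152 & 113 & 112 & 159 & 160 & 153 & [] ∷ 114 & 151 & 152 & 113 & [] ∷
     118 & 161 & 137 & 117 & [] ∷ 146 & 119 & 118 & 161 & 162 & 145 & [] ∷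
     120 & 147 & 146 & 119 & [] ∷ 138 & 123 & 122 & 121 & 120 & 147 & [] ∷
     129 & 130 & 160 & 159 & 158 & 157 & 163 & 155 & 99 & 97 & 98 & 164 & 135 & 132 & [] ∷
     130 & 131 & 153 & 160 & [] ∷
     161 & 162 & 165 & 166 & 156 & 154 & 94 & 95 & 96 & 167 & 134 & 133 & 136 & 137 & [] ∷
     134 & 135 & 164 & 167 & [] ∷ 140 & 157 & 163 & 141 & [] ∷
     103 & 142 & 141 & 163 & 155 & 102 & [] ∷ 143 & 104 & 103 & 142 & [] ∷
     165 & 144 & 143 & 104 & 105 & 166 & [] ∷ 162 & 145 & 144 & 165 & [] ∷
     98 & 40 & 39 & 96 & 167 & 164 & [] ∷ 105 & 166 & 156 & 106 & [] ∷ [])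
    (71 / 7 & 71 / 8 & 71 / 9 & 71 / 10 & 73 / 4 & 73 / 5 & 73 / 6 & 73 / 7 & 73 / 8 & 76 / 0 &
     76 / 4 & 76 / 5 & 77 / 1 & 77 / 2 & 78 / 3 & 78 / 4 & 80 / 0 & 80 / 1 & 80 / 2 & 80 / 3 &
     81 / 0 & 81 / 2 & 81 / 3 & [])
    (34 / 1 / true & 35 / 5 / false & 59 / 3 / false & 59 / 0 / false & 37 / 4 / false &
     37 / 5 / false & 37 / 6 / false & 37 / 7 / false & 60 / 4 / false & 60 / 5 / false &
     58 / 1 / true & 32 / 3 / false & 33 / 3 / true & 33 / 2 / true & 7 / 6 / false &
     34 / 2 / true & []))
  (₀ & ₂ & ₁ & ₀ & ₁ & ₀ & ₁ & ₀ & ₂ & ₁ & ₀ & ₁ & ₀ & ₂ & ₁ & ₀ & ₁ & ₀ & ₁ & ₀ & ₁ & ₀ & ₁ & ₀ & ₁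
   & ₀ & ₂ & ₁ & ₀ & ₁ & ₀ & ₂ & ₁ & ₀ & ₁ & ₀ & ₁ & ₂ & ₁ & ₀ & ₁ & [] ∷ ₁ & ₀ & ₁ & ₂ & ₁ & ₀ & ₁
   & ₀ & ₁ & ₀ & ₁ & ₀ & ₁ & ₀ & ₁ & ₀ & ₁ & ₂ & ₁ & ₀ & ₁ & ₀ & ₂ & ₁ & ₀ & ₁ & ₀ & ₁ & ₀ & ₁ & ₂ &
   ₁ & ₀ & ₁ & ₀ & ₂ & ₁ & ₀ & ₁ & ₀ & ₁ & ₂ & [] ∷ [])

realise-4-6-16 : Realisable ((4 , 1) ∷ (6 , 1) ∷ (16 , 1) ∷ [])
realise-4-6-16 = viaℤ
  (plan 95 0 (1 & 2 & 3 & [])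
    (4 & 5 & 6 & 7 & 0 & 3 & [] ∷
     8 & 9 & 10 & 11 & 12 & 2 & 3 & 4 & 13 & 14 & 15 & 16 & 17 & 18 & 19 & 20 & [] ∷
     2 & 1 & 21 & 22 & 23 & 12 & [] ∷
     24 & 25 & 26 & 27 & 28 & 29 & 30 & 31 & 32 & 33 & 34 & 35 & 7 & 0 & 1 & 21 & [] ∷
     13 & 36 & 5 & 4 & [] ∷
     37 & 38 & 39 & 40 & 41 & 42 & 43 & 44 & 45 & 36 & 5 & 6 & 46 & 47 & 48 & 49 & [] ∷
     35 & 46 & 6 & 7 & [] ∷ 35 & 46 & 47 & 8 & 9 & 34 & [] ∷ 9 & 34 & 33 & 10 & [] ∷
     11 & 50 & 51 & 32 & 33 & 10 & [] ∷ 11 & 50 & 23 & 12 & [] ∷ 28 & 14 & 13 & 36 & 45 & 29 & [] ∷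
     28 & 14 & 15 & 27 & [] ∷ 52 & 16 & 15 & 27 & 26 & 53 & [] ∷ 52 & 16 & 17 & 54 & [] ∷
     18 & 55 & 56 & 57 & 54 & 17 & [] ∷ 58 & 19 & 18 & 55 & [] ∷ 49 & 59 & 58 & 19 & 20 & 48 & [] ∷
     47 & 8 & 20 & 48 & [] ∷ 60 & 24 & 21 & 22 & [] ∷
     61 & 62 & 63 & 60 & 22 & 23 & 50 & 51 & 64 & 65 & 66 & 67 & 68 & 69 & 70 & 71 & [] ∷
     72 & 63 & 60 & 24 & 25 & 73 & [] ∷ 25 & 73 & 53 & 26 & [] ∷ 45 & 29 & 30 & 44 & [] ∷
     30 & 44 & 43 & 65 & 64 & 31 & [] ∷ 64 & 31 & 32 & 51 & [] ∷ 37 & 74 & 75 & 76 & 77 & 38 & [] ∷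
     77 & 38 & 39 & 78 & [] ∷ 79 & 80 & 78 & 39 & 40 & 81 & [] ∷ 41 & 82 & 81 & 40 & [] ∷
     66 & 42 & 41 & 82 & 83 & 67 & [] ∷ 66 & 42 & 43 & 65 & [] ∷ 37 & 74 & 59 & 49 & [] ∷
     84 & 85 & 86 & 87 & 83 & 82 & 81 & 79 & 56 & 55 & 58 & 59 & 74 & 75 & 88 & 89 & [] ∷
     79 & 80 & 57 & 56 & [] ∷ 61 & 84 & 85 & 90 & 91 & 62 & [] ∷ 91 & 62 & 63 & 72 & [] ∷
     83 & 67 & 68 & 87 & [] ∷ 92 & 69 & 68 & 87 & 86 & 93 & [] ∷ 70 & 94 & 92 & 69 & [] ∷
     89 & 71 & 70 & 94 & 95 & 88 & [] ∷ 61 & 84 & 89 & 71 & [] ∷ 75 & 76 & 95 & 88 & [] ∷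
     90 & 91 & 72 & 73 & 53 & 52 & 54 & 57 & 80 & 78 & 77 & 76 & 95 & 94 & 92 & 93 & [] ∷
     85 & 90 & 93 & 86 & [] ∷ [])
    (14 / 0 & 14 / 5 & 15 / 0 & 15 / 3 & 16 / 3 & 16 / 4 & 22 / 0 & 22 / 5 & 23 / 1 & 23 / 2 &
     34 / 2 & 34 / 3 & 34 / 4 & 34 / 5 & 34 / 6 & 34 / 7 & 35 / 0 & 35 / 1 & 35 / 2 & 36 / 3 &
     36 / 4 & 37 / 0 & 37 / 3 & 45 / 1 & 45 / 2 & 45 / 3 & [])
    (31 / 3 / true & 30 / 1 / false & 29 / 5 / false & 29 / 0 / false & 35 / 1 / false &
     16 / 3 / false & 15 / 3 / false & 14 / 5 / true & 23 / 1 / true & 22 / 5 / false &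
     37 / 3 / false & 36 / 3 / true & 44 / 15 / true & 39 / 4 / true & 34 / 2 / false &
     34 / 3 / false & []))
  (₀ & ₁ & ₀ & ₁ & ₂ & ₁ & ₀ & ₁ & ₀ & ₁ & ₀ & ₁ & ₀ & ₁ & ₂ & ₁ & ₀ & ₁ & ₀ & ₂ & ₁ & ₀ & ₁ & ₀ & ₁
   & ₂ & [] ∷ ₀ & ₂ & ₁ & ₀ & ₁ & ₀ & ₁ & ₀ & ₁ & ₀ & ₁ & ₀ & ₁ & ₀ & ₁ & ₂ & ₁ & ₀ & ₁ & ₀ & ₂ & ₁
   & ₀ & ₁ & ₀ & ₁ & ₂ & ₁ & ₀ & ₁ & [] ∷ [])

realise-4-6-20 : Realisable ((4 , 1) ∷ (6 , 1) ∷ (20 , 1) ∷ [])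
realise-4-6-20 = viaℤ
  (plan 59 0 (1 & 2 & 3 & [])
    (3 & 0 & 4 & 5 & 6 & 7 & [] ∷
     8 & 9 & 10 & 11 & 12 & 13 & 14 & 15 & 16 & 17 & 18 & 19 & 20 & 21 & 22 & 1 & 0 & 4 & 23 & 24 & [] ∷
     1 & 2 & 25 & 26 & 27 & 22 & [] ∷
     28 & 29 & 30 & 31 & 32 & 33 & 34 & 35 & 7 & 3 & 2 & 25 & 36 & 37 & 38 & 39 & 40 & 41 & 42 & 43 & [] ∷
     4 & 5 & 44 & 23 & [] ∷
     45 & 46 & 47 & 48 & 49 & 50 & 51 & 52 & 53 & 44 & 5 & 6 & 54 & 55 & 27 & 26 & 56 & 57 & 58 & 59 & [] ∷
     6 & 7 & 35 & 54 & [] ∷ 45 & 28 & 29 & 8 & 9 & 46 & [] ∷ 41 & 16 & 15 & 42 & [] ∷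
     41 & 16 & 17 & 50 & 49 & 40 & [] ∷ 17 & 50 & 51 & 18 & [] ∷ 18 & 51 & 52 & 32 & 33 & 19 & [] ∷
     33 & 19 & 20 & 34 & [] ∷ 54 & 35 & 34 & 20 & 21 & 55 & [] ∷ 21 & 55 & 27 & 22 & [] ∷
     23 & 44 & 53 & 31 & 30 & 24 & [] ∷ 29 & 8 & 24 & 30 & [] ∷ 36 & 56 & 26 & 25 & [] ∷
     52 & 32 & 31 & 53 & [] ∷ 36 & 56 & 57 & 13 & 12 & 37 & [] ∷ 12 & 37 & 38 & 11 & [] ∷
     11 & 38 & 39 & 48 & 47 & 10 & [] ∷ 49 & 40 & 39 & 48 & [] ∷ 9 & 46 & 47 & 10 & [] ∷
     57 & 13 & 14 & 58 & [] ∷ 43 & 59 & 58 & 14 & 15 & 42 & [] ∷ 45 & 28 & 43 & 59 & [] ∷ [])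
    (6 / 0 & 6 / 1 & 20 / 3 & 20 / 4 & 21 / 0 & 21 / 3 & 22 / 0 & 22 / 5 & 24 / 0 & 24 / 1 &
     24 / 3 & 25 / 1 & 25 / 2 & 26 / 0 & 26 / 3 & 26 / 4 & 26 / 5 & 27 / 0 & 27 / 1 & 27 / 2 & [])
    (8 / 4 / false & 6 / 0 / true & 8 / 0 / false & 4 / 19 / true & 4 / 18 / true & 9 / 2 / true &
     2 / 6 / true & 2 / 5 / true & 2 / 4 / true & 2 / 3 / true & 2 / 2 / true & 2 / 1 / true & []))
  (₀ & ₁ & ₀ & ₁ & ₂ & ₁ & ₀ & ₁ & ₀ & ₁ & ₀ & ₁ & ₀ & ₁ & ₀ & ₁ & ₀ & ₁ & ₀ & ₂ & ₁ & ₀ & ₁ & ₀ & ₂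
   & ₁ & ₀ & ₁ & ₀ & ₁ & ₀ & ₁ & ₀ & ₁ & ₀ & ₁ & ₀ & ₁ & ₀ & ₂ & [] ∷ ₀ & ₂ & ₁ & ₀ & ₁ & ₀ & ₁ & ₀
   & ₂ & ₁ & ₀ & ₁ & ₀ & ₂ & ₁ & ₀ & ₁ & ₀ & ₁ & ₂ & ₁ & ₀ & ₁ & [] ∷ [])

realise-4-8-10 : Realisable ((4 , 1) ∷ (8 , 1) ∷ (10 , 1) ∷ [])
realise-4-8-10 = viaℤ
  (plan 79 0 (1 & 2 & 3 & [])
    (3 & 0 & 4 & 5 & 6 & 7 & 8 & 9 & [] ∷ 0 & 4 & 10 & 11 & 12 & 13 & 14 & 15 & 16 & 1 & [] ∷
     16 & 17 & 18 & 19 & 20 & 21 & 2 & 1 & [] ∷ 3 & 9 & 22 & 23 & 24 & 25 & 26 & 27 & 21 & 2 & [] ∷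
     4 & 5 & 28 & 10 & [] ∷ 5 & 6 & 29 & 30 & 17 & 18 & 31 & 32 & 33 & 28 & [] ∷
     6 & 7 & 34 & 29 & [] ∷ 35 & 36 & 37 & 38 & 8 & 7 & 34 & 39 & 40 & 41 & [] ∷
     8 & 9 & 22 & 38 & [] ∷ 42 & 27 & 26 & 33 & 28 & 10 & 11 & 43 & [] ∷ 12 & 44 & 43 & 11 & [] ∷
     45 & 13 & 12 & 44 & 46 & 47 & 48 & 49 & [] ∷ 45 & 13 & 14 & 50 & [] ∷
     15 & 30 & 29 & 34 & 39 & 51 & 50 & 14 & [] ∷ 15 & 30 & 17 & 16 & [] ∷ 18 & 19 & 52 & 31 & [] ∷
     53 & 54 & 46 & 44 & 43 & 42 & 20 & 19 & 52 & 55 & [] ∷ 20 & 21 & 27 & 42 & [] ∷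
     38 & 22 & 23 & 56 & 57 & 58 & 59 & 37 & [] ∷ 23 & 56 & 60 & 24 & [] ∷
     55 & 61 & 60 & 24 & 25 & 32 & 31 & 52 & [] ∷ 25 & 32 & 33 & 26 & [] ∷
     62 & 63 & 64 & 35 & 36 & 65 & 66 & 67 & [] ∷ 36 & 65 & 59 & 37 & [] ∷ 64 & 35 & 41 & 68 & [] ∷
     54 & 69 & 47 & 46 & [] ∷ 65 & 66 & 48 & 47 & 69 & 70 & 71 & 72 & 58 & 59 & [] ∷
     66 & 67 & 49 & 48 & [] ∷ 62 & 67 & 49 & 45 & 50 & 51 & 73 & 74 & 75 & 76 & [] ∷
     76 & 77 & 78 & 53 & 54 & 69 & 70 & 75 & [] ∷ 78 & 53 & 55 & 61 & [] ∷
     63 & 64 & 68 & 79 & 57 & 56 & 60 & 61 & 78 & 77 & [] ∷ 57 & 58 & 72 & 79 & [] ∷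
     62 & 63 & 77 & 76 & [] ∷ 70 & 75 & 74 & 71 & [] ∷ 72 & 79 & 68 & 41 & 40 & 73 & 74 & 71 & [] ∷
     39 & 51 & 73 & 40 & [] ∷ [])
    (8 / 7 & 8 / 8 & 8 / 9 & 14 / 4 & 14 / 5 & 23 / 1 & 23 / 2 & 25 / 0 & 25 / 2 & 25 / 3 & 29 / 5 &
     29 / 6 & 29 / 7 & 29 / 8 & 29 / 9 & 34 / 1 & 34 / 2 & 34 / 3 & [])
    (30 / 0 / true & 29 / 8 / true & 29 / 7 / true & 29 / 6 / true & 29 / 5 / true & 14 / 4 / true &
     8 / 7 / false & 8 / 8 / false & 25 / 2 / false & 25 / 3 / false & 23 / 1 / true &
     32 / 9 / true & []))
  (₀ & ₁ & ₂ & ₁ & ₀ & ₁ & ₀ & ₁ & ₂ & ₁ & ₀ & ₁ & ₀ & ₁ & ₀ & ₁ & ₀ & ₂ & ₁ & ₀ & ₁ & ₀ & ₁ & ₂ & ₁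
   & [] ∷ ₀ & ₁ & ₀ & ₁ & ₂ & ₁ & ₀ & ₁ & ₀ & ₁ & ₀ & ₂ & ₁ & ₀ & ₁ & ₀ & ₁ & ₀ & ₁ & ₂ & ₁ & ₀ & ₁
   & ₀ & ₁ & ₂ & [] ∷ [])

realise-4-8-12 : Realisable ((4 , 1) ∷ (8 , 1) ∷ (12 , 1) ∷ [])
realise-4-8-12 = via𝔻
  (plan 47 0 (1 & 2 & 3 & 4 & 5 & 6 & 7 & 8 & 9 & 10 & 11 & [])
    (12 & 13 & 14 & 0 & 1 & 15 & 16 & 17 & [] ∷ 1 & 15 & 18 & 2 & [] ∷
     19 & 20 & 21 & 3 & 2 & 18 & 22 & 23 & [] ∷ 21 & 3 & 4 & 24 & [] ∷
     5 & 25 & 26 & 27 & 28 & 29 & 24 & 4 & [] ∷ 6 & 30 & 25 & 5 & [] ∷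
     31 & 7 & 6 & 30 & 32 & 33 & 34 & 35 & [] ∷ 31 & 7 & 8 & 36 & [] ∷
     37 & 38 & 39 & 40 & 36 & 8 & 9 & 41 & [] ∷ 42 & 10 & 9 & 41 & [] ∷
     11 & 43 & 44 & 45 & 46 & 47 & 42 & 10 & [] ∷ 14 & 0 & 11 & 43 & [] ∷ 12 & 13 & 40 & 39 & [] ∷
     13 & 14 & 43 & 44 & 19 & 23 & 27 & 28 & 35 & 31 & 36 & 40 & [] ∷ 16 & 17 & 46 & 47 & [] ∷
     12 & 17 & 46 & 45 & 20 & 21 & 24 & 29 & 34 & 33 & 38 & 39 & [] ∷ 44 & 45 & 20 & 19 & [] ∷
     15 & 16 & 47 & 42 & 41 & 37 & 32 & 30 & 25 & 26 & 22 & 18 & [] ∷ 22 & 23 & 27 & 26 & [] ∷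
     32 & 33 & 38 & 37 & [] ∷ 34 & 35 & 28 & 29 & [] ∷ [])
    (1 / 5 & 1 / 6 & 2 / 1 & 2 / 2 & 3 / 5 & 3 / 6 & 3 / 7 & 14 / 5 & 14 / 6 & 14 / 7 & 15 / 0 &
     15 / 2 & 15 / 3 & 16 / 2 & 16 / 3 & 16 / 4 & 16 / 5 & 16 / 6 & 16 / 7 & 21 / 2 & 21 / 3 & [])
    (5 / 3 / true & 14 / 5 / true & 3 / 6 / true & 3 / 5 / true & 2 / 1 / true & 1 / 5 / false &
     15 / 3 / true & 11 / 4 / true & 11 / 3 / true & 16 / 3 / false & 3 / 1 / false & 4 / 3 / true &
     5 / 5 / true & 5 / 4 / true & []))
  ((14 / 2 / false , + 0) & (11 / 6 / false , + 0) & (17 / 0 / false , + 0) &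
   (3 / 4 / false , + 0) & (19 / 0 / false , + 1) & (5 / 4 / false , + 1) & (21 / 0 / true , + 0) &
   (7 / 0 / true , + 0) & (8 / 0 / true , + 0) & (9 / 0 / true , + 0) & (13 / 0 / false , + 0) &
   (1 / 2 / false , + 0) & (12 / 2 / false , + 0) & (10 / 0 / false , + 0) &
   (0 / 10 / false , + 0) & (15 / 2 / false , -[1+ 0 ]) & (18 / 2 / true , + 0) &
   (2 / 0 / false , + 0) & (16 / 2 / true , + 0) & (4 / 0 / false , + 1) & (20 / 0 / true , + 0) &
   (6 / 0 / true , + 0) & [])
  (₁ & ₀ & ₁ & ₀ & ₁ & ₀ & ₁ & ₀ & ₂ & ₁ & ₀ & ₁ & ₀ & ₂ & ₁ & ₀ & ₁ & ₀ & ₂ & ₁ & ₀ & ₁ & ₂ & [] ∷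
   [])

realise-6²-7 : Realisable ((6 , 2) ∷ (7 , 1) ∷ [])
realise-6²-7 = viaℤ
  (plan 83 0 (1 & 2 & 3 & 4 & 5 & 6 & [])
    (3 & 7 & 8 & 9 & 10 & 2 & [] ∷ 10 & 2 & 1 & 11 & 12 & 13 & [] ∷ 0 & 14 & 15 & 16 & 11 & 1 & [] ∷
     17 & 18 & 14 & 0 & 6 & 19 & [] ∷ 20 & 5 & 6 & 19 & 21 & 22 & [] ∷
     4 & 23 & 24 & 25 & 20 & 5 & [] ∷ 26 & 27 & 23 & 4 & 3 & 7 & [] ∷
     28 & 29 & 30 & 31 & 9 & 8 & [] ∷ 9 & 10 & 13 & 32 & 33 & 34 & 31 & [] ∷
     35 & 12 & 11 & 16 & 36 & 37 & 38 & [] ∷ 12 & 13 & 32 & 39 & 40 & 35 & [] ∷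
     41 & 42 & 18 & 14 & 15 & 43 & 44 & [] ∷ 45 & 43 & 15 & 16 & 36 & 46 & [] ∷
     42 & 47 & 48 & 49 & 17 & 18 & [] ∷ 17 & 19 & 21 & 39 & 40 & 50 & 49 & [] ∷
     33 & 51 & 22 & 21 & 39 & 32 & [] ∷ 20 & 22 & 51 & 52 & 46 & 45 & 25 & [] ∷
     53 & 24 & 23 & 27 & 54 & 55 & 56 & [] ∷ 25 & 24 & 53 & 44 & 43 & 45 & [] ∷
     57 & 58 & 59 & 30 & 29 & 60 & 61 & [] ∷ 31 & 30 & 59 & 62 & 63 & 34 & [] ∷
     34 & 63 & 64 & 52 & 51 & 33 & [] ∷ 37 & 65 & 64 & 52 & 46 & 36 & [] ∷
     38 & 66 & 67 & 68 & 65 & 37 & [] ∷ 50 & 69 & 66 & 38 & 35 & 40 & [] ∷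
     41 & 57 & 58 & 70 & 47 & 42 & [] ∷ 61 & 56 & 53 & 44 & 41 & 57 & [] ∷
     47 & 48 & 71 & 72 & 73 & 74 & 70 & [] ∷ 75 & 71 & 48 & 49 & 50 & 69 & [] ∷
     70 & 58 & 59 & 62 & 76 & 74 & [] ∷ 76 & 77 & 68 & 65 & 64 & 63 & 62 & [] ∷
     78 & 75 & 69 & 66 & 67 & 79 & 80 & [] ∷ 79 & 81 & 82 & 77 & 68 & 67 & [] ∷
     78 & 55 & 54 & 72 & 71 & 75 & [] ∷ 72 & 54 & 27 & 26 & 83 & 73 & [] ∷
     83 & 73 & 74 & 76 & 77 & 82 & [] ∷ 80 & 60 & 29 & 28 & 81 & 79 & [] ∷
     56 & 61 & 60 & 80 & 78 & 55 & [] ∷ 81 & 82 & 83 & 26 & 7 & 8 & 28 & [] ∷ [])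
    (34 / 1 & 34 / 2 & 35 / 1 & 35 / 2 & 35 / 3 & 37 / 1 & 37 / 2 & 37 / 3 & 38 / 0 & 38 / 1 &
     38 / 2 & 38 / 5 & 39 / 3 & 39 / 4 & 39 / 5 & 39 / 6 & [])
    (8 / 5 / false & 8 / 0 / false & 20 / 4 / false & 20 / 5 / false & 27 / 0 / false &
     18 / 5 / true & 18 / 4 / true & 18 / 3 / true & 7 / 0 / true & 7 / 5 / true & 1 / 1 / false &
     []))
  (₁ & ₀ & ₁ & ₀ & ₁ & ₂ & ₁ & ₀ & ₁ & ₀ & ₁ & ₂ & ₁ & ₀ & ₁ & ₀ & ₁ & ₂ & ₁ & ₀ & ₁ & ₀ & ₂ & ₁ & ₀
   & ₁ & ₂ & [] ∷ ₀ & ₁ & ₀ & ₂ & ₁ & ₀ & ₁ & ₀ & ₁ & ₂ & ₁ & ₀ & ₁ & ₀ & ₁ & ₂ & ₁ & ₀ & ₁ & ₀ & ₁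
   & ₂ & ₁ & ₀ & ₁ & ₀ & ₂ & ₁ & [] ∷ [])

realise-8-6² : Realisable ((8 , 1) ∷ (6 , 2) ∷ [])
realise-8-6² = viaℤ
  (plan 47 0 (1 & 2 & 3 & 4 & 5 & 6 & 7 & [])
    (8 & 9 & 10 & 0 & 1 & 11 & [] ∷ 12 & 13 & 11 & 1 & 2 & 14 & [] ∷
     15 & 16 & 17 & 3 & 2 & 14 & [] ∷ 4 & 18 & 8 & 9 & 17 & 3 & [] ∷
     19 & 20 & 18 & 4 & 5 & 21 & [] ∷ 22 & 23 & 21 & 5 & 6 & 24 & [] ∷
     7 & 25 & 15 & 16 & 24 & 6 & [] ∷ 25 & 7 & 0 & 10 & 26 & 27 & [] ∷
     26 & 28 & 22 & 24 & 16 & 17 & 9 & 10 & [] ∷ 20 & 18 & 8 & 11 & 13 & 29 & 30 & 31 & [] ∷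
     32 & 33 & 12 & 13 & 29 & 34 & [] ∷ 35 & 33 & 12 & 14 & 15 & 25 & 27 & 36 & [] ∷
     31 & 37 & 38 & 39 & 19 & 20 & [] ∷ 40 & 39 & 19 & 21 & 23 & 41 & 42 & 43 & [] ∷
     23 & 22 & 28 & 44 & 45 & 41 & [] ∷ 46 & 36 & 27 & 26 & 28 & 44 & [] ∷
     40 & 35 & 33 & 32 & 38 & 39 & [] ∷ 43 & 47 & 46 & 36 & 35 & 40 & [] ∷
     42 & 30 & 31 & 37 & 45 & 41 & [] ∷ 43 & 47 & 34 & 29 & 30 & 42 & [] ∷
     46 & 44 & 45 & 37 & 38 & 32 & 34 & 47 & [] ∷ [])
    (19 / 1 & 19 / 2 & 19 / 3 & 20 / 2 & 20 / 3 & 20 / 4 & 21 / 3 & 21 / 4 & 21 / 5 & 21 / 6 & [])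
    (17 / 3 / true & 11 / 5 / true & 11 / 4 / true & 10 / 5 / false & 10 / 6 / false &
     13 / 0 / false & 13 / 1 / false & []))
  (₀ & ₁ & ₀ & ₁ & ₀ & ₁ & ₂ & ₁ & ₀ & ₁ & ₀ & ₁ & ₂ & ₁ & ₀ & ₁ & ₀ & ₁ & ₂ & [] ∷ ₀ & ₁ & ₀ & ₁ &
   ₂ & ₁ & ₀ & ₁ & ₀ & ₁ & ₂ & ₁ & ₀ & ₁ & ₀ & ₁ & ₂ & ₁ & ₀ & ₁ & [] ∷ [])

realise-9-6² : Realisable ((9 , 1) ∷ (6 , 2) ∷ [])
realise-9-6² = viaℤ
  (plan 35 0 (1 & 2 & 3 & 4 & 5 & 6 & 7 & 8 & [])
    (8 & 9 & 10 & 11 & 12 & 7 & [] ∷ 6 & 13 & 14 & 15 & 12 & 7 & [] ∷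
     5 & 16 & 17 & 18 & 13 & 6 & [] ∷ 4 & 19 & 20 & 21 & 16 & 5 & [] ∷
     19 & 4 & 3 & 22 & 23 & 24 & [] ∷ 25 & 2 & 3 & 22 & 26 & 27 & [] ∷
     28 & 29 & 25 & 2 & 1 & 30 & [] ∷ 15 & 14 & 30 & 1 & 0 & 31 & [] ∷
     0 & 31 & 32 & 33 & 9 & 8 & [] ∷ 9 & 10 & 17 & 16 & 21 & 26 & 22 & 23 & 33 & [] ∷
     32 & 29 & 25 & 27 & 34 & 11 & 12 & 15 & 31 & [] ∷
     14 & 30 & 28 & 24 & 19 & 20 & 35 & 18 & 13 & [] ∷ 17 & 18 & 35 & 34 & 11 & 10 & [] ∷
     27 & 26 & 21 & 20 & 35 & 34 & [] ∷ 23 & 24 & 28 & 29 & 32 & 33 & [] ∷ [])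
    (3 / 1 & 3 / 2 & 4 / 3 & 4 / 4 & 13 / 0 & 13 / 3 & 13 / 4 & 13 / 5 & 14 / 0 & 14 / 1 & 14 / 2 &
     14 / 5 & [])
    (10 / 4 / true & 4 / 3 / false & 3 / 1 / false & 10 / 1 / true & 1 / 2 / false & 11 / 4 / true &
     11 / 3 / true & 6 / 4 / true & []))
  (₁ & ₀ & ₁ & ₀ & ₁ & ₂ & ₁ & ₀ & ₁ & ₀ & ₁ & ₂ & ₁ & ₀ & ₁ & ₀ & ₁ & ₂ & [] ∷ ₀ & ₁ & ₀ & ₂ & ₁ &
   ₀ & ₁ & ₀ & ₂ & ₁ & ₀ & ₁ & ₀ & ₁ & ₂ & ₁ & ₀ & ₁ & ₂ & [] ∷ [])

realise-10-6² : Realisable ((10 , 1) ∷ (6 , 2) ∷ [])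
realise-10-6² = viaℤ
  (plan 29 0 (1 & 2 & 3 & 4 & 5 & 6 & 7 & 8 & 9 & [])
    (10 & 0 & 9 & 11 & 12 & 13 & [] ∷ 14 & 7 & 8 & 15 & 16 & 17 & [] ∷
     14 & 7 & 6 & 18 & 13 & 12 & [] ∷ 5 & 19 & 20 & 21 & 18 & 6 & [] ∷
     19 & 5 & 4 & 22 & 23 & 24 & [] ∷ 22 & 4 & 3 & 25 & 17 & 16 & [] ∷
     3 & 25 & 26 & 27 & 28 & 2 & [] ∷ 28 & 2 & 1 & 29 & 24 & 23 & [] ∷
     29 & 1 & 0 & 10 & 27 & 26 & [] ∷ 27 & 28 & 23 & 22 & 16 & 15 & 21 & 18 & 13 & 10 & [] ∷
     26 & 25 & 17 & 14 & 12 & 11 & 20 & 19 & 24 & 29 & [] ∷ 8 & 15 & 21 & 20 & 11 & 9 & [] ∷ [])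
    (6 / 4 & 6 / 5 & 10 / 4 & 10 / 5 & 11 / 2 & 11 / 3 & 11 / 4 & 11 / 5 & 12 / 0 & 12 / 1 &
     12 / 4 & 12 / 5 & [])
    (2 / 3 / true & 2 / 2 / true & 0 / 8 / false & 1 / 2 / false & 1 / 3 / false & 3 / 5 / false &
     2 / 5 / true & 2 / 4 / true & []))
  (₀ & ₁ & ₀ & ₁ & ₂ & ₁ & ₀ & ₁ & ₀ & ₁ & ₂ & ₁ & ₀ & ₁ & ₀ & ₁ & ₂ & [] ∷ ₁ & ₀ & ₁ & ₀ & ₁ & ₀ &
   ₁ & ₀ & ₂ & ₁ & ₀ & ₁ & ₀ & ₁ & ₂ & ₁ & ₀ & ₁ & ₀ & ₁ & ₂ & ₁ & [] ∷ [])

realise-5-8² : Realisable ((5 , 1) ∷ (8 , 2) ∷ [])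
realise-5-8² = viaℤ
  (plan 39 0 (1 & 2 & 3 & 4 & [])
    (5 & 1 & 2 & 6 & 7 & 8 & 9 & 10 & [] ∷ 11 & 12 & 5 & 1 & 0 & 13 & 14 & 15 & [] ∷
     16 & 17 & 10 & 9 & 18 & 4 & 0 & 13 & [] ∷ 18 & 4 & 3 & 19 & 14 & 15 & 20 & 21 & [] ∷
     22 & 23 & 19 & 3 & 2 & 6 & 24 & 25 & [] ∷ 24 & 26 & 27 & 7 & 6 & [] ∷
     28 & 29 & 8 & 7 & 27 & 30 & 31 & 32 & [] ∷ 21 & 29 & 8 & 9 & 18 & [] ∷
     33 & 12 & 5 & 10 & 17 & [] ∷ 19 & 14 & 13 & 16 & 23 & [] ∷ 34 & 11 & 15 & 20 & 35 & [] ∷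
     16 & 17 & 33 & 36 & 37 & 38 & 22 & 23 & [] ∷ 38 & 37 & 39 & 35 & 20 & 21 & 29 & 28 & [] ∷
     35 & 39 & 31 & 32 & 25 & 24 & 26 & 34 & [] ∷ 25 & 32 & 28 & 38 & 22 & [] ∷
     27 & 30 & 36 & 33 & 12 & 11 & 34 & 26 & [] ∷ 31 & 30 & 36 & 37 & 39 & [] ∷ [])
    (14 / 0 & 14 / 1 & 14 / 7 & 16 / 2 & 16 / 3 & 16 / 4 & 16 / 5 & 16 / 6 & 17 / 2 & 17 / 3 &
     17 / 4 & [])
    (13 / 1 / false & 13 / 2 / false & 11 / 4 / false & 11 / 0 / false & 2 / 0 / false &
     9 / 0 / true & 12 / 2 / false & 12 / 3 / false & []))
  (₁ & ₀ & ₁ & ₀ & ₂ & ₁ & ₀ & ₁ & ₀ & ₁ & ₂ & ₁ & ₀ & ₁ & ₀ & ₁ & ₂ & [] ∷ ₀ & ₁ & ₂ & ₁ & ₀ & ₁ &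
   ₀ & ₁ & ₀ & ₂ & ₁ & ₀ & ₁ & ₀ & ₁ & ₀ & ₂ & ₁ & [] ∷ [])

realise-6-8² : Realisable ((6 , 1) ∷ (8 , 2) ∷ [])
realise-6-8² = via𝔻
  (plan 23 0 (1 & 2 & 3 & 4 & 5 & 6 & 7 & [])
    (8 & 9 & 10 & 11 & 0 & 1 & 12 & 13 & [] ∷ 14 & 15 & 2 & 1 & 12 & 16 & [] ∷
     17 & 18 & 19 & 15 & 2 & 3 & 9 & 8 & [] ∷ 10 & 9 & 3 & 4 & 20 & 21 & [] ∷
     22 & 5 & 6 & 13 & 8 & 17 & [] ∷ 20 & 23 & 7 & 6 & 13 & 12 & 16 & 21 & [] ∷
     18 & 19 & 23 & 7 & 0 & 11 & [] ∷ 16 & 21 & 10 & 11 & 18 & 17 & 22 & 14 & [] ∷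
     23 & 20 & 4 & 5 & 22 & 14 & 15 & 19 & [] ∷ [])
    (0 / 4 & 0 / 5 & 4 / 3 & 4 / 4 & 4 / 5 & 5 / 0 & 5 / 1 & 8 / 0 & 8 / 1 & 8 / 6 & 8 / 7 & [])
    (2 / 5 / false & 8 / 6 / true & 5 / 0 / false & 0 / 4 / true & 4 / 3 / false & 4 / 4 / false &
     6 / 6 / true & []))
  -- The mirror is a half turn on the octagon 9, which alone lies between C and its image; hence its
  -- height 1.
  ((3 / 6 / true , + 0) & (1 / 4 / false , + 0) & (4 / 3 / true , + 0) & (0 / 6 / true , + 0) &
   (2 / 3 / true , + 0) & (7 / 1 / true , + 0) & (8 / 6 / true , + 0) & (5 / 1 / true , + 0) &
   (6 / 6 / true , + 0) & (9 / 4 / false , + 1) & [])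
  (₀ & ₂ & ₁ & ₀ & ₁ & ₀ & ₂ & ₁ & ₀ & ₁ & ₀ & ₂ & ₁ & ₀ & ₁ & [] ∷ ₀ & ₁ & ₀ & ₁ & ₀ & ₁ & ₂ & ₁ &
   ₀ & ₁ & ₀ & ₂ & ₁ & ₀ & ₁ & ₀ & ₁ & ₂ & [] ∷ [])

realise-4-10² : Realisable ((4 , 1) ∷ (10 , 2) ∷ [])
realise-4-10² = viaℤ
  (plan 39 0 (1 & 2 & 3 & 4 & 5 & 6 & 7 & 8 & 9 & [])
    (10 & 11 & 1 & 2 & 12 & 13 & 14 & 15 & 16 & 17 & [] ∷ 18 & 3 & 2 & 12 & [] ∷
     19 & 20 & 4 & 3 & 18 & 21 & 22 & 23 & 24 & 25 & [] ∷ 26 & 20 & 4 & 5 & [] ∷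
     23 & 22 & 27 & 28 & 29 & 30 & 6 & 5 & 26 & 31 & [] ∷ 32 & 30 & 6 & 7 & [] ∷
     33 & 32 & 7 & 8 & 13 & 12 & 18 & 21 & 34 & 35 & [] ∷ 8 & 9 & 14 & 13 & [] ∷
     0 & 9 & 14 & 15 & 29 & 30 & 32 & 33 & 36 & 37 & [] ∷ 11 & 37 & 0 & 1 & [] ∷
     19 & 20 & 26 & 31 & 38 & 39 & 36 & 37 & 11 & 10 & [] ∷ 29 & 15 & 16 & 28 & [] ∷
     17 & 16 & 28 & 27 & 34 & 35 & 39 & 38 & 24 & 25 & [] ∷ 25 & 17 & 10 & 19 & [] ∷
     34 & 27 & 22 & 21 & [] ∷ 39 & 35 & 33 & 36 & [] ∷ 31 & 38 & 24 & 23 & [] ∷ [])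
    (11 / 0 & 11 / 1 & 11 / 2 & 11 / 3 & 13 / 8 & 13 / 9 & 14 / 0 & 14 / 3 & 17 / 0 & 17 / 2 &
     17 / 3 & [])
    (3 / 9 / true & 3 / 8 / true & 3 / 7 / true & 5 / 9 / true & 5 / 8 / true & 4 / 0 / false &
     3 / 0 / true & []))
  (₀ & ₁ & ₀ & ₂ & ₁ & ₀ & ₁ & ₀ & ₁ & ₀ & ₁ & ₂ & ₁ & ₀ & ₁ & ₀ & ₂ & ₁ & [] ∷ ₁ & ₀ & ₁ & ₀ & ₁ &
   ₀ & ₂ & ₁ & ₀ & ₁ & ₀ & ₂ & ₁ & ₀ & ₁ & ₀ & ₁ & ₀ & ₁ & ₂ & ₁ & [] ∷ [])

realise-3-14² : Realisable ((3 , 1) ∷ (14 , 2) ∷ [])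
realise-3-14² = viaℤ
  (plan 83 0 (1 & 2 & [])
    (3 & 4 & 5 & 6 & 7 & 8 & 9 & 1 & 2 & 10 & 11 & 12 & 13 & 14 & [] ∷
     15 & 16 & 17 & 0 & 2 & 10 & 18 & 19 & 20 & 21 & 22 & 23 & 24 & 25 & [] ∷
     26 & 27 & 28 & 29 & 30 & 31 & 32 & 33 & 34 & 35 & 9 & 1 & 0 & 17 & [] ∷
     15 & 16 & 26 & 27 & 36 & 37 & 3 & 4 & 38 & 39 & 40 & 41 & 42 & 43 & [] ∷ 5 & 38 & 4 & [] ∷
     39 & 38 & 5 & 6 & 44 & 45 & 23 & 22 & 46 & 47 & 48 & 49 & 50 & 51 & [] ∷ 44 & 7 & 6 & [] ∷
     25 & 24 & 45 & 44 & 7 & 8 & 35 & 34 & 52 & 53 & 54 & 55 & 42 & 43 & [] ∷ 35 & 8 & 9 & [] ∷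
     11 & 18 & 10 & [] ∷ 19 & 18 & 11 & 12 & 56 & 57 & 58 & 59 & 60 & 61 & 62 & 63 & 64 & 65 & [] ∷
     56 & 13 & 12 & [] ∷ 36 & 37 & 14 & 13 & 56 & 57 & 66 & 67 & 68 & 69 & 70 & 71 & 29 & 28 & [] ∷
     14 & 3 & 37 & [] ∷ 17 & 26 & 16 & [] ∷ 65 & 19 & 20 & [] ∷
     21 & 20 & 65 & 64 & 72 & 73 & 74 & 75 & 68 & 69 & 76 & 77 & 47 & 46 & [] ∷ 46 & 21 & 22 & [] ∷
     45 & 23 & 24 & [] ∷ 43 & 25 & 15 & [] ∷ 28 & 36 & 27 & [] ∷ 71 & 30 & 29 & [] ∷
     30 & 31 & 78 & 79 & 60 & 61 & 80 & 81 & 49 & 48 & 77 & 76 & 70 & 71 & [] ∷ 78 & 31 & 32 & [] ∷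
     53 & 52 & 33 & 32 & 78 & 79 & 59 & 58 & 66 & 67 & 75 & 74 & 82 & 83 & [] ∷ 33 & 34 & 52 & [] ∷
     51 & 39 & 40 & [] ∷ 41 & 40 & 51 & 50 & 81 & 80 & 62 & 63 & 72 & 73 & 82 & 83 & 54 & 55 & [] ∷
     55 & 41 & 42 & [] ∷ 77 & 48 & 47 & [] ∷ 81 & 49 & 50 & [] ∷ 83 & 53 & 54 & [] ∷
     58 & 66 & 57 & [] ∷ 64 & 63 & 72 & [] ∷ 67 & 68 & 75 & [] ∷ 70 & 69 & 76 & [] ∷
     79 & 60 & 59 & [] ∷ 61 & 62 & 80 & [] ∷ 74 & 73 & 82 & [] ∷ [])
    (23 / 4 & 23 / 5 & 25 / 6 & 25 / 7 & 25 / 8 & 25 / 9 & 25 / 10 & 25 / 11 & 28 / 6 & 28 / 7 &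
     28 / 8 & 28 / 9 & 37 / 1 & 37 / 2 & 38 / 0 & 38 / 1 & 39 / 0 & 39 / 1 & [])
    (11 / 10 / false & 28 / 7 / false & 17 / 4 / false & 17 / 5 / false & 17 / 6 / false &
     25 / 9 / true & 13 / 6 / true & 25 / 7 / true & 11 / 6 / false & 11 / 7 / false &
     11 / 8 / false & 11 / 9 / false & []))
  (₀ & ₁ & ₂ & ₁ & ₀ & ₁ & ₀ & ₁ & ₀ & ₂ & ₁ & ₀ & ₁ & ₀ & ₁ & ₀ & ₁ & ₀ & ₂ & ₁ & ₀ & ₁ & ₀ & ₁ & ₀
   & ₁ & ₀ & ₁ & ₂ & ₁ & [] ∷ ₀ & ₁ & ₀ & ₂ & ₁ & ₀ & ₁ & ₀ & ₁ & ₀ & ₁ & ₀ & ₁ & ₀ & ₂ & ₁ & ₀ & ₁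
   & ₀ & ₂ & ₁ & ₀ & ₁ & ₀ & ₂ & ₁ & ₀ & ₁ & ₀ & ₁ & ₂ & [] ∷ [])

realise-7³ : Realisable ((7 , 3) ∷ [])
realise-7³ = viaℤ
  (plan 27 0 (1 & 2 & 3 & 4 & 5 & 6 & [])
    (7 & 5 & 6 & 8 & 9 & 10 & 11 & [] ∷ 12 & 13 & 14 & 0 & 6 & 8 & 15 & [] ∷
     16 & 14 & 0 & 1 & 9 & 10 & 17 & [] ∷ 18 & 2 & 1 & 9 & 8 & 15 & 19 & [] ∷
     20 & 18 & 2 & 3 & 13 & 14 & 16 & [] ∷ 21 & 12 & 13 & 3 & 4 & 22 & 23 & [] ∷
     24 & 25 & 26 & 22 & 4 & 5 & 7 & [] ∷ 11 & 10 & 17 & 23 & 22 & 26 & 27 & [] ∷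
     19 & 15 & 12 & 21 & 25 & 26 & 27 & [] ∷ 20 & 16 & 17 & 23 & 21 & 25 & 24 & [] ∷
     20 & 24 & 7 & 11 & 27 & 19 & 18 & [] ∷ [])
    (9 / 4 & 9 / 5 & 9 / 6 & 10 / 5 & 10 / 6 & 11 / 1 & 11 / 2 & 11 / 3 & 11 / 4 & [])
    (7 / 0 / false & 7 / 1 / false & 8 / 5 / false & 8 / 6 / false & 1 / 6 / false & 7 / 6 / false &
     []))
  (₀ & ₁ & ₂ & ₁ & ₀ & ₁ & ₀ & ₁ & ₂ & ₁ & ₀ & ₁ & ₀ & ₂ & ₁ & [] ∷ ₀ & ₁ & ₀ & ₁ & ₀ & ₂ & ₁ & ₀ &
   ₁ & ₀ & ₁ & ₂ & ₁ & ₀ & ₁ & ₂ & [] ∷ [])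

realisable : All Realisable types
realisable =
  realise-3⁷ ∷ realise-3⁵-4 ∷ realise-3⁴-4² ∷ realise-3³-4-3-4 ∷ realise-3⁵-5 ∷ realise-3⁴-7 ∷
  realise-3⁴-8 ∷ realise-3⁴-9 ∷ realise-3⁴-10 ∷ realise-3²-5-3-5 ∷ realise-3³-4-6 ∷
  realise-3²-4-3-6 ∷ realise-3-4-3-4² ∷ realise-3-4⁴ ∷ realise-3-7-3-7 ∷ realise-3-4-7-4 ∷
  realise-3-4-8-4 ∷ realise-4³-5 ∷ realise-3-4-9-4 ∷ realise-3-4-10-4 ∷ realise-3-5³ ∷
  realise-3-6-4-6 ∷ realise-4-6-18 ∷ realise-4³-6 ∷ realise-5-4-5-4 ∷ realise-4-6-14 ∷
  realise-4-6-16 ∷ realise-4-6-20 ∷ realise-4-8-10 ∷ realise-4-8-12 ∷ realise-6²-7 ∷ realise-8-6² ∷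
  realise-9-6² ∷ realise-10-6² ∷ realise-5-8² ∷ realise-6-8² ∷ realise-4-10² ∷ realise-3-14² ∷
  realise-7³ ∷ []

corollary1p1 : ∀ (X : VertexType) → X ∈ types → ∀ (m : ℕ) → 2 ≤ m →
    Σ[ Kᵐ ∈ PolyhedralMap ]
    ( SemiEquivelar Kᵐ X
    × (Σ[ K ∈ PolyhedralMap ]
    ( SemiEquivelar K X
    × PolyhedralMap.χ K ≡ - (+ 2)
    × IsCovering m K Kᵐ ))
    × PolyhedralMap.χ Kᵐ ≡ - (+ (2 * m))
    × (Aut Kᵐ ≅ 𝔻 m ⊎ Aut Kᵐ ≅ ℤ/ m) )
corollary1p1 X X∈types = All.lookup realisable X∈types
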